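{- Let $n$ be a positive integer and let $\lambda=(1^{m_1}2^{m_2}\cdots)$ be a partition of $n$ (with $m_i$ parts of size $i$ for each $i\ge 1$). Let $\mathfrak{S}_n(\lambda)$ be the set of permutations in $\mathfrak{S}_n$ of cycle type $\lambda$, and let $z_\lambda=\prod_{i\ge1} i^{m_i}m_i!$. Then $$\sum_{\pi\in\mathfrak{S}_n(\lambda)} s^{\mathrm{cval}(\pi)}t^{\mathrm{exc}(\pi)}=\frac{n!}{z_\lambda}\left(\frac{1+u}{1+uv}\right)^{n-m_1}\prod_{i\ge1}\left[\frac{A_{i-1}(v)}{(i-1)!}\right]^{m_i},$$ where $$u=\frac{1+t^2-2st-(1-t)\sqrt{(1+t)^2-4st}}{2(1-s)t},\qquad v=\frac{(1+t)^2-2st-(1+t)\sqrt{(1+t)^2-4st}}{2st}.$$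
   Context: $[n]=\{1,\dots,n\}$ and $\mathfrak{S}_n$ is the symmetric group on $[n]$. For $\pi\in\mathfrak{S}_n$, an excedance of $\pi$ is an $i\in[n]$ with $i<\pi(i)$, and $\mathrm{exc}(\pi)$ is the number of excedances. A cyclic valley of $\pi$ is an $i\in[n]$ with $\pi^{ -1}(i)>i<\pi(i)$, and $\mathrm{cval}(\pi)$ is the number of cyclic valleys. The Eulerian polynomials are $A_0(t)=1$ and, for $n\ge1$, $A_n(t)=\sum_{\pi\in\mathfrak{S}_n}t^{\mathrm{des}(\pi)+1}=\sum_{\pi\in\mathfrak{S}_n}t^{\mathrm{exc}(\pi)+1}$, where $\mathrm{des}(\pi)$ is the number of $i\in[n-1]$ with $\pi(i)>\pi(i+1)$. The identity is understood in the ring of formal power series in $t$ with coefficients in $\mathbb{Q}[s]$; $\sqrt{(1+t)^2-4st}$ denotes the power series in $t$ with constant term $1$ (then $u$ and $v$ are well-defined power series in $t$ with coefficients in $\mathbb{Q}[s]$ and zero constant term). -}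

module Defs where

open import Algebra.Bundles using (CommutativeMonoid; CommutativeRing; RawRing)
open import Algebra.Solver.Ring.AlmostCommutativeRing
  using (_-Raw-AlmostCommutative⟶_; fromCommutativeRing)
import Algebra.Morphism.RingMonomorphism as RingMonomorphism
import Algebra.Properties.CommutativeSemigroup as CommutativeSemigroupProperties
import Algebra.Properties.Ring as RingProperties
import Algebra.Properties.Semiring.Exp as Exp
import Algebra.Properties.Semiring.Sum as Sum
import Algebra.Solver.Ring as RingSolver
import Data.Bool.Properties as Bool
open import Data.Fin.Base as Fin using (Fin; toℕ)
open import Data.Fin.Patterns using (0F)
open import Data.Fin.Permutation as Perm
  using (Permutation′; _⟨$⟩ʳ_; _⟨$⟩ˡ_; _∘ₚ_; transpose; lift₀; remove)
open import Data.Fin.Permutation.Components as PC using ()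
import Data.Fin.Properties as Fin
open import Data.Fin.Subset using (Subset; ∣_∣)
open import Data.Integer.Base using (+_)
open import Data.List.Base
  using (List; []; _∷_; allFin; upTo; cartesianProductWith; deduplicate; filter; foldr; length; map)
import Data.List.Properties as List
open import Data.List.Membership.Propositional.Properties using (∈-allFin)
import Data.List.Membership.Setoid as SetoidMembership
open import Data.List.Relation.Unary.All using (All; [])
import Data.List.Relation.Unary.All as All
import Data.List.Relation.Unary.All.Properties as All
open import Data.List.Relation.Unary.AllPairs using ([]; _∷_)
open import Data.List.Relation.Unary.Any using (here)
import Data.List.Relation.Unary.Any.Properties as Any
import Data.List.Relation.Unary.Sorted.TotalOrder as SortedList
import Data.List.Relation.Unary.Unique.Propositional.Properties as Unique
import Data.List.Relation.Unary.Unique.Setoid as UniqueList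
import Data.List.Relation.Unary.Unique.Setoid.Properties as UniqueSetoid
import Data.List.Sort.InsertionSort as InsertionSort
open import Data.Maybe.Base using (Maybe; just; nothing)
open import Data.Nat.Base as ℕ using (ℕ; zero; suc; _≤_; _<_; _∸_; z≤n; s≤s; NonZero; _!)
open import Data.Nat.GeneralisedArithmetic using (iterate)
import Data.Nat.ListAction as ℕ using (sum; product)
open import Data.Nat.ListAction.Properties using (product≢0)
import Data.Nat.Properties as ℕ
open import Data.Product.Base using (_×_; _,_)
open import Data.Rational.Base as ℚ using (ℚ; _/_)
import Data.Rational.Properties as ℚ
open import Data.Vec.Base using (tabulate)
open import Data.Vec.Properties using (≡-dec)
open import Function.Base using (_∘_)
open import Level using (0ℓ)
open import Relation.Binary.Bundles using (Setoid)
open import Relation.Binary.PropositionalEquality as ≡ using (_≡_; refl; cong)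
import Relation.Binary.Reasoning.Setoid as ≈-Reasoning
open import Relation.Nullary using (yes; no; does; contradiction)
open import Relation.Nullary.Decidable using (_×-dec_)
open import Relation.Unary using (Pred; Decidable)

module PowerSeries {c ℓ} (R : CommutativeRing c ℓ) where

  private
    module R = CommutativeRing R

  open Sum R.semiring using (sum)

  Series : Set c
  Series = ℕ → R.Carrier

  infix 4 _≈_
  infix 8 -_
  infixl 7 _*_
  infixl 6 _+_

  record _≈_ (f g : Series) : Set ℓ where
    constructor ext
    field at : ∀ n → f n R.≈ g n

  open _≈_ public

  _+_ _*_ : Series → Series → Series
  (f + g) n = f n R.+ g n
  (f * g) n = sum {suc n} λ i → f (toℕ i) R.* g (n ∸ toℕ i)

  -_ : Series → Series
  (- f) n = R.- f n

  const : R.Carrier → Series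
  const a zero    = a
  const a (suc n) = R.0#

  0# 1# X : Series
  0# = const R.0#
  1# = const R.1#
  X zero          = R.0#
  X (suc zero)    = R.1#
  X (suc (suc n)) = R.0#

  open ≈-Reasoning R.setoid
  open CommutativeSemigroupProperties (CommutativeMonoid.commutativeSemigroup R.+-commutativeMonoid)
    using (interchange)

  -- The sum defining (f * g) (suc n) unfolds to
  -- f 0 * g (suc n) + ((f ∘ suc) * g) n, so inductions on n peel off f.

  *-local : ∀ n {f f′ g g′ : Series} →
            (∀ i → i ≤ n → f i R.≈ f′ i) → (∀ i → i ≤ n → g i R.≈ g′ i) →
            (f * g) n R.≈ (f′ * g′) n
  *-local zero    p q = R.+-congʳ (R.*-cong (p 0 z≤n) (q 0 z≤n))
  *-local (suc n) p q = R.+-cong (R.*-cong (p 0 z≤n) (q (suc n) ℕ.≤-refl))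
    (*-local n (λ i i≤n → p (suc i) (s≤s i≤n)) (λ i i≤n → q i (ℕ.m≤n⇒m≤1+n i≤n)))

  private
    *-cong : ∀ {f f′ g g′} → f ≈ f′ → g ≈ g′ → f * g ≈ f′ * g′
    *-cong p q = ext λ n → *-local n (λ i _ → at p i) (λ i _ → at q i)

    zeroAt : ∀ (g : Series) n → ((λ _ → R.0#) * g) n R.≈ R.0#
    zeroAt g zero    = R.trans (R.+-identityʳ _) (R.zeroˡ _)
    zeroAt g (suc n) = R.trans (R.+-cong (R.zeroˡ _) (zeroAt g n)) (R.+-identityˡ _)

    distribʳAt : ∀ (f g h : Series) n → ((g + h) * f) n R.≈ (g * f) n R.+ (h * f) n
    distribʳAt f g h zero = begin
      (g 0 R.+ h 0) R.* f 0 R.+ R.0#                       ≈⟨ R.+-congʳ (R.distribʳ _ _ _) ⟩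
      g 0 R.* f 0 R.+ h 0 R.* f 0 R.+ R.0#                 ≈⟨ R.+-congˡ (R.+-identityˡ _) ⟨
      g 0 R.* f 0 R.+ h 0 R.* f 0 R.+ (R.0# R.+ R.0#)      ≈⟨ interchange _ _ _ _ ⟩
      (g 0 R.* f 0 R.+ R.0#) R.+ (h 0 R.* f 0 R.+ R.0#)    ∎
    distribʳAt f g h (suc n) = begin
      (g 0 R.+ h 0) R.* f (suc n) R.+ ((g ∘ suc + h ∘ suc) * f) n
        ≈⟨ R.+-cong (R.distribʳ _ _ _) (distribʳAt f (g ∘ suc) (h ∘ suc) n) ⟩
      (g 0 R.* f (suc n) R.+ h 0 R.* f (suc n)) R.+ ((g ∘ suc * f) n R.+ (h ∘ suc * f) n)
        ≈⟨ interchange _ _ _ _ ⟩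
      (g * f) (suc n) R.+ (h * f) (suc n) ∎

    scaleAt : ∀ a (g h : Series) n → ((λ i → a R.* g i) * h) n R.≈ a R.* (g * h) n
    scaleAt a g h zero = begin
      a R.* g 0 R.* h 0 R.+ R.0#          ≈⟨ R.+-cong (R.*-assoc _ _ _) (R.sym (R.zeroʳ a)) ⟩
      a R.* (g 0 R.* h 0) R.+ a R.* R.0#  ≈⟨ R.distribˡ _ _ _ ⟨
      a R.* (g 0 R.* h 0 R.+ R.0#)        ∎
    scaleAt a g h (suc n) = begin
      a R.* g 0 R.* h (suc n) R.+ ((λ i → a R.* g (suc i)) * h) n
        ≈⟨ R.+-cong (R.*-assoc _ _ _) (scaleAt a (g ∘ suc) h n) ⟩
      a R.* (g 0 R.* h (suc n)) R.+ a R.* (g ∘ suc * h) n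
        ≈⟨ R.distribˡ _ _ _ ⟨
      a R.* (g * h) (suc n) ∎

    assocAt : ∀ (f g h : Series) n → ((f * g) * h) n R.≈ (f * (g * h)) n
    assocAt f g h zero = R.+-congʳ (begin
      (f 0 R.* g 0 R.+ R.0#) R.* h 0  ≈⟨ R.*-congʳ (R.+-identityʳ _) ⟩
      f 0 R.* g 0 R.* h 0             ≈⟨ R.*-assoc _ _ _ ⟩
      f 0 R.* (g 0 R.* h 0)           ≈⟨ R.*-congˡ (R.+-identityʳ _) ⟨
      f 0 R.* (g 0 R.* h 0 R.+ R.0#)  ∎)
    assocAt f g h (suc n) = begin
      (f * g) 0 R.* h (suc n) R.+ ((f0g′ + f ∘ suc * g) * h) n
        ≈⟨ R.+-cong (R.*-congʳ (R.+-identityʳ _)) (distribʳAt h f0g′ (f ∘ suc * g) n) ⟩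
      f 0 R.* g 0 R.* h (suc n) R.+ ((f0g′ * h) n R.+ ((f ∘ suc * g) * h) n)
        ≈⟨ R.+-cong (R.*-assoc _ _ _) (R.+-cong (scaleAt (f 0) (g ∘ suc) h n) (assocAt (f ∘ suc) g h n)) ⟩
      f 0 R.* (g 0 R.* h (suc n)) R.+ (f 0 R.* (g ∘ suc * h) n R.+ (f ∘ suc * (g * h)) n)
        ≈⟨ R.+-assoc _ _ _ ⟨
      f 0 R.* (g 0 R.* h (suc n)) R.+ f 0 R.* (g ∘ suc * h) n R.+ (f ∘ suc * (g * h)) n
        ≈⟨ R.+-congʳ (R.distribˡ _ _ _) ⟨
      (f * (g * h)) (suc n) ∎
      where
      f0g′ : Series
      f0g′ i = f 0 R.* g (suc i)

    peelʳ : ∀ (f g : Series) n → (f * g) (suc n) R.≈ (f * (g ∘ suc)) n R.+ f (suc n) R.* g 0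
    peelʳ f g zero    = R.trans (R.+-congˡ (R.+-identityʳ _)) (R.+-congʳ (R.sym (R.+-identityʳ _)))
    peelʳ f g (suc n) = R.trans (R.+-congˡ (peelʳ (f ∘ suc) g n)) (R.sym (R.+-assoc _ _ _))

    commAt : ∀ (f g : Series) n → (f * g) n R.≈ (g * f) n
    commAt f g zero    = R.+-congʳ (R.*-comm _ _)
    commAt f g (suc n) = begin
      f 0 R.* g (suc n) R.+ (f ∘ suc * g) n  ≈⟨ R.+-comm _ _ ⟩
      (f ∘ suc * g) n R.+ f 0 R.* g (suc n)  ≈⟨ R.+-cong (commAt (f ∘ suc) g n) (R.*-comm _ _) ⟩
      (g * f ∘ suc) n R.+ g (suc n) R.* f 0  ≈⟨ peelʳ g f n ⟨
      (g * f) (suc n)                        ∎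

  const-* : ∀ a (g : Series) n → (const a * g) n R.≈ a R.* g n
  const-* a g zero    = R.+-identityʳ _
  const-* a g (suc n) = R.trans (R.+-congˡ (zeroAt g n)) (R.+-identityʳ _)

  X-*-zero : ∀ (g : Series) → (X * g) zero R.≈ R.0#
  X-*-zero g = R.trans (R.+-identityʳ _) (R.zeroˡ _)

  X-*-suc : ∀ (g : Series) n → (X * g) (suc n) R.≈ g n
  X-*-suc g n = begin
    R.0# R.* g (suc n) R.+ (X ∘ suc * g) n  ≈⟨ R.+-cong (R.zeroˡ _) (*-local n {g = g} shift (λ _ _ → R.refl)) ⟩
    R.0# R.+ (1# * g) n                     ≈⟨ R.+-identityˡ _ ⟩
    (1# * g) n                              ≈⟨ const-* R.1# g n ⟩
    R.1# R.* g n                            ≈⟨ R.*-identityˡ _ ⟩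
    g n                                     ∎
    where
    shift : ∀ i → i ≤ n → X (suc i) R.≈ 1# i
    shift zero    _ = R.refl
    shift (suc i) _ = R.refl

  powerSeriesRing : CommutativeRing c ℓ
  powerSeriesRing = record
    { Carrier = Series
    ; _≈_ = _≈_
    ; _+_ = _+_
    ; _*_ = _*_
    ; -_  = -_
    ; 0#  = 0#
    ; 1#  = 1#
    ; isCommutativeRing = record
      { isRing = record
        { +-isAbelianGroup = record
          { isGroup = record
            { isMonoid = record
              { isSemigroup = record
                { isMagma = record
                  { isEquivalence = record
                    { refl  = ext λ n → R.refl
                    ; sym   = λ p → ext λ n → R.sym (at p n)
                    ; trans = λ p q → ext λ n → R.trans (at p n) (at q n)
                    }
                  ; ∙-cong = λ p q → ext λ n → R.+-cong (at p n) (at q n)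
                  }
                ; assoc = λ f g h → ext λ n → R.+-assoc _ _ _
                }
              ; identity = (λ f → ext λ n → R.trans (R.+-congʳ (0-at n)) (R.+-identityˡ _))
                         , (λ f → ext λ n → R.trans (R.+-congˡ (0-at n)) (R.+-identityʳ _))
              }
            ; inverse = (λ f → ext λ n → R.trans (R.-‿inverseˡ _) (R.sym (0-at n)))
                      , (λ f → ext λ n → R.trans (R.-‿inverseʳ _) (R.sym (0-at n)))
            ; ⁻¹-cong = λ p → ext λ n → R.-‿cong (at p n)
            }
          ; comm = λ f g → ext λ n → R.+-comm _ _
          }
        ; *-cong = *-cong
        ; *-assoc = λ f g h → ext (assocAt f g h)
        ; *-identity = (λ f → ext (1-identityˡ f))
                     , (λ f → ext λ n → R.trans (commAt f 1# n) (1-identityˡ f n))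
        ; distrib = (λ f g h → ext λ n → R.trans (commAt f (g + h) n)
                      (R.trans (distribʳAt f g h n) (R.+-cong (commAt g f n) (commAt h f n))))
                  , (λ f g h → ext (distribʳAt f g h))
        }
      ; *-comm = λ f g → ext (commAt f g)
      }
    }
    where
    0-at : ∀ n → 0# n R.≈ R.0#
    0-at zero    = R.refl
    0-at (suc n) = R.refl
    1-identityˡ : ∀ (f : Series) n → (1# * f) n R.≈ f n
    1-identityˡ f n = R.trans (const-* R.1# f n) (R.*-identityˡ _)

  const-cong : ∀ {a b} → a R.≈ b → const a ≈ const b
  const-cong p = ext λ { zero → p ; (suc n) → R.refl }

  const-+ : ∀ a b → const (a R.+ b) ≈ const a + const b
  const-+ a b = ext λ { zero → R.refl ; (suc n) → R.sym (R.+-identityˡ _) }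

  const-** : ∀ a b → const (a R.* b) ≈ const a * const b
  const-** a b = ext λ { zero    → R.sym (const-* a (const b) zero)
                       ; (suc n) → R.sym (R.trans (const-* a (const b) (suc n)) (R.zeroʳ _)) }

  const-neg : ∀ a → const (R.- a) ≈ - const a
  const-neg a = ext λ { zero    → R.refl
                      ; (suc n) → R.sym (RingProperties.-0#≈0# R.ring) }

  -- An operator whose n-th output coefficient only depends on the input
  -- coefficients of index < n has a fixed point.

  AgreeBelow : ℕ → Series → Series → Set ℓ
  AgreeBelow k f g = ∀ i → i < k → f i R.≈ g i

  module _ (Φ : Series → Series)
           (contractive : ∀ {k f g} → AgreeBelow k f g → AgreeBelow (suc k) (Φ f) (Φ g)) where
    private
      approx : ℕ → Series
      approx zero    = 0#
      approx (suc k) = Φ (approx k)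

      stable : ∀ {m j k} → m ≤ j → m ≤ k → AgreeBelow m (approx j) (approx k)
      stable z≤n       z≤n       = λ _ ()
      stable (s≤s m≤j) (s≤s m≤k) = contractive (stable m≤j m≤k)

    fix : Series
    fix n = approx (suc n) n

    fix-≈ : fix ≈ Φ fix
    fix-≈ = ext λ n → contractive {k = n} {approx n} {fix}
      (λ i i<n → stable i<n ℕ.≤-refl i ℕ.≤-refl) n ℕ.≤-refl

-- Polynomials: lists of coefficients in increasing degree, trailing
-- zeros being irrelevant for _≈_

module Polynomial {c ℓ} (R : CommutativeRing c ℓ) where

  private
    module R = CommutativeRing R
    module S = PowerSeries R
    module SR = CommutativeRing S.powerSeriesRing

  Poly : Set c
  Poly = List R.Carrier

  coeff : Poly → ℕ → R.Carrier
  coeff []      n       = R.0#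
  coeff (a ∷ p) zero    = a
  coeff (a ∷ p) (suc n) = coeff p n

  infix 4 _≈_
  infix 8 -_
  infixl 7 _*_
  infixl 6 _+_

  record _≈_ (p q : Poly) : Set ℓ where
    constructor ext
    field coeffs : coeff p S.≈ coeff q

  open _≈_ public

  _+_ _*_ : Poly → Poly → Poly
  []      + q       = q
  (a ∷ p) + []      = a ∷ p
  (a ∷ p) + (b ∷ q) = a R.+ b ∷ p + q

  []      * q = []
  (a ∷ p) * q = map (a R.*_) q + (R.0# ∷ p * q)

  -_ : Poly → Poly
  - p = map (λ a → R.- a) p

  const : R.Carrier → Poly
  const a = a ∷ []

  X : Poly
  X = R.0# ∷ R.1# ∷ []

  private
    +-homo : ∀ p q n → coeff (p + q) n R.≈ coeff p n R.+ coeff q n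
    +-homo []      q       n       = R.sym (R.+-identityˡ _)
    +-homo (a ∷ p) []      n       = R.sym (R.+-identityʳ _)
    +-homo (a ∷ p) (b ∷ q) zero    = R.refl
    +-homo (a ∷ p) (b ∷ q) (suc n) = +-homo p q n

    -‿homo : ∀ p n → coeff (- p) n R.≈ R.- coeff p n
    -‿homo []      n       = R.sym (RingProperties.-0#≈0# R.ring)
    -‿homo (a ∷ p) zero    = R.refl
    -‿homo (a ∷ p) (suc n) = -‿homo p n

    scale-homo : ∀ a q n → coeff (map (a R.*_) q) n R.≈ a R.* coeff q n
    scale-homo a []      n       = R.sym (R.zeroʳ a)
    scale-homo a (b ∷ q) zero    = R.refl
    scale-homo a (b ∷ q) (suc n) = scale-homo a q n

    0-at : ∀ n → R.0# R.≈ SR.0# n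
    0-at zero    = R.refl
    0-at (suc n) = R.refl

    *-homo : ∀ p q n → coeff (p * q) n R.≈ (coeff p S.* coeff q) n
    *-homo []      q n = R.trans (0-at n) (R.sym (R.trans
      (S.*-local n {g = coeff q} (λ i _ → 0-at i) (λ _ _ → R.refl)) (S.at (SR.zeroˡ (coeff q)) n)))
    *-homo (a ∷ p) q n = R.trans (+-homo (map (a R.*_) q) (R.0# ∷ p * q) n) (tail n)
      where
      tail : ∀ n → coeff (map (a R.*_) q) n R.+ coeff (R.0# ∷ p * q) n R.≈ (coeff (a ∷ p) S.* coeff q) n
      tail zero    = R.+-congʳ (scale-homo a q zero)
      tail (suc n) = R.+-cong (scale-homo a q (suc n)) (*-homo p q n)

    rawRing : RawRing c ℓ
    rawRing = record
      { Carrier = Poly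
      ; _≈_ = _≈_
      ; _+_ = _+_
      ; _*_ = _*_
      ; -_  = -_
      ; 0#  = []
      ; 1#  = const R.1#
      }

  polynomialRing : CommutativeRing c ℓ
  polynomialRing = record
    { RawRing rawRing
    ; isCommutativeRing = RingMonomorphism.isCommutativeRing {R₁ = rawRing} {R₂ = SR.rawRing} {⟦_⟧ = coeff}
        (record
          { isRingHomomorphism = record
            { isSemiringHomomorphism = record
              { isNearSemiringHomomorphism = record
                { +-isMonoidHomomorphism = record
                  { isMagmaHomomorphism = record
                    { isRelHomomorphism = record { cong = coeffs }
                    ; homo = λ p q → S.ext (+-homo p q)
                    }
                  ; ε-homo = S.ext 0-at
                  }
                ; *-homo = λ p q → S.ext (*-homo p q)
                }
              ; 1#-homo = S.ext λ { zero → R.refl ; (suc n) → R.refl }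
              }
            ; -‿homo = λ p → S.ext (-‿homo p)
            }
          ; injective = ext
          })
        SR.isCommutativeRing
    }

private
  drop-defect : ∀ {c ℓ} (R : CommutativeRing c ℓ) → let open CommutativeRing R in
                ∀ a k {x y} → x ≈ y → a + k * (x - y) ≈ a
  drop-defect R a k {x} {y} x≈y = begin
    a + k * (x - y)  ≈⟨ +-congˡ (*-congˡ (+-congʳ x≈y)) ⟩
    a + k * (y - y)  ≈⟨ +-congˡ (*-congˡ (-‿inverseʳ y)) ⟩
    a + k * 0#       ≈⟨ +-congˡ (zeroʳ k) ⟩
    a + 0#           ≈⟨ +-identityʳ a ⟩
    a                ∎
    where
    open CommutativeRing R
    open ≈-Reasoning setoid

ℚ[s] : CommutativeRing 0ℓ 0ℓ
ℚ[s] = Polynomial.polynomialRing ℚ.+-*-commutativeRing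

ℚ[s]⟦t⟧ : CommutativeRing 0ℓ 0ℓ
ℚ[s]⟦t⟧ = PowerSeries.powerSeriesRing ℚ[s]

private
  module P = Polynomial ℚ.+-*-commutativeRing
  module PR = CommutativeRing ℚ[s]
  module S = PowerSeries ℚ[s]
  module PS = CommutativeRing ℚ[s]⟦t⟧

open CommutativeRing ℚ[s]⟦t⟧ using (Carrier; _≈_; _+_; _*_; _-_; 0#; 1#)
open Exp (CommutativeRing.semiring ℚ[s]⟦t⟧) using (_^_)

s t : Carrier
s = S.const P.X
t = S.X

fromℚ : ℚ → Carrier
fromℚ q = S.const (P.const q)

fromℚ-morphism : CommutativeRing.rawRing ℚ.+-*-commutativeRing
                   -Raw-AlmostCommutative⟶ fromCommutativeRing ℚ[s]⟦t⟧
fromℚ-morphism = record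
  { ⟦_⟧    = fromℚ
  ; +-homo = λ p q → S.const-+ (P.const p) (P.const q)
  ; *-homo = λ p q → PS.trans
      (S.const-cong (P.ext (PowerSeries.ext λ
        { zero → ≡.sym (ℚ.+-identityʳ _) ; (suc zero) → refl ; (suc (suc n)) → refl })))
      (S.const-** (P.const p) (P.const q))
  ; -‿homo = λ p → S.const-neg (P.const p)
  ; 0-homo = S.const-cong (P.ext (PowerSeries.ext λ { zero → refl ; (suc n) → refl }))
  ; 1-homo = PS.refl
  }

∑ ∏ : ∀ {a} {A : Set a} → List A → (A → Carrier) → Carrier
∑ xs f = foldr _+_ 0# (map f xs)
∏ xs f = foldr _*_ 1# (map f xs)

2# 4# : Carrier
2# = fromℚ (+ 2 / 1)
4# = fromℚ (+ 4 / 1)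

-- √Δ = √((1+t)²-4st) and w = (1+u)/(1+uv).  A quotient a/b is
-- characterised by b * (a/b) ≈ a: ℚ[s]⟦t⟧ is an integral domain and the
-- denominators are nonzero, so the equations have unique solutions.

record Substitution : Set where
  field
    √Δ u v w : Carrier
    √Δ²      : √Δ ^ 2 ≈ (1# + t) ^ 2 - 4# * s * t
    √Δ₀      : √Δ 0 PR.≈ PR.1#
    u-def    : (2# * (1# - s) * t) * u ≈ (1# + t ^ 2 - 2# * s * t) - (1# - t) * √Δ
    v-def    : (2# * s * t) * v ≈ ((1# + t) ^ 2 - 2# * s * t) - (1# + t) * √Δ
    w-def    : (1# + u * v) * w ≈ 1# + u

-- The equations are solvable: √Δ = 1 + (1-2s)t + 2s(1-s)t²h where
-- h = 1 - (1-2s)th - s(1-s)t²h².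

private
  module Solution where
    open PS using (trans) renaming (refl to ≈-refl)

    coeff≟ : ∀ p q → Maybe (fromℚ p ≈ fromℚ q)
    coeff≟ p q with p ℚ.≟ q
    ... | yes refl = just ≈-refl
    ... | no  _    = nothing

    open RingSolver (CommutativeRing.rawRing ℚ.+-*-commutativeRing)
      (fromCommutativeRing ℚ[s]⟦t⟧) fromℚ-morphism coeff≟
      using (solve; con; _:=_; _:+_; _:*_; _:-_; _:^_)

    contractive : ∀ (a : Carrier) (Ψ : Carrier → Carrier) →
      (∀ {k f g} → S.AgreeBelow k f g → S.AgreeBelow k (Ψ f) (Ψ g)) →
      ∀ {k f g} → S.AgreeBelow k f g → S.AgreeBelow (suc k) (a - t * Ψ f) (a - t * Ψ g)
    contractive a Ψ local {f = f} {g} f~g zero    _         = PR.+-congˡ (PR.-‿cong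
      (PR.trans (S.X-*-zero (Ψ f)) (PR.sym (S.X-*-zero (Ψ g)))))
    contractive a Ψ local {f = f} {g} f~g (suc i) (s≤s i<k) = PR.+-congˡ (PR.-‿cong
      (PR.trans (S.X-*-suc (Ψ f) i) (PR.trans (local f~g i i<k) (PR.sym (S.X-*-suc (Ψ g) i)))))

    *-agree : ∀ {k f f′ g g′} → S.AgreeBelow k f f′ → S.AgreeBelow k g g′ → S.AgreeBelow k (f * g) (f′ * g′)
    *-agree p q i i<k = S.*-local i (λ j j≤i → p j (ℕ.≤-<-trans j≤i i<k)) (λ j j≤i → q j (ℕ.≤-<-trans j≤i i<k))

    +-agree : ∀ {k f f′ g g′} → S.AgreeBelow k f f′ → S.AgreeBelow k g g′ → S.AgreeBelow k (f + g) (f′ + g′)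
    +-agree p q i i<k = PR.+-cong (p i i<k) (q i i<k)

    refl-agree : ∀ {k} f → S.AgreeBelow k f f
    refl-agree f i i<k = PR.refl

    Ψʰ Φʰ : Carrier → Carrier
    Ψʰ h = (1# - 2# * s) * h + (s * (1# - s) * t) * (h * h)
    Φʰ h = 1# - t * Ψʰ h

    Ψʰ-local : ∀ {k f g} → S.AgreeBelow k f g → S.AgreeBelow k (Ψʰ f) (Ψʰ g)
    Ψʰ-local {k} {f} {g} p =
      +-agree {f = a * f} {a * g} {b * (f * f)} {b * (g * g)}
        (*-agree {f = a} {a} {f} {g} (refl-agree a) p)
        (*-agree {f = b} {b} {f * f} {g * g} (refl-agree b) (*-agree {f = f} {g} {f} {g} p p))
      where
      a b : Carrier
      a = 1# - 2# * s
      b = s * (1# - s) * t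

    h : Carrier
    h = S.fix Φʰ (λ {k} {f} {g} → contractive 1# Ψʰ (λ {k} {f} {g} → Ψʰ-local {k} {f} {g}) {k} {f} {g})

    h-fix : h ≈ Φʰ h
    h-fix = S.fix-≈ Φʰ (λ {k} {f} {g} → contractive 1# Ψʰ (λ {k} {f} {g} → Ψʰ-local {k} {f} {g}) {k} {f} {g})

    √Δ′ √Δ u′ u v : Carrier
    √Δ′ = (1# - 2# * s) + 2# * s * (1# - s) * t * h
    √Δ  = 1# + t * √Δ′
    u′  = 1# - s * (1# - t) * h
    u   = t * u′
    v   = t * (1# - (1# - s) * (1# + t) * h)

    Ψʷ Φʷ : Carrier → Carrier
    Ψʷ w = (u′ * v) * w
    Φʷ w = (1# + u) - t * Ψʷ w

    Ψʷ-local : ∀ {k f g} → S.AgreeBelow k f g → S.AgreeBelow k (Ψʷ f) (Ψʷ g)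
    Ψʷ-local {k} {f} {g} p = *-agree {f = u′ * v} {u′ * v} {f} {g} (refl-agree (u′ * v)) p

    w : Carrier
    w = S.fix Φʷ (λ {k} {f} {g} → contractive (1# + u) Ψʷ (λ {k} {f} {g} → Ψʷ-local {k} {f} {g}) {k} {f} {g})

    w-fix : w ≈ Φʷ w
    w-fix = S.fix-≈ Φʷ (λ {k} {f} {g} → contractive (1# + u) Ψʷ (λ {k} {f} {g} → Ψʷ-local {k} {f} {g}) {k} {f} {g})

    solution : Substitution
    solution = record
      { √Δ = √Δ ; u = u ; v = v ; w = w
      ; √Δ² = trans
          (solve 3 (λ s t h → let 1ₚ = con ℚ.1ℚ ; 2ₚ = con (+ 2 / 1) ; 4ₚ = con (+ 4 / 1) in
            (1ₚ :+ t :* ((1ₚ :- 2ₚ :* s) :+ 2ₚ :* s :* (1ₚ :- s) :* t :* h)) :^ 2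
            := ((1ₚ :+ t) :^ 2 :- 4ₚ :* s :* t) :+ (4ₚ :* s :* (1ₚ :- s) :* t :* t) :*
               (h :- (1ₚ :- t :* ((1ₚ :- 2ₚ :* s) :* h :+ (s :* (1ₚ :- s) :* t) :* (h :* h)))))
            ≈-refl s t h)
          (drop-defect ℚ[s]⟦t⟧ ((1# + t) ^ 2 - 4# * s * t) (4# * s * (1# - s) * t * t) h-fix)
      ; √Δ₀ = PR.trans (PR.+-congˡ {PR.1#} (S.X-*-zero √Δ′)) (PR.+-identityʳ PR.1#)
      ; u-def = solve 3 (λ s t h → let 1ₚ = con ℚ.1ℚ ; 2ₚ = con (+ 2 / 1) in
          (2ₚ :* (1ₚ :- s) :* t) :* (t :* (1ₚ :- s :* (1ₚ :- t) :* h))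
          := (1ₚ :+ t :^ 2 :- 2ₚ :* s :* t) :-
             (1ₚ :- t) :* (1ₚ :+ t :* ((1ₚ :- 2ₚ :* s) :+ 2ₚ :* s :* (1ₚ :- s) :* t :* h)))
          ≈-refl s t h
      ; v-def = solve 3 (λ s t h → let 1ₚ = con ℚ.1ℚ ; 2ₚ = con (+ 2 / 1) in
          (2ₚ :* s :* t) :* (t :* (1ₚ :- (1ₚ :- s) :* (1ₚ :+ t) :* h))
          := ((1ₚ :+ t) :^ 2 :- 2ₚ :* s :* t) :-
             (1ₚ :+ t) :* (1ₚ :+ t :* ((1ₚ :- 2ₚ :* s) :+ 2ₚ :* s :* (1ₚ :- s) :* t :* h)))
          ≈-refl s t h
      ; w-def = trans
          (solve 4 (λ t u′ v w → let 1ₚ = con ℚ.1ℚ in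
            (1ₚ :+ (t :* u′) :* v) :* w
            := (1ₚ :+ t :* u′) :+ 1ₚ :* (w :- ((1ₚ :+ t :* u′) :- t :* ((u′ :* v) :* w))))
            ≈-refl t u′ v w)
          (drop-defect ℚ[s]⟦t⟧ (1# + u) 1# w-fix)
      }

substitution : Substitution
substitution = Solution.solution

-- Fin n stands for [n], shifted by one.

count : ∀ {n p} {P : Pred (Fin n) p} → Decidable P → ℕ
count P? = length (filter P? (allFin _))

module _ {n} (π : Permutation′ n) where

  Excedance : Pred (Fin n) 0ℓ
  Excedance i = i Fin.< π ⟨$⟩ʳ i

  CyclicValley : Pred (Fin n) 0ℓ
  CyclicValley i = i Fin.< π ⟨$⟩ˡ i × i Fin.< π ⟨$⟩ʳ i

  exc cval : ℕ
  exc  = count {P = Excedance} λ i → i Fin.<? π ⟨$⟩ʳ i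
  cval = count {P = CyclicValley} λ i → i Fin.<? π ⟨$⟩ˡ i ×-dec i Fin.<? π ⟨$⟩ʳ i

  -- The cycle through x as a set: cycles have at most n elements, so
  -- fewer than n iterations of π reach all of it.
  cycle : Fin n → Subset n
  cycle x = tabulate λ y → does (Fin.any? λ (k : Fin n) → iterate (π ⟨$⟩ʳ_) x (toℕ k) Fin.≟ y)

  cycles : List (Subset n)
  cycles = deduplicate (≡-dec Bool._≟_) (map cycle (allFin n))

  cycleType : List ℕ
  cycleType = InsertionSort.sort ℕ.≤-decTotalOrder (map ∣_∣ cycles)

-- The list of all permutations of Fin n.  Those of Fin (suc n) are
-- obtained by inserting 0 after j in the cycle notation of a
-- permutation of {1,…,n}, or as a fixed point if j = 0.

permutations : ∀ n → List (Permutation′ n)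
permutations zero    = Perm.id ∷ []
permutations (suc n) =
  cartesianProductWith (λ j π → transpose 0F j ∘ₚ lift₀ π) (allFin (suc n)) (permutations n)

permutationSetoid : ℕ → Setoid 0ℓ 0ℓ
permutationSetoid n = record
  { Carrier = Permutation′ n
  ; _≈_ = Perm._≈_
  ; isEquivalence = record
    { refl  = λ i → refl
    ; sym   = λ p i → ≡.sym (p i)
    ; trans = λ p q i → ≡.trans (p i) (q i)
    }
  }

private
  transpose-ʳ : ∀ {n} (i j : Fin n) → PC.transpose i j j ≡ i
  transpose-ʳ i j with j Fin.≟ i
  ... | yes j≡i = j≡i
  ... | no  _ with j Fin.≟ j
  ...   | yes _  = refl
  ...   | no j≢j = contradiction refl j≢j

  lift₀-0 : ∀ {n} (π : Permutation′ n) i → lift₀ π ⟨$⟩ʳ i ≡ 0F → i ≡ 0F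
  lift₀-0 π 0F _ = refl

permutations-complete : ∀ {n} (π : Permutation′ n) →
  SetoidMembership._∈_ (permutationSetoid n) π (permutations n)
permutations-complete {zero}  π = here λ ()
permutations-complete {suc n} π = Any.cartesianProductWith⁺ _
  (λ {k} {ρ} → decompose {k} {ρ}) (∈-allFin j) (permutations-complete (remove 0F τ))
  where
  j : Fin (suc n)
  j = π ⟨$⟩ˡ 0F
  τ : Permutation′ (suc n)
  τ = transpose j 0F ∘ₚ π
  τ-0 : τ ⟨$⟩ʳ 0F ≡ 0F
  τ-0 = ≡.trans (cong (π ⟨$⟩ʳ_) (transpose-ʳ j 0F)) (Perm.inverseʳ π)
  decompose : ∀ {k ρ} → j ≡ k → remove 0F τ Perm.≈ ρ → π Perm.≈ (transpose 0F k ∘ₚ lift₀ ρ)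
  decompose {ρ = ρ} refl rest≈ρ i = begin
    π ⟨$⟩ʳ i                                        ≡⟨ cong (π ⟨$⟩ʳ_) (PC.transpose-inverse j 0F) ⟨
    τ ⟨$⟩ʳ (PC.transpose 0F j i)                    ≡⟨ Perm.lift₀-remove τ τ-0 (PC.transpose 0F j i) ⟨
    lift₀ (remove 0F τ) ⟨$⟩ʳ (PC.transpose 0F j i)  ≡⟨ Perm.lift₀-cong (remove 0F τ) ρ rest≈ρ _ ⟩
    lift₀ ρ ⟨$⟩ʳ (PC.transpose 0F j i)              ∎
    where open ≡.≡-Reasoning

permutations-unique : ∀ n → UniqueList.Unique (permutationSetoid n) (permutations n)
permutations-unique zero    = [] ∷ []
permutations-unique (suc n) = UniqueSetoid.cartesianProductWith⁺
  (≡.setoid (Fin (suc n))) (permutationSetoid n) (permutationSetoid (suc n)) _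
  (λ {j} {k} {π} {ρ} → injective {j} {k} {π} {ρ}) (Unique.allFin⁺ (suc n)) (permutations-unique n)
  where
  injective : ∀ {j k π ρ} → (transpose 0F j ∘ₚ lift₀ π) Perm.≈ (transpose 0F k ∘ₚ lift₀ ρ) →
              j ≡ k × π Perm.≈ ρ
  injective {j} {k} {π} {ρ} eq = j≡k , π≈ρ
    where
    open ≡.≡-Reasoning
    k↦0 : PC.transpose 0F j k ≡ 0F
    k↦0 = lift₀-0 π _ (≡.trans (eq k) (cong (lift₀ ρ ⟨$⟩ʳ_) (transpose-ʳ 0F k)))
    j≡k : j ≡ k
    j≡k = begin
      j                                        ≡⟨ transpose-ʳ j 0F ⟨
      PC.transpose j 0F 0F                     ≡⟨ cong (PC.transpose j 0F) k↦0 ⟨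
      PC.transpose j 0F (PC.transpose 0F j k)  ≡⟨ PC.transpose-inverse j 0F ⟩
      k                                        ∎
    π≈ρ : π Perm.≈ ρ
    π≈ρ i with refl ← j≡k = Fin.suc-injective (begin
      lift₀ π ⟨$⟩ʳ Fin.suc i                                  ≡⟨ cong (lift₀ π ⟨$⟩ʳ_) (PC.transpose-inverse 0F j) ⟨
      lift₀ π ⟨$⟩ʳ (PC.transpose 0F j (PC.transpose j 0F (Fin.suc i)))  ≡⟨ eq (PC.transpose j 0F (Fin.suc i)) ⟩
      lift₀ ρ ⟨$⟩ʳ (PC.transpose 0F j (PC.transpose j 0F (Fin.suc i)))  ≡⟨ cong (lift₀ ρ ⟨$⟩ʳ_) (PC.transpose-inverse 0F j) ⟩
      lift₀ ρ ⟨$⟩ʳ Fin.suc i                                  ∎)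

-- Parts are listed in weakly increasing order, as cycleType lists them.

record Partition (n : ℕ) : Set where
  field
    parts    : List ℕ
    sorted   : SortedList.Sorted ℕ.≤-totalOrder parts
    positive : All (0 <_) parts
    sum≡n    : ℕ.sum parts ≡ n

open Partition public

mult : ∀ {n} → Partition n → ℕ → ℕ
mult λ′ i = length (filter (i ℕ.≟_) (parts λ′))

permutationsOfType : ∀ {n} → Partition n → List (Permutation′ n)
permutationsOfType {n} λ′ = filter (λ π → List.≡-dec ℕ._≟_ (cycleType π) (parts λ′)) (permutations n)

-- Part sizes are i = suc k for k < n: no part of a partition of n exceeds n.
z-factor : ∀ {n} → Partition n → ℕ → ℕ
z-factor λ′ k = suc k ℕ.^ mult λ′ (suc k) ℕ.* mult λ′ (suc k) !

z : ∀ {n} → Partition n → ℕ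
z {n} λ′ = ℕ.product (map (z-factor λ′) (upTo n))

z≢0 : ∀ {n} (λ′ : Partition n) → NonZero (z λ′)
z≢0 {n} λ′ = product≢0 (All.map⁺ (All.universal factor≢0 (upTo n)))
  where
  factor≢0 : ∀ k → NonZero (z-factor λ′ k)
  factor≢0 k = ℕ.m*n≢0 _ _ {{ℕ.m^n≢0 (suc k) (mult λ′ (suc k))}} {{mult λ′ (suc k) ℕ.!≢0}}

-- The Eulerian polynomial A_n evaluated at a series x, in its excedance
-- form; A_n has no constant term for n ≥ 1, hence the suc.

A : ℕ → Carrier → Carrier
A zero      x = 1#
A n@(suc _) x = ∑ (permutations n) λ π → x ^ suc (exc π)

{-# OPTIONS --safe #-}
module Submission where

open import Defs hiding (∑; ∏; s; t; 2#; 4#)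
open import Algebra.Bundles using (CommutativeMonoid; CommutativeSemiring; CommutativeRing)
import Algebra.Properties.CommutativeMonoid.Mult as CommutativeMonoidMult
import Algebra.Properties.CommutativeSemigroup as CommutativeSemigroupProperties
import Algebra.Properties.CommutativeSemiring.Exp as CommutativeExp
import Algebra.Properties.Ring as RingProperties
import Algebra.Properties.Semiring.Exp as Exp
import Algebra.Properties.Semiring.Mult as SemiringMult
import Algebra.Solver.Ring as RingSolver
open import Algebra.Solver.Ring.AlmostCommutativeRing using (fromCommutativeRing; _-Raw-AlmostCommutative⟶_)
import Algebra.Solver.Ring.NaturalCoefficients.Default as NaturalSolver
open import Data.Bool.Base using (Bool; true; false; if_then_else_; not; _∧_; _∨_)
import Data.Bool.Properties as Bool
open import Data.Fin.Base as Fin using (Fin; toℕ; fromℕ<)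
open import Data.Fin.Patterns using (0F)
open import Data.Fin.Permutation using (Permutation′; _⟨$⟩ʳ_; _⟨$⟩ˡ_; _∘ₚ_; transpose; lift₀; inverseʳ; inverseˡ)
import Data.Fin.Properties as Fin
open import Data.Fin.Subset using (Subset; ∣_∣; ⊥)
open import Data.Integer.Base as ℤ using (+_)
import Data.Integer.Properties as ℤ
open import Data.List.Base as List
  using (List; []; _∷_; _++_; map; foldr; allFin; upTo; filter; length; cartesianProductWith)
open import Data.List.Membership.Propositional using (_∈_)
open import Data.List.Membership.Propositional.Properties
  using (∈-map⁺; ∈-map⁻; ∈-allFin; ∈-upTo⁺; ∈-deduplicate⁺; ∈-deduplicate⁻)
open import Data.List.Membership.Propositional.Properties.WithK using (unique∧set⇒bag)
import Data.List.Properties as List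
open import Data.List.Relation.Binary.BagAndSetEquality using (∼bag⇒↭)
open import Data.List.Relation.Binary.Equality.Propositional using (≋⇒≡)
open import Data.List.Relation.Binary.Permutation.Propositional
  using (_↭_; ↭-refl; ↭-sym; ↭-trans; ↭-reflexive; ↭⇒↭ₛ; prep; swap)
  renaming (refl to ↭-reflˡ; trans to ↭-transˡ)
open import Data.List.Relation.Binary.Permutation.Propositional.Properties
  using (All-resp-↭; ∈-resp-↭; drop-∷) renaming (map⁺ to ↭-map⁺)
open import Data.List.Relation.Unary.All as All using (All; []; _∷_)
import Data.List.Relation.Unary.All.Properties as All
open import Data.List.Relation.Unary.AllPairs using ([]; _∷_)
open import Data.List.Relation.Unary.Any using (here; there)
open import Data.List.Relation.Unary.Sorted.TotalOrder.Properties using (↗↭↗⇒≋)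
import Data.List.Relation.Unary.Unique.DecPropositional.Properties as DecUnique
open import Data.List.Relation.Unary.Unique.Propositional using (Unique)
import Data.List.Relation.Unary.Unique.Propositional.Properties as Unique
import Data.List.Sort.InsertionSort.Properties as InsertionSort
open import Data.Maybe.Base using (Maybe; just; nothing)
open import Data.Nat.Base as ℕ using (ℕ; zero; suc; _∸_; pred; _!; _<_; _≤_; s≤s; z≤n; NonZero)
open import Data.Nat.DivMod using (_%_; m≡m%n+[m/n]*n; m%n<n) renaming (_/_ to _div_)
open import Data.Nat.GeneralisedArithmetic using (iterate)
import Data.Nat.ListAction as ℕ using (sum; product)
import Data.Nat.ListAction.Properties as ℕ using (sum-↭; product-↭; product≢0)
import Data.Nat.Properties as ℕ
open import Data.Nat.Solver using (module +-*-Solver)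
open import Data.Product.Base using (_×_; _,_; proj₁; proj₂; ∃)
open import Data.Rational.Base as ℚ using (ℚ; _/_; toℚᵘ)
import Data.Rational.Properties as ℚ
open import Data.Rational.Unnormalised.Base as ℚᵘ using (mkℚᵘ; *≡*)
import Data.Rational.Unnormalised.Properties as ℚᵘ
open import Data.Vec.Base as Vec using (lookup; tabulate)
import Data.Vec.Properties as Vec
open import Function.Base using (_∘_)
open import Function.Bundles using (mk⇔)
open import Level using (_⊔_)
open import Relation.Binary.Definitions using (DecidableEquality)
open import Relation.Binary.PropositionalEquality as ≡ using (_≡_; _≢_; cong; cong₂; subst; module ≡-Reasoning)
import Relation.Binary.Reasoning.Setoid as ≈-Reasoning
open import Relation.Nullary using (Dec; yes; no; does; ¬_; contradiction)
open import Relation.Nullary.Decidable using (map′; dec-true; dec-false; does-⇔)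
open import Relation.Unary using (Decidable)

-- Permutations are generated by inserting a new smallest element into an arc
-- j → π j, and the effect on the numbers of excedances and cyclic valleys of
-- the cycle hit depends only on those two numbers and on its length.  Summing
-- products of weights over all matchings of cycles with parts makes this process
-- multilinear, so that the cycles evolve independently, and the sum over
-- permutations of a given cycle type factors into sums over single cycles.
-- For a single cycle, valley hopping shows that the weights x of a
-- valley, α of a double ascent and β of a double descent matter only through
-- x and α + β.  The triples (x , α , β) = (s t , t , 1) and (a b , b , a) with
-- a = w and b = w v are equivalent because w + w v = 1 + t and w² v = s t, and
-- the second one yields wⁱ Aᵢ₋₁(v), since Eulerian polynomials satisfy the
-- recursion for cycles counted by excedances.

-- Inserting a new least letter into the arc from j to π j makes it a valley and an excedance, ends
-- the excedance at j, if any, and destroys a valley at either end of the arc. So the new statistics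
-- of the cycle hit depend only on its length, its old statistics and the kind of arc, and the arcs
-- of each kind are counted by these data (`cycleState-insert₀`, `∑-insertions`).
--
-- Let `E n Ws` be the sum over all π of the permanent `M`, which matches the cycles of π with the
-- weights in `Ws`. Insertion gives a recursion that alters one weight at a time (`E-suc`). For
-- weights concentrated on cycle lengths with sum n, its solution is a multinomial coefficient times
-- a product of sums over single cycles (`closed-form`). With the weights s^v t^e on the parts of λ,
-- the permanent vanishes unless π has type λ, and otherwise it is the product of the mᵢ! times
-- s^cval t^exc. All numerical factors of the theorem then come from the fact that the product of
-- all (part)! and all mᵢ! is z_λ times the product of the (i-1)!^mᵢ (`fact-automorphisms`).
--
-- For a single cycle of length i ≥ 2, valley hopping (`G-invariant`) allows any change of weights
-- that keeps the weight of a valley and the sum of the weights of a double ascent and a double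
-- descent. The weights (s t, t, 1) become (a b, b, a) with a = w and b = w v. As there are as many
-- peaks as valleys, this is b per excedance and a per other letter. The same recursion counts
-- permutations of i - 1 letters by excedances (`∑-U`), so the cycle sum is wⁱ Aᵢ₋₁(v) (`total-𝔸`).
-- A fixed point contributes 1, whence the exponent n - m₁.
--
-- The identities for a and b follow from u + v = t (1 + u v) and s t (1 + v)² = (1 + t)² v.

module ListFold {c ℓ} (M : CommutativeMonoid c ℓ) where
  open CommutativeMonoid M
  open CommutativeSemigroupProperties commutativeSemigroup using (interchange; x∙yz≈y∙xz)

  ⨁ : ∀ {a} {A : Set a} → List A → (A → Carrier) → Carrier
  ⨁ xs f = foldr _∙_ ε (map f xs)

  module _ {a} {A : Set a} where

    ⨁-cong : ∀ xs {f g : A → Carrier} → (∀ x → f x ≈ g x) → ⨁ xs f ≈ ⨁ xs g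
    ⨁-cong []       p = refl
    ⨁-cong (x ∷ xs) p = ∙-cong (p x) (⨁-cong xs p)

    ⨁-cong-All : ∀ {xs} {f g : A → Carrier} → All (λ x → f x ≈ g x) xs → ⨁ xs f ≈ ⨁ xs g
    ⨁-cong-All []       = refl
    ⨁-cong-All (p ∷ ps) = ∙-cong p (⨁-cong-All ps)

    ⨁-ε : ∀ xs → ⨁ {A = A} xs (λ _ → ε) ≈ ε
    ⨁-ε []       = refl
    ⨁-ε (x ∷ xs) = trans (identityˡ _) (⨁-ε xs)

    ⨁-∙ : ∀ xs (f g : A → Carrier) → ⨁ xs (λ x → f x ∙ g x) ≈ ⨁ xs f ∙ ⨁ xs g
    ⨁-∙ []       f g = sym (identityˡ ε)
    ⨁-∙ (x ∷ xs) f g = trans (∙-congˡ (⨁-∙ xs f g)) (interchange _ _ _ _)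

    ⨁-++ : ∀ xs ys (f : A → Carrier) → ⨁ (xs ++ ys) f ≈ ⨁ xs f ∙ ⨁ ys f
    ⨁-++ []       ys f = sym (identityˡ _)
    ⨁-++ (x ∷ xs) ys f = trans (∙-congˡ (⨁-++ xs ys f)) (sym (assoc _ _ _))

    ⨁-map : ∀ {b} {B : Set b} (h : B → A) xs (f : A → Carrier) → ⨁ (map h xs) f ≈ ⨁ xs (f ∘ h)
    ⨁-map h []       f = refl
    ⨁-map h (x ∷ xs) f = ∙-congˡ (⨁-map h xs f)

    ⨁-↭ : ∀ {xs ys} (f : A → Carrier) → xs ↭ ys → ⨁ xs f ≈ ⨁ ys f
    ⨁-↭ f ↭-reflˡ        = refl
    ⨁-↭ f (prep x p)     = ∙-congˡ (⨁-↭ f p)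
    ⨁-↭ f (swap x y p)   = trans (x∙yz≈y∙xz _ _ _) (∙-congˡ (∙-congˡ (⨁-↭ f p)))
    ⨁-↭ f (↭-transˡ p q) = trans (⨁-↭ f p) (⨁-↭ f q)

    -- The sum of F x (xs without x) over the positions x of xs.
    ⨁ₚ : List A → (A → List A → Carrier) → Carrier
    ⨁ₚ []       F = ε
    ⨁ₚ (x ∷ xs) F = F x xs ∙ ⨁ₚ xs (λ y ys → F y (x ∷ ys))

    ⨁ₚ-cong-↭ : ∀ xs {F G} → (∀ y ys → xs ↭ y ∷ ys → F y ys ≈ G y ys) → ⨁ₚ xs F ≈ ⨁ₚ xs G
    ⨁ₚ-cong-↭ []       p = refl
    ⨁ₚ-cong-↭ (x ∷ xs) p = ∙-cong (p x xs ↭-refl)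
      (⨁ₚ-cong-↭ xs λ y ys q → p y (x ∷ ys) (↭-trans (prep x q) (swap x y ↭-refl)))

    ⨁ₚ-cong : ∀ xs {F G} → (∀ y ys → F y ys ≈ G y ys) → ⨁ₚ xs F ≈ ⨁ₚ xs G
    ⨁ₚ-cong xs p = ⨁ₚ-cong-↭ xs λ y ys _ → p y ys

    ⨁ₚ-∙ : ∀ xs F G → ⨁ₚ xs (λ y ys → F y ys ∙ G y ys) ≈ ⨁ₚ xs F ∙ ⨁ₚ xs G
    ⨁ₚ-∙ []       F G = sym (identityˡ ε)
    ⨁ₚ-∙ (x ∷ xs) F G = trans (∙-congˡ (⨁ₚ-∙ xs _ _)) (interchange _ _ _ _)

    ⨁ₚ-ε : ∀ xs → ⨁ₚ xs (λ _ _ → ε) ≈ ε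
    ⨁ₚ-ε []       = refl
    ⨁ₚ-ε (x ∷ xs) = trans (identityˡ _) (⨁ₚ-ε xs)

    ⨁ₚ-forget : ∀ xs (f : A → Carrier) → ⨁ₚ xs (λ y _ → f y) ≈ ⨁ xs f
    ⨁ₚ-forget []       f = refl
    ⨁ₚ-forget (x ∷ xs) f = ∙-congˡ (⨁ₚ-forget xs f)

    ⨁-⨁ₚ-swap : ∀ {b} {B : Set b} (zs : List B) xs (F : B → A → List A → Carrier) →
                ⨁ zs (λ z → ⨁ₚ xs (F z)) ≈ ⨁ₚ xs (λ y ys → ⨁ zs (λ z → F z y ys))
    ⨁-⨁ₚ-swap []       xs F = sym (⨁ₚ-ε xs)
    ⨁-⨁ₚ-swap (z ∷ zs) xs F = trans (∙-congˡ (⨁-⨁ₚ-swap zs xs F)) (sym (⨁ₚ-∙ xs _ _))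

    -- Both sides run over the ordered pairs of distinct positions; this symmetry lets two rows of a
    -- permanent be exchanged.
    ⨁ₚ-transpose : ∀ xs (F : A → A → List A → Carrier) →
      ⨁ₚ xs (λ y ys → ⨁ₚ ys (F y)) ≈ ⨁ₚ xs (λ y ys → ⨁ₚ ys (λ z → F z y))
    ⨁ₚ-transpose []       F = refl
    ⨁ₚ-transpose (x ∷ xs) F = begin
      ⨁ₚ xs (F x) ∙ ⨁ₚ xs (λ y ys → F y x ys ∙ ⨁ₚ ys (λ z zs → F y z (x ∷ zs)))
        ≈⟨ ∙-congˡ (trans (⨁ₚ-∙ xs _ _) (∙-congˡ (⨁ₚ-transpose xs (λ y z zs → F y z (x ∷ zs))))) ⟩
      ⨁ₚ xs (F x) ∙ (⨁ₚ xs (λ y ys → F y x ys) ∙ ⨁ₚ xs (λ y ys → ⨁ₚ ys (λ z zs → F z y (x ∷ zs))))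
        ≈⟨ x∙yz≈y∙xz _ _ _ ⟩
      ⨁ₚ xs (λ y ys → F y x ys) ∙ (⨁ₚ xs (F x) ∙ ⨁ₚ xs (λ y ys → ⨁ₚ ys (λ z zs → F z y (x ∷ zs))))
        ≈⟨ ∙-congˡ (sym (⨁ₚ-∙ xs _ _)) ⟩
      ⨁ₚ xs (λ z → F z x) ∙ ⨁ₚ xs (λ y ys → F x y ys ∙ ⨁ₚ ys (λ z zs → F z y (x ∷ zs))) ∎
      where open ≈-Reasoning setoid

  ⨁-swap : ∀ {a b} {A : Set a} {B : Set b} (xs : List A) (ys : List B) (f : A → B → Carrier) →
           ⨁ xs (λ x → ⨁ ys (f x)) ≈ ⨁ ys (λ y → ⨁ xs (λ x → f x y))
  ⨁-swap []       ys f = sym (⨁-ε ys)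
  ⨁-swap (x ∷ xs) ys f = trans (∙-congˡ (⨁-swap xs ys f)) (sym (⨁-∙ ys _ _))

  ⨁ₚ-map : ∀ {a b} {A : Set a} {B : Set b} (h : B → A) xs F →
           ⨁ₚ (map h xs) F ≈ ⨁ₚ xs (λ y ys → F (h y) (map h ys))
  ⨁ₚ-map h []       F = refl
  ⨁ₚ-map h (x ∷ xs) F = ∙-congˡ (⨁ₚ-map h xs _)

  ⨁ₚ-swap : ∀ {a b} {A : Set a} {B : Set b} (xs : List A) (zs : List B)
            (F : A → List A → B → List B → Carrier) →
            ⨁ₚ xs (λ y ys → ⨁ₚ zs (F y ys)) ≈ ⨁ₚ zs (λ w ws → ⨁ₚ xs (λ y ys → F y ys w ws))
  ⨁ₚ-swap []       zs F = sym (⨁ₚ-ε zs)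
  ⨁ₚ-swap (x ∷ xs) zs F = trans (∙-congˡ (⨁ₚ-swap xs zs _)) (sym (⨁ₚ-∙ zs _ _))

module SemiringFold {c ℓ} (R : CommutativeSemiring c ℓ) where
  open CommutativeSemiring R
  open ListFold +-commutativeMonoid public using () renaming
    ( ⨁ to ∑; ⨁-cong to ∑-cong; ⨁-ε to ∑-0; ⨁-∙ to ∑-+
    ; ⨁-map to ∑-map; ⨁-swap to ∑-swap; ⨁-↭ to ∑-↭; ⨁ₚ to ∑ₚ; ⨁ₚ-cong-↭ to ∑ₚ-cong-↭; ⨁ₚ-cong to ∑ₚ-cong
    ; ⨁ₚ-∙ to ∑ₚ-+; ⨁ₚ-ε to ∑ₚ-0; ⨁ₚ-forget to ∑ₚ-forget; ⨁-⨁ₚ-swap to ∑-∑ₚ-swap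
    ; ⨁ₚ-transpose to ∑ₚ-transpose; ⨁ₚ-map to ∑ₚ-map; ⨁ₚ-swap to ∑ₚ-swap )
  open ListFold *-commutativeMonoid public using () renaming
    ( ⨁ to ∏; ⨁-cong to ∏-cong; ⨁-∙ to ∏-*; ⨁-map to ∏-map; ⨁-↭ to ∏-↭ )
  open SemiringMult semiring using (×-homo-+; ×1-homo-*) renaming (_×_ to _·_)
  open ≈-Reasoning setoid

  ∑-*ˡ : ∀ {a} {A : Set a} x (xs : List A) f → ∑ xs (λ y → x * f y) ≈ x * ∑ xs f
  ∑-*ˡ x []       f = sym (zeroʳ x)
  ∑-*ˡ x (y ∷ xs) f = trans (+-congˡ (∑-*ˡ x xs f)) (sym (distribˡ _ _ _))

  ∑-*ʳ : ∀ {a} {A : Set a} x (xs : List A) f → ∑ xs (λ y → f y * x) ≈ ∑ xs f * x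
  ∑-*ʳ x []       f = sym (zeroˡ x)
  ∑-*ʳ x (y ∷ xs) f = trans (+-congˡ (∑-*ʳ x xs f)) (sym (distribʳ _ _ _))

  ∑ₚ-*ˡ : ∀ {a} {A : Set a} x (xs : List A) F → ∑ₚ xs (λ y ys → x * F y ys) ≈ x * ∑ₚ xs F
  ∑ₚ-*ˡ x []       F = sym (zeroʳ x)
  ∑ₚ-*ˡ x (y ∷ xs) F = trans (+-congˡ (∑ₚ-*ˡ x xs _)) (sym (distribˡ _ _ _))

  ∑ₚ-*ʳ : ∀ {a} {A : Set a} x (xs : List A) F → ∑ₚ xs (λ y ys → F y ys * x) ≈ ∑ₚ xs F * x
  ∑ₚ-*ʳ x []       F = sym (zeroˡ x)
  ∑ₚ-*ʳ x (y ∷ xs) F = trans (+-congˡ (∑ₚ-*ʳ x xs _)) (sym (distribʳ _ _ _))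

  ι : ℕ → Carrier
  ι n = n · 1#

  ι-+ : ∀ m n → ι (m ℕ.+ n) ≈ ι m + ι n
  ι-+ = ×-homo-+ 1#

  ι-* : ∀ m n → ι (m ℕ.* n) ≈ ι m * ι n
  ι-* = ×1-homo-*

  ι-1 : ι 1 ≈ 1#
  ι-1 = +-identityʳ 1#

-- A weighted permanent: M L Ws is the sum over all bijections between L
-- and Ws of the product of the w σ over the matched pairs (σ , w).

module Permanent {c ℓ s} (R : CommutativeSemiring c ℓ) (S : Set s) where
  open CommutativeSemiring R
  open SemiringFold R
  open CommutativeSemigroupProperties *-commutativeSemigroup using (x∙yz≈y∙xz)
  open ≈-Reasoning setoid

  Weight : Set _
  Weight = S → Carrier

  M : List S → List Weight → Carrier
  M []      []      = 1#
  M []      (_ ∷ _) = 0#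
  M (σ ∷ L) Ws      = ∑ₚ Ws (λ w Ws′ → w σ * M L Ws′)

  -- `M` is defined by expansion along its first row; this is the expansion along its first column,
  -- by induction on the rows.
  M-column : ∀ L w Ws → M L (w ∷ Ws) ≈ ∑ₚ L (λ σ L′ → w σ * M L′ Ws)
  M-column []      w Ws = refl
  M-column (σ ∷ L) w Ws = +-congˡ (begin
    ∑ₚ Ws (λ w′ Ws′ → w′ σ * M L (w ∷ Ws′))
      ≈⟨ ∑ₚ-cong Ws (λ w′ Ws′ → trans (*-congˡ (M-column L w Ws′)) (sym (∑ₚ-*ˡ _ L _))) ⟩
    ∑ₚ Ws (λ w′ Ws′ → ∑ₚ L (λ τ L′ → w′ σ * (w τ * M L′ Ws′)))
      ≈⟨ ∑ₚ-swap Ws L _ ⟩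
    ∑ₚ L (λ τ L′ → ∑ₚ Ws (λ w′ Ws′ → w′ σ * (w τ * M L′ Ws′)))
      ≈⟨ ∑ₚ-cong L (λ τ L′ → trans (∑ₚ-cong Ws λ _ _ → x∙yz≈y∙xz _ _ _) (∑ₚ-*ˡ _ Ws _)) ⟩
    ∑ₚ L (λ τ L′ → w τ * M (σ ∷ L′) Ws) ∎)

  M-↭ : ∀ {L L′} Ws → L ↭ L′ → M L Ws ≈ M L′ Ws
  M-↭ Ws ↭-reflˡ        = refl
  M-↭ Ws (prep σ p)     = ∑ₚ-cong Ws (λ w Ws′ → *-congˡ (M-↭ Ws′ p))
  M-↭ Ws (↭-transˡ p q) = trans (M-↭ Ws p) (M-↭ Ws q)
  M-↭ {σ ∷ τ ∷ L} {_ ∷ _ ∷ L′} Ws (swap σ τ p) = begin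
    ∑ₚ Ws (λ w Ws′ → w σ * ∑ₚ Ws′ (λ w′ Ws″ → w′ τ * M L Ws″))
      ≈⟨ ∑ₚ-cong Ws (λ w Ws′ → sym (∑ₚ-*ˡ _ Ws′ _)) ⟩
    ∑ₚ Ws (λ w Ws′ → ∑ₚ Ws′ (λ w′ Ws″ → w σ * (w′ τ * M L Ws″)))
      ≈⟨ ∑ₚ-transpose Ws _ ⟩
    ∑ₚ Ws (λ w Ws′ → ∑ₚ Ws′ (λ w′ Ws″ → w′ σ * (w τ * M L Ws″)))
      ≈⟨ ∑ₚ-cong Ws (λ w Ws′ → trans
           (∑ₚ-cong Ws′ λ w′ Ws″ → trans (x∙yz≈y∙xz _ _ _) (*-congˡ (*-congˡ (M-↭ Ws″ p))))
           (∑ₚ-*ˡ _ Ws′ _)) ⟩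
    ∑ₚ Ws (λ w Ws′ → w τ * ∑ₚ Ws′ (λ w′ Ws″ → w′ σ * M L′ Ws″)) ∎

  M-0 : ∀ L w Ws → (∀ σ → w σ ≈ 0#) → M L (w ∷ Ws) ≈ 0#
  M-0 L w Ws w≈0 = begin
    M L (w ∷ Ws)                       ≈⟨ M-column L w Ws ⟩
    ∑ₚ L (λ σ L′ → w σ * M L′ Ws)      ≈⟨ ∑ₚ-cong L (λ σ L′ → trans (*-congʳ (w≈0 σ)) (zeroˡ _)) ⟩
    ∑ₚ L (λ _ _ → 0#)                  ≈⟨ ∑ₚ-0 L ⟩
    0#                                 ∎

-- A cycle is recorded by (m , e , v): it has suc m elements, e of them
-- excedances and v of them cyclic valleys.

CycleState : Set
CycleState = ℕ × ℕ × ℕ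

module Growth {c ℓ} (R : CommutativeSemiring c ℓ) where
  open CommutativeSemiring R
  open SemiringFold R
  open Permanent R CycleState public
  open CommutativeSemigroupProperties *-commutativeSemigroup using (x∙yz≈y∙xz)
  open NaturalSolver R using (solve; _:=_; _:+_; _:*_)
  open ≈-Reasoning setoid

  -- The total weight of the cycles obtained by inserting a new smallest
  -- element into an arc j → π j: the four terms correspond to the arcs with j a
  -- valley, the other ascending arcs, those with π j a valley, and the rest.
  grow : Weight → Weight
  grow w (m , e , v) = ι v * w (suc m , e , v) + ι (e ∸ v) * w (suc m , e , suc v)
                     + ι v * w (suc m , suc e , v) + ι (suc m ∸ e ∸ v) * w (suc m , suc e , suc v)

  fixed : CycleState
  fixed = 0 , 0 , 0

  -- Supported on cycles with `suc d` letters. Each `grow` lowers `d` by one.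
  Concentrated : ℕ → Weight → Set _
  Concentrated d w = ∀ m e v → m ≢ d → w (m , e , v) ≈ 0#

  private
    zero-combination : ∀ {a b c d x y z w} → x ≈ 0# → y ≈ 0# → z ≈ 0# → w ≈ 0# →
                       a * x + b * y + c * z + d * w ≈ 0#
    zero-combination {a} {b} {c} {d} x≈0 y≈0 z≈0 w≈0 = trans
      (+-cong (+-cong (+-cong (vanish a x≈0) (vanish b y≈0)) (vanish c z≈0)) (vanish d w≈0))
      (trans (+-identityʳ _) (trans (+-identityʳ _) (+-identityʳ _)))
      where
      vanish : ∀ a {x} → x ≈ 0# → a * x ≈ 0#
      vanish a x≈0 = trans (*-congˡ x≈0) (zeroʳ a)

  grow-concentrated : ∀ {d w} → Concentrated (suc d) w → Concentrated d (grow w)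
  grow-concentrated deg m e v m≢d = zero-combination (vanish e v) (vanish e (suc v)) (vanish (suc e) v) (vanish (suc e) (suc v))
    where
    vanish : ∀ e v → _ ≈ 0#
    vanish e v = deg (suc m) e v (m≢d ∘ ℕ.suc-injective)

  grow-0 : ∀ {w} → Concentrated 0 w → ∀ σ → grow w σ ≈ 0#
  grow-0 deg (m , e , v) = zero-combination (deg _ _ _ λ ()) (deg _ _ _ λ ()) (deg _ _ _ λ ()) (deg _ _ _ λ ())

  -- Every cycle on `suc d` letters arises from a fixed point by `d` insertions in exactly one way,
  -- so this is the sum of `w` over all of them.
  total : ℕ → Weight → Carrier
  total d w = iterate grow w d fixed

  -- Only the behaviour of `E` under insertion enters; `Enumeration` supplies the sum over
  -- permutations.
  module _ (E : ℕ → List Weight → Carrier)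
           (E-zero : ∀ Ws → E 0 Ws ≈ M [] Ws)
           (E-suc : ∀ n Ws → E (suc n) Ws ≈ ∑ₚ Ws (λ w Ws′ → w fixed * E n Ws′ + E n (grow w ∷ Ws′)))
           (E-0 : ∀ n w Ws → (∀ σ → w σ ≈ 0#) → E n (w ∷ Ws) ≈ 0#)
    where

    private
      DW : Set _
      DW = ℕ × Weight

      Ok : DW → Set _
      Ok (d , w) = Concentrated d w

      degree : List DW → ℕ
      degree Ds = ℕ.sum (map (suc ∘ proj₁) Ds)

      fact : List DW → ℕ
      fact Ds = ℕ.product (map (_! ∘ suc ∘ proj₁) Ds)

      tot : DW → Carrier
      tot (d , w) = total d w

    -- The letters are distributed over the cycles, which then evolve independently. In the
    -- induction, the summand of `E-suc` at `(d , w)` is `suc d` times a common value, and these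
    -- factors add up to `degree Ds`, which is `suc n`.
    closed-form : ∀ n Ds → All Ok Ds → degree Ds ≡ n →
                  ι (fact Ds) * E n (map proj₂ Ds) ≈ ι (n !) * ∏ Ds tot
    closed-form zero    []             _  _  = *-congˡ (E-zero [])
    closed-form (suc n) Ds ok Σ≡n = begin
      ι (fact Ds) * E (suc n) (map proj₂ Ds)
        ≈⟨ *-congˡ (trans (E-suc n (map proj₂ Ds)) (∑ₚ-map proj₂ Ds _)) ⟩
      ι (fact Ds) * ∑ₚ Ds (λ D Ds′ → proj₂ D fixed * E n (map proj₂ Ds′) + E n (grow (proj₂ D) ∷ map proj₂ Ds′))
        ≈⟨ ∑ₚ-*ˡ _ Ds _ ⟨
      ∑ₚ Ds (λ D Ds′ → ι (fact Ds) * (proj₂ D fixed * E n (map proj₂ Ds′) + E n (grow (proj₂ D) ∷ map proj₂ Ds′)))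
        ≈⟨ ∑ₚ-cong-↭ Ds step ⟩
      ∑ₚ Ds (λ D _ → ι (suc (proj₁ D)) * (ι (n !) * ∏ Ds tot))
        ≈⟨ ∑ₚ-*ʳ _ Ds _ ⟩
      ∑ₚ Ds (λ D _ → ι (suc (proj₁ D))) * (ι (n !) * ∏ Ds tot)
        ≈⟨ *-congʳ (trans (∑ₚ-forget Ds _) (∑-ι Ds)) ⟩
      ι (degree Ds) * (ι (n !) * ∏ Ds tot)
        ≈⟨ *-congʳ (reflexive (cong ι Σ≡n)) ⟩
      ι (suc n) * (ι (n !) * ∏ Ds tot)
        ≈⟨ *-assoc _ _ _ ⟨
      ι (suc n) * ι (n !) * ∏ Ds tot
        ≈⟨ *-congʳ (ι-* (suc n) (n !)) ⟨
      ι (suc n !) * ∏ Ds tot ∎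
      where
      ∑-ι : ∀ Ds → ∑ Ds (λ D → ι (suc (proj₁ D))) ≈ ι (degree Ds)
      ∑-ι []       = refl
      ∑-ι (D ∷ Ds) = trans (+-congˡ (∑-ι Ds)) (sym (ι-+ (suc (proj₁ D)) (degree Ds)))

      step : ∀ D Ds′ → Ds ↭ D ∷ Ds′ →
        ι (fact Ds) * (proj₂ D fixed * E n (map proj₂ Ds′) + E n (grow (proj₂ D) ∷ map proj₂ Ds′))
        ≈ ι (suc (proj₁ D)) * (ι (n !) * ∏ Ds tot)
      step (d , w) Ds′ p = begin
        ι (fact Ds) * (w fixed * E n Ws′ + E n (grow w ∷ Ws′))
          ≈⟨ *-congʳ (trans (reflexive (cong ι fact≡)) (trans (ι-* (suc d !) (fact Ds′)) (*-congʳ (ι-* (suc d) (d !))))) ⟩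
        ι (suc d) * ι (d !) * ι (fact Ds′) * (w fixed * E n Ws′ + E n (grow w ∷ Ws′))
          ≈⟨ trans (*-congʳ (*-assoc _ _ _)) (*-assoc _ _ _) ⟩
        ι (suc d) * (ι (d !) * ι (fact Ds′) * (w fixed * E n Ws′ + E n (grow w ∷ Ws′)))
          ≈⟨ *-congˡ (core d w Ds′ degree≡ ok′) ⟩
        ι (suc d) * (ι (n !) * (tot (d , w) * ∏ Ds′ tot))
          ≈⟨ *-congˡ (*-congˡ (∏-↭ tot p)) ⟨
        ι (suc d) * (ι (n !) * ∏ Ds tot) ∎
        where
        Ws′ = map proj₂ Ds′
        fact≡ : fact Ds ≡ (suc d !) ℕ.* fact Ds′
        fact≡ = ℕ.product-↭ (↭-map⁺ _ p)
        degree≡ : suc d ℕ.+ degree Ds′ ≡ suc n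
        degree≡ = ≡.trans (≡.sym (ℕ.sum-↭ (↭-map⁺ _ p))) Σ≡n
        ok′ : All Ok ((d , w) ∷ Ds′)
        ok′ = All-resp-↭ p ok
        core : ∀ d w Ds′ → suc d ℕ.+ degree Ds′ ≡ suc n → All Ok ((d , w) ∷ Ds′) →
          ι (d !) * ι (fact Ds′) * (w fixed * E n (map proj₂ Ds′) + E n (grow w ∷ map proj₂ Ds′))
          ≈ ι (n !) * (tot (d , w) * ∏ Ds′ tot)
        -- A weight concentrated on fixed points vanishes under `grow`, so the new letter can only
        -- be a fixed point.
        core zero w Ds′ deg≡ (deg ∷ degs) = begin
          ι 1 * ι (fact Ds′) * (w fixed * E n (map proj₂ Ds′) + E n (grow w ∷ map proj₂ Ds′))
            ≈⟨ *-cong (trans (*-congʳ ι-1) (*-identityˡ _)) (trans (+-congˡ (E-0 n _ _ (grow-0 deg))) (+-identityʳ _)) ⟩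
          ι (fact Ds′) * (w fixed * E n (map proj₂ Ds′))
            ≈⟨ x∙yz≈y∙xz _ _ _ ⟩
          w fixed * (ι (fact Ds′) * E n (map proj₂ Ds′))
            ≈⟨ *-congˡ (closed-form n Ds′ degs (ℕ.suc-injective deg≡)) ⟩
          w fixed * (ι (n !) * ∏ Ds′ tot)
            ≈⟨ x∙yz≈y∙xz _ _ _ ⟩
          ι (n !) * (w fixed * ∏ Ds′ tot) ∎
        -- Now the fixed-point term vanishes, and `grow w` of degree `d` replaces `w`.
        core (suc d) w Ds′ deg≡ (deg ∷ degs) = begin
          ι (suc d !) * ι (fact Ds′) * (w fixed * E n (map proj₂ Ds′) + E n (grow w ∷ map proj₂ Ds′))
            ≈⟨ *-cong (sym (ι-* (suc d !) (fact Ds′)))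
                 (trans (+-congʳ (trans (*-congʳ (deg 0 0 0 λ ())) (zeroˡ _))) (+-identityˡ _)) ⟩
          ι (fact ((d , grow w) ∷ Ds′)) * E n (grow w ∷ map proj₂ Ds′)
            ≈⟨ closed-form n ((d , grow w) ∷ Ds′) (grow-concentrated {w = w} deg ∷ degs) (ℕ.suc-injective deg≡) ⟩
          ι (n !) * (tot (suc d , w) * ∏ Ds′ tot) ∎

-- Valley hopping in the form of a recursion: in G k v p r, the numbers
-- v, p, r count the valleys, double ascents and double descents of a
-- cycle, with weights x, α, β, and k further elements are inserted.

module Hopping {c ℓ} (R : CommutativeSemiring c ℓ) where
  open CommutativeSemiring R
  open SemiringFold R using (ι; ι-+)
  open Exp semiring using (_^_)
  open NaturalSolver R using (solve; _:=_; _:+_; _:*_; con)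
  open ≈-Reasoning setoid

  module _ (x α β : Carrier) where

    G : ℕ → ℕ → ℕ → ℕ → Carrier
    G zero    v p r = x ^ v * (α ^ p * β ^ r)
    -- An arc at a valley turns that valley into a double ascent or a double descent. Any other arc
    -- turns a double ascent or a double descent into a peak. The new letter is a valley in every
    -- case.
    G (suc k) v p r = ι v * (G k v (suc p) r + G k v p (suc r))
                    + (ι p * G k (suc v) (pred p) r + ι r * G k (suc v) p (pred r))

    -- The sum of G over all 2^d ways of making d further letters double
    -- ascents or double descents.
    T : ℕ → ℕ → ℕ → ℕ → ℕ → Carrier
    T k v zero    p r = G k v p r
    T k v (suc d) p r = T k v d (suc p) r + T k v d p (suc r)

    private
      -- The factor `ι p` kills the truncated `pred` at zero; otherwise this is the definition of
      -- `T`.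
      pascal : ∀ k v d p r → ι p * T k v d p r + ι p * T k v d (pred p) (suc r) ≈ ι p * T k v (suc d) (pred p) r
      pascal k v d zero    r = trans (+-cong (zeroˡ _) (zeroˡ _)) (trans (+-identityˡ 0#) (sym (zeroˡ _)))
      pascal k v d (suc p) r = sym (distribˡ _ _ _)

      pascal′ : ∀ k v d p r → ι r * T k v d (suc p) (pred r) + ι r * T k v d p r ≈ ι r * T k v (suc d) p (pred r)
      pascal′ k v d p zero    = trans (+-cong (zeroˡ _) (zeroˡ _)) (trans (+-identityˡ 0#) (sym (zeroˡ _)))
      pascal′ k v d p (suc r) = sym (distribˡ _ _ _)


      lower : ∀ k v d p r → ι d * (T k v (pred d) (suc p) r + T k v (pred d) p (suc r)) ≈ ι d * T k v d p r
      lower k v zero    p r = trans (zeroˡ _) (sym (zeroˡ _))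
      lower k v (suc d) p r = refl

    -- An arc at a valley leaves one more undecided letter, as both outcomes occur. Turning an
    -- undecided letter into a peak removes it, and its two choices contribute equally, hence
    -- `d + d`.
    T-suc : ∀ k v d p r → T (suc k) v d p r ≈
      ι v * T k v (suc d) p r + ι (d ℕ.+ d) * T k (suc v) (pred d) p r
      + (ι p * T k (suc v) d (pred p) r + ι r * T k (suc v) d p (pred r))
    T-suc k v zero    p r = +-congʳ (sym (trans (+-congˡ (zeroˡ _)) (+-identityʳ _)))
    T-suc k v (suc d) p r = begin
      T (suc k) v d (suc p) r + T (suc k) v d p (suc r)
        ≈⟨ +-cong (T-suc k v d (suc p) r) (T-suc k v d p (suc r)) ⟩
      (V * a + D * b + (ι (suc p) * X + Q * f)) + (V * a′ + D * b′ + (P * e + ι (suc r) * X))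
        ≈⟨ +-cong (+-congˡ (+-congʳ (ι-suc p))) (+-congˡ (+-congˡ (ι-suc r))) ⟩
      (V * a + D * b + ((X + P * X) + Q * f)) + (V * a′ + D * b′ + (P * e + (X + Q * X)))
        ≈⟨ solve 10 (λ V D P Q X a a′ bb f e →
             (V :* a :+ bb :+ ((X :+ P :* X) :+ Q :* f)) :+ (V :* a′ :+ D :+ (P :* e :+ (X :+ Q :* X)))
             := V :* (a :+ a′) :+ (bb :+ D :+ (X :+ X)) :+ ((P :* X :+ P :* e) :+ (Q :* f :+ Q :* X)))
             refl V (D * b′) P Q X a a′ (D * b) f e ⟩
      V * (a + a′) + (D * b + D * b′ + (X + X)) + ((P * X + P * e) + (Q * f + Q * X))
        ≈⟨ +-cong (+-congˡ mid) (+-cong (pascal k (suc v) d p r) (pascal′ k (suc v) d p r)) ⟩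
      ι v * T k v (suc (suc d)) p r + ι (suc d ℕ.+ suc d) * T k (suc v) d p r
        + (ι p * T k (suc v) (suc d) (pred p) r + ι r * T k (suc v) (suc d) p (pred r)) ∎
      where
      ι-suc : ∀ n {x} → ι (suc n) * x ≈ x + ι n * x
      ι-suc n = trans (distribʳ _ _ _) (+-congʳ (*-identityˡ _))
      V = ι v
      D = ι (d ℕ.+ d)
      P = ι p
      Q = ι r
      X = T k (suc v) d p r
      a = T k v (suc d) (suc p) r
      a′ = T k v (suc d) p (suc r)
      b = T k (suc v) (pred d) (suc p) r
      b′ = T k (suc v) (pred d) p (suc r)
      f = T k (suc v) d (suc p) (pred r)
      e = T k (suc v) d (pred p) (suc r)
      mid : D * b + D * b′ + (X + X) ≈ ι (suc d ℕ.+ suc d) * X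
      mid = begin
        D * b + D * b′ + (X + X)
          ≈⟨ +-congʳ (trans (sym (distribˡ _ _ _)) (trans (*-congʳ (ι-+ d d)) (distribʳ _ _ _))) ⟩
        ι d * (b + b′) + ι d * (b + b′) + (X + X)
          ≈⟨ +-congʳ (+-cong (lower k (suc v) d p r) (lower k (suc v) d p r)) ⟩
        ι d * X + ι d * X + (X + X)
          ≈⟨ solve 2 (λ dX X → dX :+ dX :+ (X :+ X) := (X :+ dX) :+ (X :+ dX)) refl (ι d * X) X ⟩
        (X + ι d * X) + (X + ι d * X)
          ≈⟨ +-cong (ι-suc d) (ι-suc d) ⟨
        ι (suc d) * X + ι (suc d) * X
          ≈⟨ distribʳ _ _ _ ⟨
        (ι (suc d) + ι (suc d)) * X
          ≈⟨ *-congʳ (ι-+ (suc d) (suc d)) ⟨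
        ι (suc d ℕ.+ suc d) * X ∎

    T-zero : ∀ v d p r → T 0 v d p r ≈ x ^ v * (α ^ p * β ^ r) * (α + β) ^ d
    T-zero v zero    p r = sym (*-identityʳ _)
    T-zero v (suc d) p r = trans (+-cong (T-zero v d (suc p) r) (T-zero v d p (suc r)))
      (solve 6 (λ x a b α β q → x :* (α :* a :* b) :* q :+ x :* (a :* (β :* b)) :* q
                             := x :* (a :* b) :* ((α :+ β) :* q))
             refl (x ^ v) (α ^ p) (β ^ r) α β ((α + β) ^ d))

  -- The recursion of `T` without decided letters, where only the sum `q` of the two hopping weights
  -- is visible.
  K : Carrier → Carrier → ℕ → ℕ → ℕ → Carrier
  K x q zero    v d = x ^ v * q ^ d
  K x q (suc k) v d = ι v * K x q k v (suc d) + ι (d ℕ.+ d) * K x q k (suc v) (pred d)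

  T≈K : ∀ x α β k v d → T x α β k v d 0 0 ≈ K x (α + β) k v d
  T≈K x α β zero    v d = trans (T-zero x α β v d 0 0) (*-congʳ (trans (*-congˡ (*-identityˡ 1#)) (*-identityʳ _)))
  T≈K x α β (suc k) v d = begin
    T x α β (suc k) v d 0 0
      ≈⟨ T-suc x α β k v d 0 0 ⟩
    _ + (0# * _ + 0# * _)
      ≈⟨ trans (+-congˡ (trans (+-cong (zeroˡ _) (zeroˡ _)) (+-identityˡ 0#))) (+-identityʳ _) ⟩
    ι v * T x α β k v (suc d) 0 0 + ι (d ℕ.+ d) * T x α β k (suc v) (pred d) 0 0
      ≈⟨ +-cong (*-congˡ (T≈K x α β k v (suc d))) (*-congˡ (T≈K x α β k (suc v) (pred d))) ⟩
    K x (α + β) (suc k) v d ∎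

  K-cong : ∀ {x x′ q q′} → x ≈ x′ → q ≈ q′ → ∀ k v d → K x q k v d ≈ K x′ q′ k v d
  K-cong p q zero    v d = *-cong (Exp.^-congˡ semiring v p) (Exp.^-congˡ semiring d q)
  K-cong p q (suc k) v d = +-cong (*-congˡ (K-cong p q k v (suc d))) (*-congˡ (K-cong p q k (suc v) (pred d)))

  G-invariant : ∀ {x x′ α α′ β β′} → x ≈ x′ → α + β ≈ α′ + β′ → ∀ k v → G x α β k v 0 0 ≈ G x′ α′ β′ k v 0 0
  G-invariant p q k v = trans (T≈K _ _ _ k v 0) (trans (K-cong p q k v 0) (sym (T≈K _ _ _ k v 0)))

-- d, the degree, is one less than the cycle length throughout.

module CyclePolynomial {c ℓ} (R : CommutativeSemiring c ℓ) where
  open CommutativeSemiring R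
  open SemiringFold R using (ι; ι-+; ι-1)
  open Growth R
  open Hopping R
  open Exp semiring using (_^_; ^-homo-*)
  open CommutativeExp R using (^-distrib-*)
  open NaturalSolver R using (solve; _:=_; _:+_; _:*_)
  open ≈-Reasoning setoid

  private
    iterate-suc : ∀ {a} {A : Set a} (f : A → A) k x → iterate f x (suc k) ≡ f (iterate f x k)
    iterate-suc f zero    x = ≡.refl
    iterate-suc f (suc k) x = iterate-suc f k (f x)

    1^ : ∀ n → 1# ^ n ≈ 1#
    1^ zero    = refl
    1^ (suc n) = trans (*-identityˡ _) (1^ n)

    ι-pred : ∀ n {x y} → (∀ m → n ≡ suc m → x ≈ y) → ι n * x ≈ ι n * y
    ι-pred zero    _ = trans (zeroˡ _) (sym (zeroˡ _))
    ι-pred (suc n) p = *-congˡ (p n ≡.refl)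

  module _ (s t : Carrier) where

    cycleWeight : ℕ → Weight
    cycleWeight d (m , e , v) = if does (m ℕ.≟ d) then s ^ v * t ^ e else 0#

    cycleWeight-concentrated : ∀ d → Concentrated d (cycleWeight d)
    cycleWeight-concentrated d m e v m≢d rewrite dec-false (m ℕ.≟ d) m≢d = refl

    private
      -- There are as many peaks as valleys, so the `suc m` letters number `2 (suc v) + p + r`, and
      -- the excedances are the valleys and the double ascents. Hence a valley weighs `s * t`, a
      -- double ascent `t`, and the other letters 1. The form `suc v` reflects that a cycle of
      -- length at least two has a valley.
      hop : ∀ k m e v p r → m ≡ v ℕ.+ suc v ℕ.+ p ℕ.+ r → e ≡ suc v ℕ.+ p →
            iterate grow (cycleWeight (k ℕ.+ m)) k (m , e , suc v) ≈ G (s * t) t 1# k (suc v) p r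
      hop zero m _ v p r _ ≡.refl rewrite dec-true (m ℕ.≟ m) ≡.refl = begin
        s ^ suc v * t ^ (suc v ℕ.+ p)        ≈⟨ *-congˡ (^-homo-* t (suc v) p) ⟩
        s ^ suc v * (t ^ suc v * t ^ p)      ≈⟨ *-assoc _ _ _ ⟨
        s ^ suc v * t ^ suc v * t ^ p        ≈⟨ *-cong (^-distrib-* s t (suc v)) (trans (*-congˡ (1^ r)) (*-identityʳ _)) ⟨
        (s * t) ^ suc v * (t ^ p * 1# ^ r)   ∎
      hop (suc k) m e v p r m≡ e≡ rewrite iterate-suc grow k (cycleWeight (suc k ℕ.+ m)) | ≡.sym (ℕ.+-suc k m) = begin
        ι (suc v) * w (suc m , e , suc v) + ι (e ∸ suc v) * w (suc m , e , suc (suc v))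
          + ι (suc v) * w (suc m , suc e , suc v) + ι (suc m ∸ e ∸ suc v) * w (suc m , suc e , suc (suc v))
          ≈⟨ +-cong (+-cong (+-cong
               (*-congˡ (hop k (suc m) e v p (suc r) (≡.trans (cong suc m≡) (≡.sym (ℕ.+-suc _ r))) e≡))
               (trans (*-congʳ (reflexive (cong ι p≡))) (ι-pred p λ { p′ ≡.refl → hop k (suc m) e (suc v) p′ r (≡.trans (cong suc m≡) (m₁ p′ r)) (≡.trans e≡ (ℕ.+-suc _ p′)) })))
               (*-congˡ (hop k (suc m) (suc e) v (suc p) r m₂ (≡.trans (cong suc e≡) (≡.sym (ℕ.+-suc _ p))))))
               (trans (*-congʳ (reflexive (cong ι r≡))) (ι-pred r λ { r′ ≡.refl → hop k (suc m) (suc e) (suc v) p r′ (≡.trans (cong suc m≡) (m₃ p r′)) (cong suc e≡) })) ⟩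
        V * G′ (suc v) p (suc r) + ι p * G′ (suc (suc v)) (pred p) r + V * G′ (suc v) (suc p) r + ι r * G′ (suc (suc v)) p (pred r)
          ≈⟨ solve 5 (λ V a b c d → V :* a :+ b :+ V :* c :+ d := V :* (c :+ a) :+ (b :+ d)) refl V _ _ _ _ ⟩
        V * (G′ (suc v) (suc p) r + G′ (suc v) p (suc r)) + (ι p * G′ (suc (suc v)) (pred p) r + ι r * G′ (suc (suc v)) p (pred r)) ∎
        where
        open +-*-Solver using () renaming (solve to solveℕ; _:=_ to _≐_; _:+_ to _⊕_; con to num)
        w  = iterate grow (cycleWeight (k ℕ.+ suc m)) k
        G′ = G (s * t) t 1# k
        V  = ι (suc v)
        p≡ : e ∸ suc v ≡ p
        p≡ = ≡.trans (cong (_∸ suc v) e≡) (ℕ.m+n∸m≡n (suc v) p)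
        r≡ : suc m ∸ e ∸ suc v ≡ r
        r≡ = ≡.trans (cong (_∸ suc v) (≡.trans (≡.cong₂ _∸_ (≡.trans (cong suc m≡) rearrange) e≡)
               (ℕ.m+n∸m≡n (suc v ℕ.+ p) (suc v ℕ.+ r)))) (ℕ.m+n∸m≡n (suc v) r)
          where
          rearrange : suc (v ℕ.+ suc v ℕ.+ p ℕ.+ r) ≡ (suc v ℕ.+ p) ℕ.+ (suc v ℕ.+ r)
          rearrange = solveℕ 3 (λ v p r → num 1 ⊕ (v ⊕ (num 1 ⊕ v) ⊕ p ⊕ r) ≐ ((num 1 ⊕ v) ⊕ p) ⊕ ((num 1 ⊕ v) ⊕ r)) ≡.refl v p r
        m₂ : suc m ≡ v ℕ.+ suc v ℕ.+ suc p ℕ.+ r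
        m₂ = ≡.trans (cong suc m≡) (cong (ℕ._+ r) (≡.sym (ℕ.+-suc (v ℕ.+ suc v) p)))
        m₁ : ∀ p r → suc (v ℕ.+ suc v ℕ.+ suc p ℕ.+ r) ≡ suc v ℕ.+ suc (suc v) ℕ.+ p ℕ.+ r
        m₁ p r = solveℕ 3 (λ v p r → num 1 ⊕ (v ⊕ (num 1 ⊕ v) ⊕ (num 1 ⊕ p) ⊕ r)
                                   ≐ (num 1 ⊕ v) ⊕ (num 2 ⊕ v) ⊕ p ⊕ r) ≡.refl v p r
        m₃ : ∀ p r → suc (v ℕ.+ suc v ℕ.+ p ℕ.+ suc r) ≡ suc v ℕ.+ suc (suc v) ℕ.+ p ℕ.+ r
        m₃ p r = solveℕ 3 (λ v p r → num 1 ⊕ (v ⊕ (num 1 ⊕ v) ⊕ p ⊕ (num 1 ⊕ r))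
                                   ≐ (num 1 ⊕ v) ⊕ (num 2 ⊕ v) ⊕ p ⊕ r) ≡.refl v p r

    -- The first insertion has no choice: it turns the fixed point into a 2-cycle, whose state is
    -- `(1 , 1 , 1)`.
    total-cycleWeight : ∀ d → total (suc d) (cycleWeight (suc d)) ≈ G (s * t) t 1# d 1 0 0
    total-cycleWeight d = begin
      total (suc d) (cycleWeight (suc d))
        ≈⟨ reflexive (cong (λ w → w fixed) (iterate-suc grow d (cycleWeight (suc d)))) ⟩
      0# * _ + 0# * _ + 0# * _ + (1# + 0#) * w (1 , 1 , 1)
        ≈⟨ +-cong (+-cong (+-cong (zeroˡ _) (zeroˡ _)) (zeroˡ _)) (trans (*-congʳ ι-1) (*-identityˡ _)) ⟩
      0# + 0# + 0# + w (1 , 1 , 1)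
        ≈⟨ trans (+-congʳ (trans (+-identityʳ _) (+-identityʳ _))) (+-identityˡ _) ⟩
      w (1 , 1 , 1)
        ≈⟨ reflexive (cong (λ i → iterate grow (cycleWeight i) d (1 , 1 , 1)) (ℕ.+-comm 1 d)) ⟩
      iterate grow (cycleWeight (d ℕ.+ 1)) d (1 , 1 , 1)
        ≈⟨ hop d 1 1 0 0 0 ≡.refl ≡.refl ⟩
      G (s * t) t 1# d 1 0 0 ∎
      where
      w = iterate grow (cycleWeight (suc d)) d

  module _ (a b : Carrier) where

    -- The homogeneous Eulerian recursion, with `e` and `f` the exponents of `b` and `a`.
    U : ℕ → ℕ → ℕ → Carrier
    U zero    e f = b ^ e * a ^ f
    U (suc k) e f = ι e * U k e (suc f) + ι f * U k (suc e) f

    -- With `b` per excedance and `a` per other letter, a valley and a peak together weigh `a * b`.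
    U≈G : ∀ k {e f} v p r → e ≡ v ℕ.+ p → f ≡ v ℕ.+ r → U k e f ≈ G (a * b) b a k v p r
    U≈G zero v p r ≡.refl ≡.refl = begin
      b ^ (v ℕ.+ p) * a ^ (v ℕ.+ r)          ≈⟨ *-cong (^-homo-* b v p) (^-homo-* a v r) ⟩
      (b ^ v * b ^ p) * (a ^ v * a ^ r)      ≈⟨ solve 4 (λ bv bp av ar → (bv :* bp) :* (av :* ar) := (av :* bv) :* (bp :* ar)) refl _ _ _ _ ⟩
      (a ^ v * b ^ v) * (b ^ p * a ^ r)      ≈⟨ *-congʳ (^-distrib-* a b v) ⟨
      (a * b) ^ v * (b ^ p * a ^ r)          ∎
    U≈G (suc k) {e} {f} v p r ≡.refl ≡.refl = begin
      ι (v ℕ.+ p) * X + ι (v ℕ.+ r) * Y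
        ≈⟨ +-cong (*-congʳ (ι-+ v p)) (*-congʳ (ι-+ v r)) ⟩
      (ι v + ι p) * X + (ι v + ι r) * Y
        ≈⟨ solve 5 (λ V P Q X Y → (V :+ P) :* X :+ (V :+ Q) :* Y := V :* (Y :+ X) :+ (P :* X :+ Q :* Y)) refl _ _ _ _ _ ⟩
      ι v * (Y + X) + (ι p * X + ι r * Y)
        ≈⟨ +-cong (*-congˡ (+-cong (U≈G k v (suc p) r (≡.sym (ℕ.+-suc v p)) ≡.refl) (U≈G k v p (suc r) ≡.refl (≡.sym (ℕ.+-suc v r)))))
             (+-cong (ι-pred p λ { p′ ≡.refl → U≈G k (suc v) p′ r (ℕ.+-suc v p′) ≡.refl })
                     (ι-pred r λ { r′ ≡.refl → U≈G k (suc v) p r′ ≡.refl (ℕ.+-suc v r′) })) ⟩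
      G (a * b) b a (suc k) v p r ∎
      where
      X = U k (v ℕ.+ p) (suc (v ℕ.+ r))
      Y = U k (suc (v ℕ.+ p)) (v ℕ.+ r)

    total≈U : ∀ {s t} → a * b ≈ s * t → a + b ≈ 1# + t → ∀ d →
              total (suc d) (cycleWeight s t (suc d)) ≈ U (suc d) 1 0
    total≈U {s} {t} ab≈st a+b≈1+t d = begin
      total (suc d) (cycleWeight s t (suc d))  ≈⟨ total-cycleWeight s t d ⟩
      G (s * t) t 1# d 1 0 0                   ≈⟨ G-invariant (sym ab≈st) (trans (+-comm _ _) (trans (sym a+b≈1+t) (+-comm _ _))) d 1 ⟩
      G (a * b) b a d 1 0 0                    ≈⟨ U≈G d 1 0 0 ≡.refl ≡.refl ⟨
      -- One step of the recursion read backwards, to reach the state that belongs to the empty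
      -- permutation in `∑-U`.
      U d 1 1                                  ≈⟨ trans (+-cong (trans (*-congʳ ι-1) (*-identityˡ _)) (zeroˡ _)) (+-identityʳ _) ⟨
      U (suc d) 1 0                            ∎

open ≡ using (refl)

-- Cycles under insertion of a new smallest element

iterate-+ : ∀ {a} {A : Set a} (f : A → A) x j k → iterate f x (j ℕ.+ k) ≡ iterate f (iterate f x j) k
iterate-+ f x zero    k = refl
iterate-+ f x (suc j) k = iterate-+ f (f x) j k

module _ {n} (π : Permutation′ n) where

  private
    f = π ⟨$⟩ʳ_

    f-injective : ∀ {x y} → f x ≡ f y → x ≡ y
    f-injective {x} {y} p = ≡.trans (≡.sym (inverseˡ π)) (≡.trans (cong (π ⟨$⟩ˡ_) p) (inverseˡ π))

    iterate-injective : ∀ k {x y} → iterate f x k ≡ iterate f y k → x ≡ y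
    iterate-injective zero    p = p
    iterate-injective (suc k) p = f-injective (iterate-injective k p)

  Reach : Fin n → Fin n → Set
  Reach x y = ∃ λ k → iterate f x k ≡ y

  reach-refl : ∀ {x} → Reach x x
  reach-refl = 0 , refl

  reach-trans : ∀ {x y z} → Reach x y → Reach y z → Reach x z
  reach-trans {x} (j , refl) (k , q) = j ℕ.+ k , ≡.trans (iterate-+ f x j k) q

  reach-step : ∀ {x} → Reach x (f x)
  reach-step = 1 , refl

  -- Two of the first `n + 1` iterates coincide, and injectivity moves the coincidence back to `x`.
  period : ∀ x → ∃ λ q → suc q ≤ n × iterate f x (suc q) ≡ x
  period x with Fin.pigeonhole {n} {suc n} ℕ.≤-refl (λ k → iterate f x (toℕ k))
  ... | i , j , i<j , eq = q , q<n , iterate-injective (toℕ i) (begin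
    iterate f (iterate f x (suc q)) (toℕ i)  ≡⟨ iterate-+ f x (suc q) (toℕ i) ⟨
    iterate f x (suc q ℕ.+ toℕ i)            ≡⟨ cong (iterate f x) sq+i≡j ⟩
    iterate f x (toℕ j)                      ≡⟨ eq ⟨
    iterate f x (toℕ i)                      ∎)
    where
    open ≡-Reasoning
    q = toℕ j ∸ suc (toℕ i)
    sq+i≡j : suc q ℕ.+ toℕ i ≡ toℕ j
    sq+i≡j = ≡.trans (≡.sym (ℕ.+-suc q (toℕ i))) (ℕ.m∸n+n≡m i<j)
    q<n : suc q ≤ n
    q<n = ℕ.≤-trans (ℕ.m≤m+n (suc q) (toℕ i)) (ℕ.≤-trans (ℕ.≤-reflexive sq+i≡j) (Fin.toℕ≤pred[n] j))

  reach-back : ∀ x → Reach (f x) x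
  reach-back x with q , _ , r ← period x = q , r

  reach-sym : ∀ {x y} → Reach x y → Reach y x
  reach-sym (k , p) = go k p
    where
    go : ∀ k {x y} → iterate f x k ≡ y → Reach y x
    go zero    refl = reach-refl
    go (suc k) p    = reach-trans (go k p) (reach-back _)

  -- The number of steps may be reduced modulo the period, so the `n` iterates inspected by `cycle`
  -- cover the whole orbit.
  reach-bounded : ∀ {x y} → Reach x y → ∃ λ (k : Fin n) → iterate f x (toℕ k) ≡ y
  reach-bounded {x} {y} (k , p) with q , q<n , r ← period x = fromℕ< k%q<n , (begin
    iterate f x (toℕ (fromℕ< k%q<n))                               ≡⟨ cong (iterate f x) (Fin.toℕ-fromℕ< k%q<n) ⟩
    iterate f x (k % suc q)                                        ≡⟨ cong (λ z → iterate f z (k % suc q)) (multiple q r (k div suc q)) ⟨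
    iterate f (iterate f x (k div suc q ℕ.* suc q)) (k % suc q)    ≡⟨ iterate-+ f x (k div suc q ℕ.* suc q) (k % suc q) ⟨
    iterate f x (k div suc q ℕ.* suc q ℕ.+ k % suc q)              ≡⟨ cong (iterate f x) (ℕ.+-comm (k div suc q ℕ.* suc q) (k % suc q)) ⟩
    iterate f x (k % suc q ℕ.+ k div suc q ℕ.* suc q)              ≡⟨ cong (iterate f x) (m≡m%n+[m/n]*n k (suc q)) ⟨
    iterate f x k                                                  ≡⟨ p ⟩
    y                                                              ∎)
    where
    open ≡-Reasoning
    k%q<n : k % suc q < n
    k%q<n = ℕ.<-≤-trans (m%n<n k (suc q)) q<n
    multiple : ∀ q → iterate f x (suc q) ≡ x → ∀ m → iterate f x (m ℕ.* suc q) ≡ x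
    multiple q r zero    = refl
    multiple q r (suc m) = ≡.trans (iterate-+ f x (suc q) (m ℕ.* suc q))
      (≡.trans (cong (λ z → iterate f z (m ℕ.* suc q)) r) (multiple q r m))

  -- Chosen so that cycle π x is tabulate (does ∘ reach? x) by computation.
  reach? : ∀ x y → Dec (Reach x y)
  reach? x y = map′ (λ (k , p) → toℕ k , p) reach-bounded
    (Fin.any? λ (k : Fin n) → iterate f x (toℕ k) Fin.≟ y)

  lookup-cycle : ∀ x y → lookup (cycle π x) y ≡ does (reach? x y)
  lookup-cycle x y = Vec.lookup∘tabulate (does ∘ reach? x) y

  reach⇒cycle≡ : ∀ {x y} → Reach x y → cycle π x ≡ cycle π y
  reach⇒cycle≡ {x} {y} p = Vec.tabulate-cong λ z →
    does-⇔ (mk⇔ (reach-trans (reach-sym p)) (reach-trans p)) (reach? x z) (reach? y z)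

  lookup-cycle⇒reach : ∀ {x y} → lookup (cycle π x) y ≡ true → Reach x y
  lookup-cycle⇒reach {x} {y} p = does-true (reach? x y) (≡.trans (≡.sym (lookup-cycle x y)) p)
    where
    does-true : ∀ {A : Set} (a? : Dec A) → does a? ≡ true → A
    does-true (yes a) _ = a

  reach⇒lookup-cycle : ∀ {x y} → Reach x y → lookup (cycle π x) y ≡ true
  reach⇒lookup-cycle {x} {y} r = ≡.trans (lookup-cycle x y) (dec-true (reach? x y) r)

  cycle≡⇒reach : ∀ {x y} → cycle π x ≡ cycle π y → Reach x y
  cycle≡⇒reach {x} {y} p = lookup-cycle⇒reach (≡.trans (cong (λ c → lookup c y) p) (reach⇒lookup-cycle reach-refl))

_≟ₛ_ : ∀ {n} → DecidableEquality (Subset n)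
_≟ₛ_ = Vec.≡-dec Bool._≟_

lookup-cycle≡does : ∀ {n} (π : Permutation′ n) x y → lookup (cycle π x) y ≡ does (cycle π x ≟ₛ cycle π y)
lookup-cycle≡does π x y = ≡.trans (lookup-cycle π x y)
  (does-⇔ (mk⇔ (reach⇒cycle≡ π) (cycle≡⇒reach π)) (reach? π x y) (cycle π x ≟ₛ cycle π y))

cycles-unique : ∀ {n} (π : Permutation′ n) → Unique (cycles π)
cycles-unique {n} π = DecUnique.deduplicate-! _≟ₛ_ (map (cycle π) (allFin n))

∈-cycles⁻ : ∀ {n} (π : Permutation′ n) {c} → c ∈ cycles π → ∃ λ x → c ≡ cycle π x
∈-cycles⁻ {n} π p with x , _ , q ← ∈-map⁻ (cycle π) (∈-deduplicate⁻ _≟ₛ_ (map (cycle π) (allFin n)) p) = x , q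

∈-cycles⁺ : ∀ {n} (π : Permutation′ n) x → cycle π x ∈ cycles π
∈-cycles⁺ π x = ∈-deduplicate⁺ _≟ₛ_ (∈-map⁺ (cycle π) (∈-allFin x))

-- Composition runs from left to right: for `j = suc i`, the letter `suc i` goes to `0F` and `0F`
-- goes to `suc (π i)`.
insert₀ : ∀ {n} → Fin (suc n) → Permutation′ n → Permutation′ (suc n)
insert₀ j π = transpose 0F j ∘ₚ lift₀ π

module _ {n} (π : Permutation′ n) where

  private
    π₀ = insert₀ 0F π

    reach₀⁺ : ∀ {x y} → Reach π x y → Reach π₀ (Fin.suc x) (Fin.suc y)
    reach₀⁺ (zero  , refl) = reach-refl π₀
    reach₀⁺ (suc k , p)    = reach-trans π₀ (reach-step π₀) (reach₀⁺ (k , p))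

    reach₀⁻ : ∀ {x y} → Reach π₀ (Fin.suc x) (Fin.suc y) → Reach π x y
    reach₀⁻ (zero  , p) = 0 , Fin.suc-injective p
    reach₀⁻ (suc k , p) = reach-trans π (reach-step π) (reach₀⁻ (k , p))

    reach₀-0 : ∀ {y} → Reach π₀ 0F y → 0F ≡ y
    reach₀-0 (zero  , p) = p
    reach₀-0 (suc k , p) = reach₀-0 (k , p)

  cycle-insert₀-0-0 : cycle π₀ 0F ≡ true Vec.∷ ⊥
  cycle-insert₀-0-0 = cong₂ Vec._∷_ (dec-true (reach? π₀ 0F 0F) (reach-refl π₀))
    (≡.trans (Vec.tabulate-cong {g = λ _ → false} λ y → dec-false (reach? π₀ 0F (Fin.suc y)) λ r → contradiction (reach₀-0 r) λ ())
      (tabulate-false n))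
    where
    tabulate-false : ∀ n → tabulate {n = n} (λ _ → false) ≡ ⊥
    tabulate-false zero    = refl
    tabulate-false (suc n) = cong (false Vec.∷_) (tabulate-false n)

  cycle-insert₀-0-suc : ∀ x → cycle π₀ (Fin.suc x) ≡ false Vec.∷ cycle π x
  cycle-insert₀-0-suc x = cong₂ Vec._∷_
    (dec-false (reach? π₀ (Fin.suc x) 0F) λ r → contradiction (reach₀-0 (reach-sym π₀ r)) λ ())
    (Vec.tabulate-cong λ y → does-⇔ (mk⇔ reach₀⁻ reach₀⁺) (reach? π₀ (Fin.suc x) (Fin.suc y)) (reach? π x y))

  -- Lists without repetitions that have the same members agree up to order, so the order chosen by
  -- `cycles` need not be followed.
  cycles-insert₀-0 : cycles π₀ ↭ (true Vec.∷ ⊥) ∷ map (false Vec.∷_) (cycles π)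
  cycles-insert₀-0 = ∼bag⇒↭ (unique∧set⇒bag (cycles-unique π₀)
    (All.tabulate (λ p q → head≢ (∈-map⁻ (false Vec.∷_) p) q) ∷ Unique.map⁺ (λ { refl → refl }) (cycles-unique π)) (mk⇔ to from))
    where
    head≢ : ∀ {c xs} → (∃ λ d → d ∈ xs × c ≡ false Vec.∷ d) → true Vec.∷ ⊥ ≢ c
    head≢ (_ , _ , refl) ()
    to : ∀ {c} → c ∈ cycles π₀ → c ∈ (true Vec.∷ ⊥) ∷ map (false Vec.∷_) (cycles π)
    to p with ∈-cycles⁻ π₀ p
    ... | 0F        , refl = here cycle-insert₀-0-0
    ... | Fin.suc x , refl = there (subst (_∈ map (false Vec.∷_) (cycles π)) (≡.sym (cycle-insert₀-0-suc x)) (∈-map⁺ (false Vec.∷_) (∈-cycles⁺ π x)))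
    from : ∀ {c} → c ∈ (true Vec.∷ ⊥) ∷ map (false Vec.∷_) (cycles π) → c ∈ cycles π₀
    from (here refl) = subst (_∈ cycles π₀) cycle-insert₀-0-0 (∈-cycles⁺ π₀ 0F)
    from (there p) with _ , q , refl ← ∈-map⁻ (false Vec.∷_) p with x , refl ← ∈-cycles⁻ π q =
      subst (_∈ cycles π₀) (cycle-insert₀-0-suc x) (∈-cycles⁺ π₀ (Fin.suc x))

module _ {n} (π : Permutation′ n) (j : Fin n) where

  private
    πⱼ = insert₀ (Fin.suc j) π

  insert₀-ʳ-≡ : πⱼ ⟨$⟩ʳ Fin.suc j ≡ 0F
  insert₀-ʳ-≡ with j Fin.≟ j
  ... | yes _  = refl
  ... | no j≢j = contradiction refl j≢j

  insert₀-ʳ-≢ : ∀ {i} → i ≢ j → πⱼ ⟨$⟩ʳ Fin.suc i ≡ Fin.suc (π ⟨$⟩ʳ i)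
  insert₀-ʳ-≢ {i} i≢j with i Fin.≟ j
  ... | yes i≡j = contradiction i≡j i≢j
  ... | no  _   = refl

  insert₀-ˡ-≡ : ∀ {i} → π ⟨$⟩ˡ i ≡ j → πⱼ ⟨$⟩ˡ Fin.suc i ≡ 0F
  insert₀-ˡ-≡ {i} p with π ⟨$⟩ˡ i Fin.≟ j
  ... | yes _ = refl
  ... | no ¬p = contradiction p ¬p

  insert₀-ˡ-≢ : ∀ {i} → π ⟨$⟩ˡ i ≢ j → πⱼ ⟨$⟩ˡ Fin.suc i ≡ Fin.suc (π ⟨$⟩ˡ i)
  insert₀-ˡ-≢ {i} ¬p with π ⟨$⟩ˡ i Fin.≟ j
  ... | yes p = contradiction p ¬p
  ... | no _  = refl

  private
    -- Skipping over the new element turns a step of πⱼ into at most one step of π.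
    skip : Fin (suc n) → Fin n
    skip 0F          = j
    skip (Fin.suc i) = i

    skip-step : ∀ a → Reach π (skip a) (skip (πⱼ ⟨$⟩ʳ a))
    skip-step 0F          = reach-step π
    skip-step (Fin.suc i) with i Fin.≟ j
    ... | yes refl = reach-refl π
    ... | no _     = reach-step π

    reach-skip : ∀ {a b} → Reach πⱼ a b → Reach π (skip a) (skip b)
    reach-skip         (zero  , refl) = reach-refl π
    reach-skip {a} {b} (suc k , p)    = reach-trans π (skip-step a) (reach-skip (k , p))

    reach-0 : Reach πⱼ (Fin.suc j) 0F
    reach-0 = 1 , insert₀-ʳ-≡

    suc-step : ∀ x → Reach πⱼ (Fin.suc x) (Fin.suc (π ⟨$⟩ʳ x))
    suc-step x = by-cases (x Fin.≟ j)
      where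
      by-cases : Dec (x ≡ j) → Reach πⱼ (Fin.suc x) (Fin.suc (π ⟨$⟩ʳ x))
      by-cases (yes refl) = reach-trans πⱼ reach-0 (reach-step πⱼ)
      by-cases (no x≢j)   = 1 , insert₀-ʳ-≢ x≢j

    reach-suc : ∀ {x y} → Reach π x y → Reach πⱼ (Fin.suc x) (Fin.suc y)
    reach-suc         (zero  , refl) = reach-refl πⱼ
    reach-suc {x} {y} (suc k , p)    = reach-trans πⱼ (suc-step x) (reach-suc (k , p))

  extend : Subset n → Subset (suc n)
  extend c = does (c ≟ₛ cycle π j) Vec.∷ c

  cycle-insert₀-suc : ∀ x → cycle πⱼ (Fin.suc x) ≡ extend (cycle π x)
  cycle-insert₀-suc x = cong₂ Vec._∷_
    (does-⇔ (mk⇔ (reach⇒cycle≡ π ∘ reach-skip) (λ q → reach-trans πⱼ (reach-suc (cycle≡⇒reach π q)) reach-0))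
      (reach? πⱼ (Fin.suc x) 0F) (cycle π x ≟ₛ cycle π j))
    (Vec.tabulate-cong λ y → does-⇔ (mk⇔ reach-skip reach-suc) (reach? πⱼ (Fin.suc x) (Fin.suc y)) (reach? π x y))

  cycles-insert₀-suc : cycles πⱼ ↭ map extend (cycles π)
  cycles-insert₀-suc = ∼bag⇒↭ (unique∧set⇒bag (cycles-unique πⱼ)
    (Unique.map⁺ Vec.∷-injectiveʳ (cycles-unique π)) (mk⇔ to from))
    where
    to : ∀ {c} → c ∈ cycles πⱼ → c ∈ map extend (cycles π)
    to p with ∈-cycles⁻ πⱼ p
    ... | 0F        , refl = subst (_∈ map extend (cycles π)) (≡.trans (≡.sym (cycle-insert₀-suc j)) (reach⇒cycle≡ πⱼ reach-0)) (∈-map⁺ extend (∈-cycles⁺ π j))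
    ... | Fin.suc x , refl = subst (_∈ map extend (cycles π)) (≡.sym (cycle-insert₀-suc x)) (∈-map⁺ extend (∈-cycles⁺ π x))
    from : ∀ {c} → c ∈ map extend (cycles π) → c ∈ cycles πⱼ
    from p with _ , q , refl ← ∈-map⁻ extend p with x , refl ← ∈-cycles⁻ π q =
      subst (_∈ cycles πⱼ) (cycle-insert₀-suc x) (∈-cycles⁺ πⱼ (Fin.suc x))

open SemiringFold ℕ.+-*-commutativeSemiring using () renaming (∑ to ∑ℕ; ∑-cong to ∑ℕ-cong; ∑-+ to ∑ℕ-+; ∑-map to ∑ℕ-map; ∑-↭ to ∑ℕ-↭; ∑-0 to ∑ℕ-0; ∑ₚ to ∑ℕₚ)

-- Excedances and cyclic valleys under insertion

bit : Bool → ℕ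
bit true  = 1
bit false = 0

length-filter : ∀ {a p} {A : Set a} {P : A → Set p} (P? : Decidable P) xs → length (filter P? xs) ≡ ∑ℕ xs (bit ∘ does ∘ P?)
length-filter P? []       = refl
length-filter P? (x ∷ xs) with does (P? x)
... | true  = cong suc (length-filter P? xs)
... | false = length-filter P? xs

module _ {c ℓ} (M : CommutativeMonoid c ℓ) where
  open CommutativeMonoid M renaming (refl to ≈-refl; trans to ≈-trans; sym to ≈-sym)
  open ListFold M

  ⨁-allFin : ∀ {n} (f : Fin (suc n) → Carrier) → ⨁ (allFin (suc n)) f ≈ f 0F ∙ ⨁ (allFin n) (f ∘ Fin.suc)
  ⨁-allFin {n} f = ∙-congˡ (≈-trans (reflexive (cong (λ xs → ⨁ xs f) (≡.sym (List.map-tabulate (λ i → i) Fin.suc))))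
    (⨁-map Fin.suc (allFin n) f))

  ⨁-cartesianProductWith : ∀ {a b d} {A : Set a} {B : Set b} {D : Set d} (h : A → B → D) xs ys f →
    ⨁ (cartesianProductWith h xs ys) f ≈ ⨁ xs (λ x → ⨁ ys (λ y → f (h x y)))
  ⨁-cartesianProductWith h []       ys f = ≈-refl
  ⨁-cartesianProductWith h (x ∷ xs) ys f = ≈-trans (⨁-++ (map (h x) ys) _ f)
    (∙-cong (⨁-map (h x) ys f) (⨁-cartesianProductWith h xs ys f))

  -- If h differs from st only at c, where it is u, then the position of c
  -- singles out the summand equal to f (map h xs).
  ⨁ₚ-update : ∀ {a b} {A : Set a} {B : Set b} (_≟_ : DecidableEquality A)
    (f : List B → Carrier) → (∀ {ks ls} → ks ↭ ls → f ks ≈ f ls) →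
    (st u h : A → B) (c : A) {xs : List A} → Unique xs → c ∈ xs →
    (∀ {x} → x ∈ xs → h x ≡ (if does (x ≟ c) then u x else st x)) →
    f (map h xs) ≈ ⨁ₚ xs (λ y ys → if does (y ≟ c) then f (u y ∷ map st ys) else ε)
  ⨁ₚ-update _≟_ f f-↭ st u h c {x ∷ xs} (x∉xs ∷ uniq) c∈ h≡ = by-cases (x ≟ c)
    where
    F : _ → _ → Carrier
    F y ys = if does (y ≟ c) then f (u y ∷ map st ys) else ε
    on : ∀ {y ys} → y ≡ c → F y ys ≈ f (u y ∷ map st ys)
    on {y} p rewrite dec-true (y ≟ c) p = ≈-refl
    off : ∀ {y ys} → y ≢ c → F y ys ≈ ε
    off {y} p rewrite dec-false (y ≟ c) p = ≈-refl
    h-on : ∀ {y} → y ∈ x ∷ xs → y ≡ c → h y ≡ u y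
    h-on {y} y∈ p = ≡.trans (h≡ y∈) (cong (λ b → if b then u y else st y) (dec-true (y ≟ c) p))
    h-off : ∀ {y} → y ∈ x ∷ xs → y ≢ c → h y ≡ st y
    h-off {y} y∈ p = ≡.trans (h≡ y∈) (cong (λ b → if b then u y else st y) (dec-false (y ≟ c) p))
    by-cases : Dec (x ≡ c) → f (map h (x ∷ xs)) ≈ ⨁ₚ (x ∷ xs) F
    by-cases (yes refl) = begin
      f (h x ∷ map h xs)
        ≈⟨ reflexive (cong f (cong₂ _∷_ (h-on (here refl) refl) (List.map-cong-local
             (All.tabulate λ y∈ → h-off (there y∈) (λ { refl → All.lookup x∉xs y∈ refl }))))) ⟩
      f (u x ∷ map st xs)
        ≈⟨ identityʳ _ ⟨
      f (u x ∷ map st xs) ∙ ε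
        ≈⟨ ∙-cong (on refl) (≈-trans (⨁ₚ-cong-↭ xs λ y ys p → off (λ { refl → All.lookup x∉xs (∈-resp-↭ (↭-sym p) (here refl)) refl })) (⨁ₚ-ε xs)) ⟨
      ⨁ₚ (x ∷ xs) F ∎
      where open ≈-Reasoning setoid
    by-cases (no x≢c) = begin
      f (h x ∷ map h xs)
        ≈⟨ reflexive (cong (λ z → f (z ∷ map h xs)) (h-off (here refl) x≢c)) ⟩
      f (st x ∷ map h xs)
        ≈⟨ ⨁ₚ-update _≟_ (f ∘ (st x ∷_)) (λ p → f-↭ (prep _ p)) st u h c uniq (tail c∈) (h≡ ∘ there) ⟩
      ⨁ₚ xs (λ y ys → if does (y ≟ c) then f (st x ∷ u y ∷ map st ys) else ε)
        ≈⟨ ⨁ₚ-cong xs (λ y ys → if-cong (does (y ≟ c)) (f-↭ (swap _ _ ↭-refl))) ⟩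
      ⨁ₚ xs (λ y ys → F y (x ∷ ys))
        ≈⟨ identityˡ _ ⟨
      ε ∙ ⨁ₚ xs (λ y ys → F y (x ∷ ys))
        ≈⟨ ∙-congʳ (off x≢c) ⟨
      ⨁ₚ (x ∷ xs) F ∎
      where
      open ≈-Reasoning setoid
      tail : c ∈ x ∷ xs → c ∈ xs
      tail (here c≡x) = contradiction (≡.sym c≡x) x≢c
      tail (there p)  = p
      if-cong : ∀ b {y z} → y ≈ z → (if b then y else ε) ≈ (if b then z else ε)
      if-cong true  p = p
      if-cong false p = ≈-refl

remove : ∀ {n} → (Fin n → Bool) → Fin n → Fin n → Bool
remove f j i = if does (i Fin.≟ j) then false else f i

∑-remove : ∀ {n} (f : Fin n → Bool) j → ∑ℕ (allFin n) (bit ∘ f) ≡ bit (f j) ℕ.+ ∑ℕ (allFin n) (bit ∘ remove f j)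
∑-remove {suc n} f 0F = ≡.trans (⨁-allFin ℕ.+-0-commutativeMonoid (bit ∘ f))
  (cong (bit (f 0F) ℕ.+_) (≡.sym (⨁-allFin ℕ.+-0-commutativeMonoid (bit ∘ remove f 0F))))
∑-remove {suc n} f (Fin.suc j) = begin
  ∑ℕ (allFin (suc n)) (bit ∘ f)
    ≡⟨ ⨁-allFin ℕ.+-0-commutativeMonoid (bit ∘ f) ⟩
  bit (f 0F) ℕ.+ ∑ℕ (allFin n) (bit ∘ f ∘ Fin.suc)
    ≡⟨ cong (bit (f 0F) ℕ.+_) (∑-remove (f ∘ Fin.suc) j) ⟩
  bit (f 0F) ℕ.+ (bit (f (Fin.suc j)) ℕ.+ ∑ℕ (allFin n) (bit ∘ remove (f ∘ Fin.suc) j))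
    ≡⟨ x∙yz≈y∙xz (bit (f 0F)) (bit (f (Fin.suc j))) _ ⟩
  bit (f (Fin.suc j)) ℕ.+ (bit (f 0F) ℕ.+ ∑ℕ (allFin n) (bit ∘ remove (f ∘ Fin.suc) j))
    ≡⟨ cong (bit (f (Fin.suc j)) ℕ.+_) (⨁-allFin ℕ.+-0-commutativeMonoid (bit ∘ remove f (Fin.suc j))) ⟨
  bit (f (Fin.suc j)) ℕ.+ ∑ℕ (allFin (suc n)) (bit ∘ remove f (Fin.suc j)) ∎
  where
  open ≡-Reasoning
  open CommutativeSemigroupProperties ℕ.+-commutativeSemigroup using (x∙yz≈y∙xz)

∑-permute : ∀ {n} (π : Permutation′ n) (g : Fin n → ℕ) → ∑ℕ (allFin n) (g ∘ (π ⟨$⟩ʳ_)) ≡ ∑ℕ (allFin n) g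
∑-permute {n} π g = ≡.trans (≡.sym (∑ℕ-map (π ⟨$⟩ʳ_) (allFin n) g)) (∑ℕ-↭ g (∼bag⇒↭ (unique∧set⇒bag
  (Unique.map⁺ (λ {x} {y} p → ≡.trans (≡.sym (inverseˡ π)) (≡.trans (cong (π ⟨$⟩ˡ_) p) (inverseˡ π))) (Unique.allFin⁺ n))
  (Unique.allFin⁺ n)
  (mk⇔ (λ _ → ∈-allFin _) (λ _ → ∈-permuted _)))))
  where
  ∈-permuted : ∀ i → i ∈ map (π ⟨$⟩ʳ_) (allFin n)
  ∈-permuted i = subst (_∈ map (π ⟨$⟩ʳ_) (allFin n)) (inverseʳ π) (∈-map⁺ (π ⟨$⟩ʳ_) (∈-allFin (π ⟨$⟩ˡ i)))

within : ∀ {n} → Subset n → (Fin n → Bool) → ℕ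
within {n} c f = ∑ℕ (allFin n) (λ i → bit (lookup c i ∧ f i))

within-cong : ∀ {n} (c : Subset n) {f g} → (∀ i → f i ≡ g i) → within c f ≡ within c g
within-cong {n} c p = ∑ℕ-cong (allFin n) λ i → cong (λ b → bit (lookup c i ∧ b)) (p i)

within-∷ : ∀ {n} b (c : Subset n) f → within (b Vec.∷ c) f ≡ bit (b ∧ f 0F) ℕ.+ within c (f ∘ Fin.suc)
within-∷ b c f = ⨁-allFin ℕ.+-0-commutativeMonoid (λ i → bit (lookup (b Vec.∷ c) i ∧ f i))

within-remove : ∀ {n} (c : Subset n) f j → within c f ≡ bit (lookup c j ∧ f j) ℕ.+ within c (remove f j)
within-remove {n} c f j = ≡.trans (∑-remove (λ i → lookup c i ∧ f i) j)
  (cong (bit (lookup c j ∧ f j) ℕ.+_) (∑ℕ-cong (allFin n) λ i → cong bit (push (does (i Fin.≟ j)) (lookup c i) (f i))))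
  where
  push : ∀ d x y → (if d then false else x ∧ y) ≡ x ∧ (if d then false else y)
  push true  x y = ≡.sym (Bool.∧-zeroʳ x)
  push false x y = refl

within-remove-∉ : ∀ {n} (c : Subset n) f j → lookup c j ≡ false → within c (remove f j) ≡ within c f
within-remove-∉ c f j p = ≡.sym (≡.trans (within-remove c f j) (cong (λ b → bit (b ∧ f j) ℕ.+ within c (remove f j)) p))

within-split : ∀ {n} (c : Subset n) (f g : Fin n → Bool) → within c f ≡ within c (λ i → f i ∧ g i) ℕ.+ within c (λ i → f i ∧ not (g i))
within-split {n} c f g = ≡.trans (∑ℕ-cong (allFin n) λ i → split (lookup c i) (f i) (g i)) (∑ℕ-+ (allFin n) _ _)
  where
  split : ∀ x y z → bit (x ∧ y) ≡ bit (x ∧ (y ∧ z)) ℕ.+ bit (x ∧ (y ∧ not z))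
  split false y     z     = refl
  split true  false z     = refl
  split true  true  true  = refl
  split true  true  false = refl

∣∣≡within : ∀ {n} (c : Subset n) → ∣ c ∣ ≡ within c (λ _ → true)
∣∣≡within Vec.[]            = refl
∣∣≡within (true  Vec.∷ c) = ≡.trans (cong suc (∣∣≡within c)) (≡.sym (within-∷ true c (λ _ → true)))
∣∣≡within (false Vec.∷ c) = ≡.trans (∣∣≡within c) (≡.sym (within-∷ false c (λ _ → true)))

module _ {n} (π : Permutation′ n) where

  ascent valley : Fin n → Bool
  ascent i = does (i Fin.<? π ⟨$⟩ʳ i)
  valley i = does (i Fin.<? π ⟨$⟩ˡ i) ∧ ascent i

  -- Whether insertion into the arc leaving `i` destroys a valley. Both ends are never valleys,
  -- since this would order them both ways.
  arcAtValley : Fin n → Bool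
  arcAtValley i = valley i ∨ valley (π ⟨$⟩ʳ i)

  cycleState : Subset n → CycleState
  cycleState c = pred ∣ c ∣ , within c ascent , within c valley

  states : List CycleState
  states = map cycleState (cycles π)

  ascent⇒¬valley : ∀ i → ascent i ≡ true → valley (π ⟨$⟩ʳ i) ≡ false
  ascent⇒¬valley i p = cong (_∧ ascent (π ⟨$⟩ʳ i)) (dec-false (π ⟨$⟩ʳ i Fin.<? π ⟨$⟩ˡ (π ⟨$⟩ʳ i))
    λ q → ℕ.<-asym (does-true (i Fin.<? π ⟨$⟩ʳ i) p) (subst (λ k → (π ⟨$⟩ʳ i) Fin.< k) (inverseˡ π) q))
    where
    does-true : ∀ {A : Set} (a? : Dec A) → does a? ≡ true → A
    does-true (yes a) _ = a

  ascent∧arcAtValley : ∀ i → ascent i ∧ arcAtValley i ≡ valley i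
  ascent∧arcAtValley i = go (does (i Fin.<? π ⟨$⟩ˡ i)) (ascent i) _ (ascent⇒¬valley i)
    where
    go : ∀ x a b → (a ≡ true → b ≡ false) → a ∧ ((x ∧ a) ∨ b) ≡ x ∧ a
    go x false b _ = ≡.sym (Bool.∧-zeroʳ x)
    go x true  b h rewrite h refl = Bool.∨-identityʳ (x ∧ true)

  ¬ascent∧arcAtValley : ∀ i → not (ascent i) ∧ arcAtValley i ≡ valley (π ⟨$⟩ʳ i)
  ¬ascent∧arcAtValley i = go (does (i Fin.<? π ⟨$⟩ˡ i)) (ascent i) _ (ascent⇒¬valley i)
    where
    go : ∀ x a b → (a ≡ true → b ≡ false) → not a ∧ ((x ∧ a) ∨ b) ≡ b
    go x false b _ = cong (_∨ b) (Bool.∧-zeroʳ x)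
    go x true  b h = ≡.sym (h refl)

  -- The number of valleys lost by insertion; `remove` prevents a double count when `j` is fixed.
  arcAtValley-bit : ∀ j → bit (valley j) ℕ.+ bit (remove valley j (π ⟨$⟩ʳ j)) ≡ bit (arcAtValley j)
  arcAtValley-bit j with π ⟨$⟩ʳ j Fin.≟ j
  ... | yes p = ≡.trans (ℕ.+-identityʳ _) (cong bit (≡.sym (≡.trans (cong (λ i → valley j ∨ valley i) p) (Bool.∨-idem (valley j)))))
  ... | no  _ = go (does (j Fin.<? π ⟨$⟩ˡ j)) (ascent j) _ (ascent⇒¬valley j)
    where
    go : ∀ x a b → (a ≡ true → b ≡ false) → bit (x ∧ a) ℕ.+ bit b ≡ bit ((x ∧ a) ∨ b)
    go x     false b _ rewrite Bool.∧-zeroʳ x = refl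
    go false true  b h = refl
    go true  true  b h rewrite h refl = refl

  module _ (x : Fin n) where

    private
      c = cycle π x

    cycle-closed : ∀ i → lookup c i ≡ lookup c (π ⟨$⟩ʳ i)
    cycle-closed i = ≡.trans (lookup-cycle π x i) (≡.trans
      (does-⇔ (mk⇔ (λ p → reach-trans π p (reach-step π)) (λ p → reach-trans π p (reach-back π i)))
        (reach? π x i) (reach? π x (π ⟨$⟩ʳ i)))
      (≡.sym (lookup-cycle π x (π ⟨$⟩ʳ i))))

    cycle-self : lookup c x ≡ true
    cycle-self = reach⇒lookup-cycle π (reach-refl π)

    ∣cycle∣>0 : suc (pred ∣ c ∣) ≡ ∣ c ∣
    ∣cycle∣>0 = ≡.trans (cong (suc ∘ pred) eq) (≡.sym eq)
      where
      eq : ∣ c ∣ ≡ suc (within c (remove (λ _ → true) x))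
      eq = ≡.trans (∣∣≡within c) (≡.trans (within-remove c _ x) (cong (λ b → bit (b ∧ true) ℕ.+ within c (remove (λ _ → true) x)) cycle-self))

    arcs-ascent-valley : within c (λ i → ascent i ∧ arcAtValley i) ≡ within c valley
    arcs-ascent-valley = within-cong c ascent∧arcAtValley

    arcs-ascent-rest : within c (λ i → ascent i ∧ not (arcAtValley i)) ≡ within c ascent ∸ within c valley
    arcs-ascent-rest = ≡.sym (≡.trans
      (cong₂ _∸_ (within-split c ascent arcAtValley) (≡.sym arcs-ascent-valley))
      (ℕ.m+n∸m≡n (within c (λ i → ascent i ∧ arcAtValley i)) _))

    -- A descending arc can have a valley only at its head, and reindexing along `π`, which
    -- preserves the cycle, counts each valley once.
    arcs-descent-valley : within c (λ i → not (ascent i) ∧ arcAtValley i) ≡ within c valley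
    arcs-descent-valley = ≡.trans (∑ℕ-cong (allFin n) λ i → cong bit (cong₂ _∧_ (cycle-closed i) (¬ascent∧arcAtValley i)))
      (∑-permute π (λ i → bit (lookup c i ∧ valley i)))

    arcs-descent-rest : within c (λ i → not (ascent i) ∧ not (arcAtValley i)) ≡ suc (pred ∣ c ∣) ∸ within c ascent ∸ within c valley
    arcs-descent-rest = ≡.sym (begin
      suc (pred ∣ c ∣) ∸ within c ascent ∸ within c valley
        ≡⟨ cong₂ (λ k l → k ∸ within c ascent ∸ l) (≡.trans ∣cycle∣>0 (≡.trans (∣∣≡within c) (within-split c (λ _ → true) ascent))) (≡.sym arcs-descent-valley) ⟩
      (within c ascent ℕ.+ within c (λ i → not (ascent i))) ∸ within c ascent ∸ N
        ≡⟨ cong (_∸ N) (ℕ.m+n∸m≡n (within c ascent) _) ⟩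
      within c (λ i → not (ascent i)) ∸ N
        ≡⟨ cong (_∸ N) (within-split c (λ i → not (ascent i)) arcAtValley) ⟩
      (N ℕ.+ within c (λ i → not (ascent i) ∧ not (arcAtValley i))) ∸ N
        ≡⟨ ℕ.m+n∸m≡n N _ ⟩
      within c (λ i → not (ascent i) ∧ not (arcAtValley i)) ∎)
      where
      open ≡-Reasoning
      N = within c (λ i → not (ascent i) ∧ arcAtValley i)

-- The flags say that the arc ascends and that it touches a valley. The new excedance and the new
-- valley then only replace those lost.
insertState : Bool → Bool → CycleState → CycleState
insertState a b (m , e , v) = suc m , (if a then e else suc e) , (if b then v else suc v)

module _ {n} (π : Permutation′ n) where

  private
    π₀ = insert₀ 0F π

  states-insert₀-0 : states π₀ ↭ (0 , 0 , 0) ∷ states π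
  states-insert₀-0 = ↭-trans (↭-map⁺ (cycleState π₀) (cycles-insert₀-0 π)) (↭-reflexive (cong₂ _∷_ new
    (≡.trans (≡.sym (List.map-∘ (cycles π))) (List.map-cong old (cycles π)))))
    where
    within-⊥ : ∀ f → within ⊥ f ≡ 0
    within-⊥ f = ≡.trans (∑ℕ-cong (allFin n) λ i → cong (λ b → bit (b ∧ f i)) (Vec.lookup-replicate i false)) (∑ℕ-0 (allFin n))
    new : cycleState π₀ (true Vec.∷ ⊥) ≡ (0 , 0 , 0)
    new = cong₂ _,_ (≡.trans (∣∣≡within (⊥ {n})) (within-⊥ (λ _ → true)))
      (cong₂ _,_ (≡.trans (within-∷ true ⊥ (ascent π₀)) (within-⊥ (ascent π₀ ∘ Fin.suc)))
        (≡.trans (within-∷ true ⊥ (valley π₀)) (within-⊥ (valley π₀ ∘ Fin.suc))))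
    old : ∀ c → cycleState π₀ (false Vec.∷ c) ≡ cycleState π c
    old c = cong₂ _,_ refl (cong₂ _,_ (within-∷ false c (ascent π₀)) (within-∷ false c (valley π₀)))

  module _ (j : Fin n) where

    private
      πⱼ = insert₀ (Fin.suc j) π

    ascent-insert₀ : ∀ i → ascent πⱼ (Fin.suc i) ≡ remove (ascent π) j i
    ascent-insert₀ i = by-cases (i Fin.≟ j)
      where
      by-cases : Dec (i ≡ j) → ascent πⱼ (Fin.suc i) ≡ remove (ascent π) j i
      by-cases (yes refl) rewrite insert₀-ʳ-≡ π j | dec-true (j Fin.≟ j) refl = refl
      by-cases (no i≢j)   rewrite insert₀-ʳ-≢ π j i≢j | dec-false (i Fin.≟ j) i≢j = refl

    -- The letter `j` now has image `0F` and `π j` has preimage `0F`, so neither is a valley; all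
    -- other old letters keep both neighbours.
    valley-insert₀ : ∀ i → valley πⱼ (Fin.suc i) ≡ remove (remove (valley π) j) (π ⟨$⟩ʳ j) i
    valley-insert₀ i = by-cases (i Fin.≟ π ⟨$⟩ʳ j)
      where
      by-cases : Dec (i ≡ π ⟨$⟩ʳ j) → valley πⱼ (Fin.suc i) ≡ remove (remove (valley π) j) (π ⟨$⟩ʳ j) i
      by-cases (yes p) rewrite dec-true (i Fin.≟ π ⟨$⟩ʳ j) p
        | insert₀-ˡ-≡ π j {i} (≡.trans (cong (π ⟨$⟩ˡ_) p) (inverseˡ π)) = refl
      by-cases (no ¬p) rewrite dec-false (i Fin.≟ π ⟨$⟩ʳ j) ¬p
        | insert₀-ˡ-≢ π j {i} (λ q → ¬p (≡.trans (≡.sym (inverseʳ π)) (cong (π ⟨$⟩ʳ_) q)))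
        | ascent-insert₀ i = push (does (i Fin.≟ j)) _ _
        where
        push : ∀ d x y → x ∧ (if d then false else y) ≡ (if d then false else x ∧ y)
        push true  x y = Bool.∧-zeroʳ x
        push false x y = refl

    cycleState-insert₀ : ∀ {c} → c ∈ cycles π → cycleState πⱼ (extend π j c) ≡
      (if does (c ≟ₛ cycle π j) then insertState (ascent π j) (arcAtValley π j) (cycleState π c) else cycleState π c)
    cycleState-insert₀ {c} c∈ = by-cases (c ≟ₛ cycle π j)
      where
      open ≡-Reasoning
      goal : Bool → Set
      goal b = cycleState πⱼ (b Vec.∷ c) ≡
        (if b then insertState (ascent π j) (arcAtValley π j) (cycleState π c) else cycleState π c)
      by-cases : (d : Dec (c ≡ cycle π j)) → goal (does d)
      by-cases (yes refl) = cong₂ _,_ (≡.sym (∣cycle∣>0 π j)) (cong₂ _,_ e-eq v-eq)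
        where
        k = π ⟨$⟩ʳ j
        j∈c = cycle-self π j
        k∈c = ≡.trans (≡.sym (cycle-closed π j j)) j∈c
        choose : ∀ b {x y} → x ≡ bit b ℕ.+ y → suc y ≡ (if b then x else suc x)
        choose true  p = ≡.sym p
        choose false p = cong suc (≡.sym p)
        e-eq : within (true Vec.∷ c) (ascent πⱼ) ≡ (if ascent π j then within c (ascent π) else suc (within c (ascent π)))
        e-eq = begin
          within (true Vec.∷ c) (ascent πⱼ)               ≡⟨ within-∷ true c (ascent πⱼ) ⟩
          suc (within c (ascent πⱼ ∘ Fin.suc))            ≡⟨ cong suc (within-cong c ascent-insert₀) ⟩
          suc (within c (remove (ascent π) j))            ≡⟨ choose (ascent π j) (≡.trans (within-remove c (ascent π) j)
                                                              (cong (λ b → bit (b ∧ ascent π j) ℕ.+ within c (remove (ascent π) j)) j∈c)) ⟩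
          (if ascent π j then within c (ascent π) else suc (within c (ascent π))) ∎
        v-eq : within (true Vec.∷ c) (valley πⱼ) ≡ (if arcAtValley π j then within c (valley π) else suc (within c (valley π)))
        v-eq = begin
          within (true Vec.∷ c) (valley πⱼ)                        ≡⟨ within-∷ true c (valley πⱼ) ⟩
          suc (within c (valley πⱼ ∘ Fin.suc))                     ≡⟨ cong suc (within-cong c valley-insert₀) ⟩
          suc (within c (remove (remove (valley π) j) k))          ≡⟨ choose (arcAtValley π j) (begin
            within c (valley π)
              ≡⟨ within-remove c (valley π) j ⟩
            bit (lookup c j ∧ valley π j) ℕ.+ within c (remove (valley π) j)
              ≡⟨ cong (bit (lookup c j ∧ valley π j) ℕ.+_) (within-remove c (remove (valley π) j) k) ⟩
            bit (lookup c j ∧ valley π j) ℕ.+ (bit (lookup c k ∧ remove (valley π) j k) ℕ.+ W)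
              ≡⟨ cong₂ (λ x y → bit (x ∧ valley π j) ℕ.+ (bit (y ∧ remove (valley π) j k) ℕ.+ W)) j∈c k∈c ⟩
            bit (valley π j) ℕ.+ (bit (remove (valley π) j k) ℕ.+ W)
              ≡⟨ ℕ.+-assoc (bit (valley π j)) _ _ ⟨
            bit (valley π j) ℕ.+ bit (remove (valley π) j k) ℕ.+ W
              ≡⟨ cong (ℕ._+ W) (arcAtValley-bit π j) ⟩
            bit (arcAtValley π j) ℕ.+ W ∎) ⟩
          (if arcAtValley π j then within c (valley π) else suc (within c (valley π))) ∎
          where
          W = within c (remove (remove (valley π) j) k)
      by-cases (no c≢) with x , refl ← ∈-cycles⁻ π c∈ = cong₂ _,_ refl (cong₂ _,_
        (begin
          within (false Vec.∷ c) (ascent πⱼ)     ≡⟨ within-∷ false c (ascent πⱼ) ⟩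
          within c (ascent πⱼ ∘ Fin.suc)         ≡⟨ within-cong c ascent-insert₀ ⟩
          within c (remove (ascent π) j)         ≡⟨ within-remove-∉ c (ascent π) j j∉c ⟩
          within c (ascent π)                    ∎)
        (begin
          within (false Vec.∷ c) (valley πⱼ)                      ≡⟨ within-∷ false c (valley πⱼ) ⟩
          within c (valley πⱼ ∘ Fin.suc)                          ≡⟨ within-cong c valley-insert₀ ⟩
          within c (remove (remove (valley π) j) (π ⟨$⟩ʳ j))      ≡⟨ within-remove-∉ c (remove (valley π) j) (π ⟨$⟩ʳ j) (≡.trans (≡.sym (cycle-closed π x j)) j∉c) ⟩
          within c (remove (valley π) j)                          ≡⟨ within-remove-∉ c (valley π) j j∉c ⟩
          within c (valley π)                                     ∎))
        where
        j∉c : lookup c j ≡ false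
        j∉c = ≡.trans (lookup-cycle≡does π x j) (dec-false (c ≟ₛ cycle π j) c≢)

-- Multiplicities, and matchings of equal entries

open ListFold ℕ.*-1-commutativeMonoid using () renaming (⨁ to ∏ℕ; ⨁-∙ to ∏ℕ-*; ⨁-ε to ∏ℕ-1; ⨁-cong to ∏ℕ-cong)

multiplicity : List ℕ → ℕ → ℕ
multiplicity ds k = ∑ℕ ds (λ d → bit (does (k ℕ.≟ d)))

module _ {c ℓ} (M : CommutativeMonoid c ℓ) where
  open CommutativeMonoid M renaming (refl to ≈-refl; trans to ≈-trans; sym to ≈-sym)
  open ListFold M
  open CommutativeMonoidMult M using (×-homo-+) renaming (_×_ to _·_)

  ⨁-single : ∀ {a} {A : Set a} (_≟_ : DecidableEquality A) (f : A → Carrier) (c : A) {xs : List A} → Unique xs → c ∈ xs →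
             ⨁ xs (λ x → if does (x ≟ c) then f x else ε) ≈ f c
  ⨁-single _≟_ f c {x ∷ xs} (x∉xs ∷ uniq) c∈ = by-cases (x ≟ c) c∈
    where
    F : _ → Carrier
    F x = if does (x ≟ c) then f x else ε
    off : ∀ {y} → y ≢ c → F y ≈ ε
    off {y} p rewrite dec-false (y ≟ c) p = ≈-refl
    on : ∀ {y} → y ≡ c → F y ≈ f c
    on {y} refl rewrite dec-true (y ≟ y) refl = ≈-refl
    by-cases : Dec (x ≡ c) → c ∈ x ∷ xs → ⨁ (x ∷ xs) F ≈ f c
    by-cases (yes refl) _ = ≈-trans (∙-cong (on refl) (≈-trans
      (⨁-cong-All (All.map (λ x≢y → off (x≢y ∘ ≡.sym)) x∉xs)) (⨁-ε xs))) (identityʳ _)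
    by-cases (no x≢c) (here c≡x) = contradiction (≡.sym c≡x) x≢c
    by-cases (no x≢c) (there p)  = ≈-trans (∙-cong (off x≢c) (⨁-single _≟_ f c uniq p)) (identityˡ _)

  ⨁-indicator : ∀ {a} {A : Set a} (b : A → Bool) (y : Carrier) xs → ⨁ xs (λ x → if b x then y else ε) ≈ ∑ℕ xs (bit ∘ b) · y
  ⨁-indicator b y []       = ≈-refl
  ⨁-indicator b y (x ∷ xs) = ≈-trans (∙-cong (single (b x)) (⨁-indicator b y xs)) (≈-sym (×-homo-+ y (bit (b x)) (∑ℕ xs (bit ∘ b))))
    where
    single : ∀ b → (if b then y else ε) ≈ bit b · y
    single true  = ≈-sym (identityʳ y)
    single false = ≈-refl

  -- Turns products over the parts into the products over part sizes that the theorem and `z` use.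
  ⨁-by-multiplicity : ∀ n (f : ℕ → Carrier) {ds} → All (_< n) ds → ⨁ ds f ≈ ⨁ (upTo n) (λ k → multiplicity ds k · f k)
  ⨁-by-multiplicity n f {ds} ds<n = begin
    ⨁ ds f
      ≈⟨ ⨁-cong-All (All.map (λ d<n → ≈-sym (⨁-single ℕ._≟_ f _ (Unique.upTo⁺ n) (∈-upTo⁺ d<n))) ds<n) ⟩
    ⨁ ds (λ d → ⨁ (upTo n) (λ k → if does (k ℕ.≟ d) then f k else ε))
      ≈⟨ ⨁-swap ds (upTo n) _ ⟩
    ⨁ (upTo n) (λ k → ⨁ ds (λ d → if does (k ℕ.≟ d) then f k else ε))
      ≈⟨ ⨁-cong (upTo n) (λ k → ⨁-indicator (λ d → does (k ℕ.≟ d)) (f k) ds) ⟩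
    ⨁ (upTo n) (λ k → multiplicity ds k · f k) ∎
    where open ≈-Reasoning setoid

module Matching where
  open Permanent ℕ.+-*-commutativeSemiring ℕ
  open SemiringFold ℕ.+-*-commutativeSemiring using (∑ₚ-cong-↭; ∑ₚ-*ʳ; ∑ₚ-forget; ∑ₚ; ∑ₚ-0)
  open ≡-Reasoning

  is : ℕ → ℕ → ℕ
  is d m = bit (does (d ℕ.≟ m))

  matchings : List ℕ → List ℕ → ℕ
  matchings ms ds = M ms (map is ds)

  automorphisms : List ℕ → ℕ
  automorphisms []       = 1
  automorphisms (d ∷ ds) = ∑ℕ (d ∷ ds) (is d) ℕ.* automorphisms ds

  private
    on-diagonal : ∀ d m {x y} → (d ≡ m → x ≡ y) → is d m ℕ.* x ≡ is d m ℕ.* y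
    on-diagonal d m {x} {y} h = go (d ℕ.≟ m)
      where
      go : (p : Dec (d ≡ m)) → bit (does p) ℕ.* x ≡ bit (does p) ℕ.* y
      go (yes p) = cong (1 ℕ.*_) (h p)
      go (no _)  = refl

  -- Together with `matchings-¬↭`, this makes the permanent of an equality matrix detect the cycle
  -- type, up to a constant factor.
  matchings-↭ : ∀ {ms} ds → ms ↭ ds → matchings ms ds ≡ automorphisms ds
  matchings-↭ {[]}     []       p = refl
  matchings-↭ {m ∷ ms} []       p with () ← ∈-resp-↭ p (here refl)
  matchings-↭ {ms}     (d ∷ ds) p = begin
    M ms (is d ∷ map is ds)                             ≡⟨ M-column ms (is d) (map is ds) ⟩
    ∑ₚ ms (λ m ms′ → is d m ℕ.* matchings ms′ ds)       ≡⟨ ∑ₚ-cong-↭ ms (λ m ms′ q → on-diagonal d m λ { refl →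
                                                             matchings-↭ ds (drop-∷ (↭-trans (↭-sym q) p)) }) ⟩
    ∑ₚ ms (λ m ms′ → is d m ℕ.* automorphisms ds)       ≡⟨ ∑ₚ-*ʳ (automorphisms ds) ms (λ m _ → is d m) ⟩
    ∑ₚ ms (λ m _ → is d m) ℕ.* automorphisms ds         ≡⟨ cong (ℕ._* automorphisms ds) (≡.trans (∑ₚ-forget ms (is d)) (∑ℕ-↭ (is d) p)) ⟩
    ∑ℕ (d ∷ ds) (is d) ℕ.* automorphisms ds             ∎

  matchings-¬↭ : ∀ {ms} ds → ¬ (ms ↭ ds) → matchings ms ds ≡ 0
  matchings-¬↭ {[]}     []       ¬p = contradiction ↭-refl ¬p
  matchings-¬↭ {m ∷ ms} []       ¬p = refl
  matchings-¬↭ {ms}     (d ∷ ds) ¬p = begin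
    M ms (is d ∷ map is ds)                             ≡⟨ M-column ms (is d) (map is ds) ⟩
    ∑ₚ ms (λ m ms′ → is d m ℕ.* matchings ms′ ds)       ≡⟨ ∑ₚ-cong-↭ ms (λ m ms′ q → ≡.trans (on-diagonal d m {y = 0} λ { refl →
                                                             matchings-¬↭ ds (λ r → ¬p (↭-trans q (prep m r))) }) (ℕ.*-zeroʳ (is d m))) ⟩
    ∑ₚ ms (λ _ _ → 0)                                   ≡⟨ ∑ₚ-0 ms ⟩
    0                                                   ∎

  automorphisms-! : ∀ n {ds} → All (_< n) ds → automorphisms ds ≡ ∏ℕ (upTo n) (λ k → multiplicity ds k !)
  automorphisms-! n [] = ≡.sym (∏ℕ-1 (upTo n))
  automorphisms-! n {d ∷ ds} (d<n ∷ ds<n) = ≡.sym (begin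
    ∏ℕ (upTo n) (λ k → (is k d ℕ.+ ∑ℕ ds (is k)) !)
      ≡⟨ ∏ℕ-cong (upTo n) (λ k → step (does (k ℕ.≟ d)) (∑ℕ ds (is k))) ⟩
    ∏ℕ (upTo n) (λ k → (if does (k ℕ.≟ d) then suc (∑ℕ ds (is k)) else 1) ℕ.* (∑ℕ ds (is k)) !)
      ≡⟨ ∏ℕ-* (upTo n) _ _ ⟩
    ∏ℕ (upTo n) (λ k → if does (k ℕ.≟ d) then suc (∑ℕ ds (is k)) else 1) ℕ.* ∏ℕ (upTo n) (λ k → ∑ℕ ds (is k) !)
      ≡⟨ cong₂ ℕ._*_ (⨁-single ℕ.*-1-commutativeMonoid ℕ._≟_ (λ k → suc (∑ℕ ds (is k))) d (Unique.upTo⁺ n) (∈-upTo⁺ d<n)) (≡.sym (automorphisms-! n ds<n)) ⟩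
    suc (∑ℕ ds (is d)) ℕ.* automorphisms ds
      ≡⟨ cong (λ b → (bit b ℕ.+ ∑ℕ ds (is d)) ℕ.* automorphisms ds) (dec-true (d ℕ.≟ d) refl) ⟨
    automorphisms (d ∷ ds) ∎)
    where
    step : ∀ b x → (bit b ℕ.+ x) ! ≡ (if b then suc x else 1) ℕ.* x !
    step true  x = refl
    step false x = ≡.sym (ℕ.*-identityˡ (x !))

-- Statistics of a permutation as sums over its cycles

∑-within-cycles : ∀ {n} (π : Permutation′ n) f → ∑ℕ (cycles π) (λ c → within c f) ≡ ∑ℕ (allFin n) (bit ∘ f)
∑-within-cycles {n} π f = ≡.trans (⨁-swap (cycles π) (allFin n) (λ c i → bit (lookup c i ∧ f i))) (∑ℕ-cong (allFin n) once)
  where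
  open ListFold ℕ.+-0-commutativeMonoid using (⨁-swap; ⨁-cong-All)
  indicator : ∀ b y → bit (b ∧ y) ≡ (if b then bit y else 0)
  indicator true  y = refl
  indicator false y = refl
  once : ∀ i → ∑ℕ (cycles π) (λ c → bit (lookup c i ∧ f i)) ≡ bit (f i)
  once i = ≡.trans
    (⨁-cong-All {xs = cycles π} (All.tabulate λ {c} c∈ → ≡.trans (cong (λ b → bit (b ∧ f i)) (lookup-does c∈)) (indicator (does (c ≟ₛ cycle π i)) (f i))))
    (⨁-single ℕ.+-0-commutativeMonoid _≟ₛ_ (λ _ → bit (f i)) (cycle π i) (cycles-unique π) (∈-cycles⁺ π i))
    where
    lookup-does : ∀ {c} → c ∈ cycles π → lookup c i ≡ does (c ≟ₛ cycle π i)
    lookup-does c∈ with x , refl ← ∈-cycles⁻ π c∈ = lookup-cycle≡does π x i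

exc-ascents : ∀ {n} (π : Permutation′ n) → exc π ≡ ∑ℕ (allFin n) (bit ∘ ascent π)
exc-ascents {n} π = length-filter _ (allFin n)

exc-complement : ∀ {n} (π : Permutation′ n) → n ≡ exc π ℕ.+ ∑ℕ (allFin n) (bit ∘ not ∘ ascent π)
exc-complement {n} π = ≡.trans (≡.sym (≡.trans (count-all (allFin n)) (List.length-tabulate {n = n} (λ i → i))))
  (cong (ℕ._+ ∑ℕ (allFin n) (bit ∘ not ∘ ascent π)) (≡.sym (exc-ascents π)))
  where
  count-all : ∀ xs → ∑ℕ xs (bit ∘ ascent π) ℕ.+ ∑ℕ xs (bit ∘ not ∘ ascent π) ≡ List.length xs
  count-all xs = ≡.trans (≡.sym (∑ℕ-+ xs _ _)) (≡.trans (∑ℕ-cong xs (λ x → bit-not (ascent π x))) (ones xs))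
    where
    bit-not : ∀ b → bit b ℕ.+ bit (not b) ≡ 1
    bit-not true  = refl
    bit-not false = refl
    ones : ∀ (xs : List (Fin n)) → ∑ℕ xs (λ _ → 1) ≡ List.length xs
    ones []       = refl
    ones (x ∷ xs) = cong suc (ones xs)

exc-insert₀-0 : ∀ {n} (π : Permutation′ n) → exc (insert₀ 0F π) ≡ exc π
exc-insert₀-0 {n} π = ≡.trans (exc-ascents (insert₀ 0F π))
  (≡.trans (⨁-allFin ℕ.+-0-commutativeMonoid (bit ∘ ascent (insert₀ 0F π))) (≡.sym (exc-ascents π)))

exc-insert₀-suc : ∀ {n} (π : Permutation′ n) j → exc (insert₀ (Fin.suc j) π) ≡ (if ascent π j then exc π else suc (exc π))
exc-insert₀-suc {n} π j = ≡.trans (≡.trans (exc-ascents πⱼ) (≡.trans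
  (⨁-allFin ℕ.+-0-commutativeMonoid (bit ∘ ascent πⱼ))
  (cong suc (∑ℕ-cong (allFin n) λ i → cong bit (ascent-insert₀ π j i)))))
  (choose (ascent π j) (≡.trans (exc-ascents π) (∑-remove (ascent π) j)))
  where
  πⱼ = insert₀ (Fin.suc j) π
  choose : ∀ b {x y} → x ≡ bit b ℕ.+ y → suc y ≡ (if b then x else suc x)
  choose true  p = ≡.sym p
  choose false p = cong suc (≡.sym p)

-- Sums over all permutations, by insertion

module Enumeration {c ℓ} (R : CommutativeSemiring c ℓ) where
  open CommutativeSemiring R renaming (refl to ≈-refl; trans to ≈-trans; sym to ≈-sym)
  open SemiringFold R
  open Growth R
  open CyclePolynomial R
  open Exp semiring using (_^_; ^-homo-*)
  open CommutativeSemigroupProperties *-commutativeSemigroup using (interchange; x∙yz≈y∙xz)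
  open ≈-Reasoning setoid

  ∑-ι : ∀ {a} {A : Set a} (xs : List A) f → ∑ xs (ι ∘ f) ≈ ι (∑ℕ xs f)
  ∑-ι []       f = ≈-refl
  ∑-ι (x ∷ xs) f = ≈-trans (+-congˡ (∑-ι xs f)) (≈-sym (ι-+ (f x) (∑ℕ xs f)))

  ∑ₚ-ι : ∀ {a} {A : Set a} (xs : List A) F → ∑ₚ xs (λ y ys → ι (F y ys)) ≈ ι (∑ℕₚ xs F)
  ∑ₚ-ι []       F = ≈-refl
  ∑ₚ-ι (x ∷ xs) F = ≈-trans (+-congˡ (∑ₚ-ι xs _)) (≈-sym (ι-+ (F x xs) _))

  ∑-ι-* : ∀ {a} {A : Set a} (xs : List A) f x → ∑ xs (λ y → ι (f y) * x) ≈ ι (∑ℕ xs f) * x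
  ∑-ι-* xs f x = ≈-trans (∑-*ʳ x xs _) (*-congʳ (∑-ι xs f))

  ι-1-* : ∀ {x} → ι 1 * x ≈ x
  ι-1-* = ≈-trans (*-congʳ ι-1) (*-identityˡ _)

  private
    bit-* : ∀ b {x} → (if b then x else 0#) ≈ ι (bit b) * x
    bit-* true  = ≈-sym ι-1-*
    bit-* false = ≈-sym (zeroˡ _)

    drop : ∀ {x y} → y ≈ 0# → x ≈ x + y
    drop y≈0 = ≈-sym (≈-trans (+-congˡ y≈0) (+-identityʳ _))

    drop′ : ∀ {x y} → x ≈ 0# → y ≈ x + y
    drop′ x≈0 = ≈-sym (≈-trans (+-congʳ x≈0) (+-identityˡ _))

  -- Sorts the arcs of one cycle, marked by `m`, into the four classes of `grow`.
  ∑-by-arc : ∀ {a} {A : Set a} (xs : List A) (m p q : A → Bool) (F : Bool → Bool → Carrier) →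
    ∑ xs (λ x → if m x then F (p x) (q x) else 0#) ≈
      ι (∑ℕ xs (λ x → bit (m x ∧ (p x ∧ q x)))) * F true true
      + ι (∑ℕ xs (λ x → bit (m x ∧ (p x ∧ not (q x))))) * F true false
      + ι (∑ℕ xs (λ x → bit (m x ∧ (not (p x) ∧ q x)))) * F false true
      + ι (∑ℕ xs (λ x → bit (m x ∧ (not (p x) ∧ not (q x))))) * F false false
  ∑-by-arc xs m p q F = ≈-trans (∑-cong xs λ x → pointwise (m x) (p x) (q x))
    (≈-trans (∑-+ xs _ _) (+-cong (≈-trans (∑-+ xs _ _) (+-cong (≈-trans (∑-+ xs _ _)
      (+-cong (∑-ι-* xs _ _) (∑-ι-* xs _ _))) (∑-ι-* xs _ _))) (∑-ι-* xs _ _)))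
    where
    o : ∀ {x} → ι 0 * x ≈ 0#
    o = zeroˡ _
    pointwise : ∀ m p q → (if m then F p q else 0#) ≈
      ι (bit (m ∧ (p ∧ q))) * F true true + ι (bit (m ∧ (p ∧ not q))) * F true false
      + ι (bit (m ∧ (not p ∧ q))) * F false true + ι (bit (m ∧ (not p ∧ not q))) * F false false
    pointwise false p     q     = ≈-trans (≈-trans (≈-trans (≈-sym o) (drop o)) (drop o)) (drop o)
    pointwise true  true  true  = ≈-trans (≈-trans (≈-trans (≈-sym ι-1-*) (drop o)) (drop o)) (drop o)
    pointwise true  true  false = ≈-trans (≈-trans (≈-trans (≈-sym ι-1-*) (drop′ o)) (drop o)) (drop o)
    pointwise true  false true  = ≈-trans (≈-trans (≈-sym ι-1-*) (drop′ (≈-trans (≈-sym (drop o)) o))) (drop o)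
    pointwise true  false false = ≈-trans (≈-sym ι-1-*) (drop′ (≈-trans (≈-sym (drop o)) (≈-trans (≈-sym (drop o)) o)))

  ∑-insertions : ∀ {n} (π : Permutation′ n) w {c} → c ∈ cycles π →
    ∑ (allFin n) (λ j → if does (c ≟ₛ cycle π j) then w (insertState (ascent π j) (arcAtValley π j) (cycleState π c)) else 0#)
    ≈ grow w (cycleState π c)
  ∑-insertions {n} π w {c} c∈ with x , refl ← ∈-cycles⁻ π c∈ = begin
    ∑ (allFin n) (λ j → if does (c ≟ₛ cycle π j) then F (ascent π j) (arcAtValley π j) else 0#)
      ≈⟨ ∑-cong (allFin n) (λ j → reflexive (cong (λ b → if b then F (ascent π j) (arcAtValley π j) else 0#) (lookup-cycle≡does π x j))) ⟨
    ∑ (allFin n) (λ j → if lookup c j then F (ascent π j) (arcAtValley π j) else 0#)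
      ≈⟨ ∑-by-arc (allFin n) (lookup c) (ascent π) (arcAtValley π) F ⟩
    ι (within c (λ i → ascent π i ∧ arcAtValley π i)) * F true true
    + ι (within c (λ i → ascent π i ∧ not (arcAtValley π i))) * F true false
    + ι (within c (λ i → not (ascent π i) ∧ arcAtValley π i)) * F false true
    + ι (within c (λ i → not (ascent π i) ∧ not (arcAtValley π i))) * F false false
      ≈⟨ +-cong (+-cong (+-cong (ι-subst (arcs-ascent-valley π x)) (ι-subst (arcs-ascent-rest π x)))
           (ι-subst (arcs-descent-valley π x))) (ι-subst (arcs-descent-rest π x)) ⟩
    grow w (cycleState π c) ∎
    where
    F : Bool → Bool → Carrier
    F p q = w (insertState p q (cycleState π c))
    ι-subst : ∀ {k l y} → k ≡ l → ι k * y ≈ ι l * y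
    ι-subst p = *-congʳ (reflexive (cong ι p))

  M-insertions : ∀ {n} (π : Permutation′ n) Ws →
    ∑ (allFin (suc n)) (λ j → M (states (insert₀ j π)) Ws)
    ≈ ∑ₚ Ws (λ w Ws′ → w fixed * M (states π) Ws′ + M (states π) (grow w ∷ Ws′))
  M-insertions {n} π Ws = begin
    ∑ (allFin (suc n)) (λ j → M (states (insert₀ j π)) Ws)
      ≈⟨ ⨁-allFin +-commutativeMonoid (λ j → M (states (insert₀ j π)) Ws) ⟩
    M (states (insert₀ 0F π)) Ws + ∑ (allFin n) (λ j → M (states (insert₀ (Fin.suc j) π)) Ws)
      ≈⟨ +-cong (M-↭ Ws (states-insert₀-0 π)) (∑-cong (allFin n) expand) ⟩
    ∑ₚ Ws (λ w Ws′ → w fixed * M (states π) Ws′)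
      + ∑ (allFin n) (λ j → ∑ₚ cs (λ c cs′ → if does (c ≟ₛ cycle π j) then M (new j c ∷ map st cs′) Ws else 0#))
      ≈⟨ +-congˡ (∑-∑ₚ-swap (allFin n) cs _) ⟩
    ∑ₚ Ws (λ w Ws′ → w fixed * M (states π) Ws′)
      + ∑ₚ cs (λ c cs′ → ∑ (allFin n) (λ j → if does (c ≟ₛ cycle π j) then M (new j c ∷ map st cs′) Ws else 0#))
      ≈⟨ +-congˡ (∑ₚ-cong-↭ cs inner) ⟩
    ∑ₚ Ws (λ w Ws′ → w fixed * M (states π) Ws′)
      + ∑ₚ cs (λ c cs′ → ∑ₚ Ws (λ w Ws′ → grow w (st c) * M (map st cs′) Ws′))
      -- Column expansion read backwards: choosing the enlarged cycle and its partner `w` amounts to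
      -- matching with `grow w` in place of `w`.
      ≈⟨ +-congˡ (≈-trans (∑ₚ-swap cs Ws _) (∑ₚ-cong Ws λ w Ws′ →
           ≈-sym (≈-trans (M-column (states π) (grow w) Ws′) (∑ₚ-map st cs _)))) ⟩
    ∑ₚ Ws (λ w Ws′ → w fixed * M (states π) Ws′) + ∑ₚ Ws (λ w Ws′ → M (states π) (grow w ∷ Ws′))
      ≈⟨ ∑ₚ-+ Ws _ _ ⟨
    ∑ₚ Ws (λ w Ws′ → w fixed * M (states π) Ws′ + M (states π) (grow w ∷ Ws′)) ∎
    where
    cs = cycles π
    st = cycleState π
    new : Fin n → Subset n → CycleState
    new j c = insertState (ascent π j) (arcAtValley π j) (st c)

    expand : ∀ j → M (states (insert₀ (Fin.suc j) π)) Ws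
      ≈ ∑ₚ cs (λ c cs′ → if does (c ≟ₛ cycle π j) then M (new j c ∷ map st cs′) Ws else 0#)
    expand j = begin
      M (map st′ (cycles (insert₀ (Fin.suc j) π))) Ws   ≈⟨ M-↭ Ws (↭-map⁺ st′ (cycles-insert₀-suc π j)) ⟩
      M (map st′ (map (extend π j) cs)) Ws              ≈⟨ reflexive (cong (λ L → M L Ws) (≡.sym (List.map-∘ cs))) ⟩
      M (map (st′ ∘ extend π j) cs) Ws                  ≈⟨ ⨁ₚ-update +-commutativeMonoid _≟ₛ_ (λ L → M L Ws) (M-↭ Ws) st (new j) (st′ ∘ extend π j)
                                                             (cycle π j) (cycles-unique π) (∈-cycles⁺ π j) (cycleState-insert₀ π j) ⟩
      ∑ₚ cs (λ c cs′ → if does (c ≟ₛ cycle π j) then M (new j c ∷ map st cs′) Ws else 0#) ∎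
      where
      st′ = cycleState (insert₀ (Fin.suc j) π)

    inner : ∀ c cs′ → cs ↭ c ∷ cs′ →
      ∑ (allFin n) (λ j → if does (c ≟ₛ cycle π j) then M (new j c ∷ map st cs′) Ws else 0#)
      ≈ ∑ₚ Ws (λ w Ws′ → grow w (st c) * M (map st cs′) Ws′)
    inner c cs′ p = begin
      ∑ (allFin n) (λ j → if does (c ≟ₛ cycle π j) then ∑ₚ Ws (λ w Ws′ → w (new j c) * M (map st cs′) Ws′) else 0#)
        ≈⟨ ∑-cong (allFin n) (λ j → ≈-trans (if-∑ₚ (does (c ≟ₛ cycle π j)) Ws _) (∑ₚ-cong Ws λ w Ws′ → if-* (does (c ≟ₛ cycle π j)))) ⟩
      ∑ (allFin n) (λ j → ∑ₚ Ws (λ w Ws′ → (if does (c ≟ₛ cycle π j) then w (new j c) else 0#) * M (map st cs′) Ws′))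
        ≈⟨ ∑-∑ₚ-swap (allFin n) Ws _ ⟩
      ∑ₚ Ws (λ w Ws′ → ∑ (allFin n) (λ j → (if does (c ≟ₛ cycle π j) then w (new j c) else 0#) * M (map st cs′) Ws′))
        ≈⟨ ∑ₚ-cong Ws (λ w Ws′ → ≈-trans (∑-*ʳ _ (allFin n) _) (*-congʳ (∑-insertions π w (∈-resp-↭ (↭-sym p) (here refl))))) ⟩
      ∑ₚ Ws (λ w Ws′ → grow w (st c) * M (map st cs′) Ws′) ∎
      where
      if-∑ₚ : ∀ b (Ws : List Weight) F → (if b then ∑ₚ Ws F else 0#) ≈ ∑ₚ Ws (λ w Ws′ → if b then F w Ws′ else 0#)
      if-∑ₚ true  Ws F = ≈-refl
      if-∑ₚ false Ws F = ≈-sym (∑ₚ-0 Ws)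
      if-* : ∀ b {x y} → (if b then x * y else 0#) ≈ (if b then x else 0#) * y
      if-* true  = ≈-refl
      if-* false = ≈-sym (zeroˡ _)

  E : ℕ → List Weight → Carrier
  E n Ws = ∑ (permutations n) (λ π → M (states π) Ws)

  ∑-permutations-suc : ∀ n (f : Permutation′ (suc n) → Carrier) →
    ∑ (permutations (suc n)) f ≈ ∑ (permutations n) (λ π → ∑ (allFin (suc n)) (λ j → f (insert₀ j π)))
  ∑-permutations-suc n f = ≈-trans (⨁-cartesianProductWith +-commutativeMonoid insert₀ (allFin (suc n)) (permutations n) f)
    (∑-swap (allFin (suc n)) (permutations n) _)

  E-zero : ∀ Ws → E 0 Ws ≈ M [] Ws
  E-zero Ws = +-identityʳ _

  E-suc : ∀ n Ws → E (suc n) Ws ≈ ∑ₚ Ws (λ w Ws′ → w fixed * E n Ws′ + E n (grow w ∷ Ws′))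
  E-suc n Ws = begin
    E (suc n) Ws
      ≈⟨ ∑-permutations-suc n _ ⟩
    ∑ (permutations n) (λ π → ∑ (allFin (suc n)) (λ j → M (states (insert₀ j π)) Ws))
      ≈⟨ ∑-cong (permutations n) (λ π → M-insertions π Ws) ⟩
    ∑ (permutations n) (λ π → ∑ₚ Ws (λ w Ws′ → w fixed * M (states π) Ws′ + M (states π) (grow w ∷ Ws′)))
      ≈⟨ ∑-∑ₚ-swap (permutations n) Ws _ ⟩
    ∑ₚ Ws (λ w Ws′ → ∑ (permutations n) (λ π → w fixed * M (states π) Ws′ + M (states π) (grow w ∷ Ws′)))
      ≈⟨ ∑ₚ-cong Ws (λ w Ws′ → ≈-trans (∑-+ (permutations n) _ _) (+-congʳ (∑-*ˡ _ (permutations n) _))) ⟩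
    ∑ₚ Ws (λ w Ws′ → w fixed * E n Ws′ + E n (grow w ∷ Ws′)) ∎

  E-0 : ∀ n w Ws → (∀ σ → w σ ≈ 0#) → E n (w ∷ Ws) ≈ 0#
  E-0 n w Ws w≈0 = ≈-trans (∑-cong (permutations n) λ π → M-0 (states π) w Ws w≈0) (∑-0 (permutations n))

  module _ (s t : Carrier) where

    stateWeight : CycleState → Carrier
    stateWeight (m , e , v) = s ^ v * t ^ e

    -- Each entry is an indicator times a factor depending on its row alone, and the row factors
    -- come out of the permanent.
    M-cycleWeights : ∀ L ds → M L (map (cycleWeight s t) ds) ≈ ι (Matching.matchings (map proj₁ L) ds) * ∏ L stateWeight
    M-cycleWeights []      []       = ≈-sym (≈-trans ι-1-* ≈-refl)
    M-cycleWeights []      (d ∷ ds) = ≈-sym (zeroˡ _)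
    M-cycleWeights (σ@(m , e , v) ∷ L) ds = begin
      ∑ₚ (map (cycleWeight s t) ds) (λ w Ws′ → w σ * M L Ws′)
        ≈⟨ ∑ₚ-map (cycleWeight s t) ds _ ⟩
      ∑ₚ ds (λ d ds′ → cycleWeight s t d σ * M L (map (cycleWeight s t) ds′))
        ≈⟨ ∑ₚ-cong ds (λ d ds′ → ≈-trans (*-cong (≈-trans (bit-* (does (m ℕ.≟ d))) (reflexive (cong (λ b → ι (bit b) * stateWeight σ) (≟-sym m d)))) (M-cycleWeights L ds′))
             (≈-trans (interchange _ _ _ _) (*-congʳ (≈-sym (ι-* (Matching.is d m) (Matching.matchings (map proj₁ L) ds′)))))) ⟩
      ∑ₚ ds (λ d ds′ → ι (Matching.is d m ℕ.* Matching.matchings (map proj₁ L) ds′) * (stateWeight σ * ∏ L stateWeight))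
        ≈⟨ ≈-trans (∑ₚ-*ʳ _ ds _) (*-congʳ (∑ₚ-ι ds _)) ⟩
      ι (∑ℕₚ ds (λ d ds′ → Matching.is d m ℕ.* Matching.matchings (map proj₁ L) ds′)) * ∏ (σ ∷ L) stateWeight
        ≈⟨ *-congʳ (reflexive (cong ι (≡.sym (SemiringFold.∑ₚ-map ℕ.+-*-commutativeSemiring Matching.is ds _)))) ⟩
      ι (Matching.matchings (m ∷ map proj₁ L) ds) * ∏ (σ ∷ L) stateWeight ∎
      where
      ≟-sym : ∀ m d → does (m ℕ.≟ d) ≡ does (d ℕ.≟ m)
      ≟-sym m d = does-⇔ (mk⇔ ≡.sym ≡.sym) (m ℕ.≟ d) (d ℕ.≟ m)

    ∏-states : ∀ {n} (π : Permutation′ n) → ∏ (states π) stateWeight ≈ s ^ cval π * t ^ exc π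
    ∏-states {n} π = begin
      ∏ (map (cycleState π) (cycles π)) stateWeight
        ≈⟨ ∏-map (cycleState π) (cycles π) stateWeight ⟩
      ∏ (cycles π) (λ c → s ^ within c (valley π) * t ^ within c (ascent π))
        ≈⟨ ≈-trans (∏-* (cycles π) _ _) (*-cong (∏-^ s (cycles π) _) (∏-^ t (cycles π) _)) ⟩
      s ^ ∑ℕ (cycles π) (λ c → within c (valley π)) * t ^ ∑ℕ (cycles π) (λ c → within c (ascent π))
        ≈⟨ reflexive (cong₂ (λ k l → s ^ k * t ^ l) (gather (valley π) cval≡) (gather (ascent π) (exc-ascents π))) ⟩
      s ^ cval π * t ^ exc π ∎
      where
      ∏-^ : ∀ {a} {A : Set a} x (xs : List A) f → ∏ xs (λ y → x ^ f y) ≈ x ^ ∑ℕ xs f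
      ∏-^ x []       f = ≈-refl
      ∏-^ x (y ∷ xs) f = ≈-trans (*-congˡ (∏-^ x xs f)) (≈-sym (^-homo-* x (f y) (∑ℕ xs f)))
      cval≡ : cval π ≡ ∑ℕ (allFin n) (bit ∘ valley π)
      cval≡ = length-filter _ (allFin n)
      gather : ∀ f {k} → k ≡ ∑ℕ (allFin n) (bit ∘ f) → ∑ℕ (cycles π) (λ c → within c f) ≡ k
      gather f p = ≡.trans (∑-within-cycles π f) (≡.sym p)

  module _ (a b : Carrier) where

    -- A new fixed point or insertion into one of the `exc π` ascending arcs keeps the number of
    -- excedances; the other `n ∸ exc π` insertions raise it. This is one step of `U`, and `k`
    -- counts the steps still to come.
    ∑-U : ∀ n k → ∑ (permutations n) (λ π → U a b k (suc (exc π)) (n ∸ exc π)) ≈ U a b (n ℕ.+ k) 1 0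
    ∑-U zero    k = +-identityʳ _
    ∑-U (suc n) k = begin
      ∑ (permutations (suc n)) (λ π → U a b k (suc (exc π)) (suc n ∸ exc π))
        ≈⟨ ∑-permutations-suc n _ ⟩
      ∑ (permutations n) (λ π → ∑ (allFin (suc n)) (λ j → F (exc (insert₀ j π))))
        ≈⟨ ∑-cong (permutations n) step ⟩
      ∑ (permutations n) (λ π → U a b (suc k) (suc (exc π)) (n ∸ exc π))
        ≈⟨ ∑-U n (suc k) ⟩
      U a b (n ℕ.+ suc k) 1 0
        ≈⟨ reflexive (cong (λ m → U a b m 1 0) (ℕ.+-suc n k)) ⟩
      U a b (suc n ℕ.+ k) 1 0 ∎
      where
      F : ℕ → Carrier
      F e = U a b k (suc e) (suc n ∸ e)

      step : ∀ π → ∑ (allFin (suc n)) (λ j → F (exc (insert₀ j π))) ≈ U a b (suc k) (suc (exc π)) (n ∸ exc π)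
      step π = begin
        ∑ (allFin (suc n)) (λ j → F (exc (insert₀ j π)))
          ≈⟨ ⨁-allFin +-commutativeMonoid (λ j → F (exc (insert₀ j π))) ⟩
        F (exc (insert₀ 0F π)) + ∑ (allFin n) (λ j → F (exc (insert₀ (Fin.suc j) π)))
          ≈⟨ +-cong (reflexive (cong F (exc-insert₀-0 π))) (∑-cong (allFin n) λ j →
               ≈-trans (reflexive (cong F (exc-insert₀-suc π j))) (choose (ascent π j))) ⟩
        F e + ∑ (allFin n) (λ j → ι (bit (ascent π j)) * F e + ι (bit (not (ascent π j))) * F (suc e))
          ≈⟨ +-congˡ (≈-trans (∑-+ (allFin n) _ _) (+-cong (∑-ι-* (allFin n) _ _) (∑-ι-* (allFin n) _ _))) ⟩
        F e + (ι (∑ℕ (allFin n) (bit ∘ ascent π)) * F e + ι (∑ℕ (allFin n) (bit ∘ not ∘ ascent π)) * F (suc e))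
          ≈⟨ +-congˡ (+-cong (*-congʳ (reflexive (cong ι (≡.sym (exc-ascents π))))) (*-congʳ (reflexive (cong ι descents≡)))) ⟩
        F e + (ι e * F e + ι (n ∸ e) * F (suc e))
          ≈⟨ +-assoc _ _ _ ⟨
        F e + ι e * F e + ι (n ∸ e) * F (suc e)
          ≈⟨ +-congʳ (≈-trans (distribʳ _ _ _) (+-congʳ (*-identityˡ _))) ⟨
        ι (suc e) * F e + ι (n ∸ e) * F (suc e)
          ≈⟨ +-congʳ (*-congˡ (reflexive (cong (U a b k (suc e)) (ℕ.+-∸-assoc 1 e≤n)))) ⟩
        U a b (suc k) (suc e) (n ∸ e) ∎
        where
        e = exc π
        e≤n : e ≤ n
        e≤n = ℕ.≤-trans (ℕ.m≤m+n e _) (ℕ.≤-reflexive (≡.sym (exc-complement π)))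
        descents≡ : ∑ℕ (allFin n) (bit ∘ not ∘ ascent π) ≡ n ∸ e
        descents≡ = ≡.sym (≡.trans (cong (_∸ e) (exc-complement π)) (ℕ.m+n∸m≡n e _))
        choose : ∀ p → F (if p then e else suc e) ≈ ι (bit p) * F e + ι (bit (not p)) * F (suc e)
        choose true  = ≈-trans (≈-sym ι-1-*) (drop (zeroˡ _))
        choose false = ≈-trans (≈-sym ι-1-*) (drop′ (zeroˡ _))

-- The substitution

module Regularity {c ℓ} (R : CommutativeRing c ℓ) where
  open CommutativeRing R renaming (refl to ≈-refl; trans to ≈-trans; sym to ≈-sym)
  open RingProperties ring using (-‿distribʳ-*; x∙y⁻¹≈ε⇒x≈y)

  -- Denominators such as `s` and `t` are not invertible, so cancellation of non-zero-divisors takes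
  -- the place of division.
  record Regular (a : Carrier) : Set (c ⊔ ℓ) where
    constructor regular
    field annihilates-0 : ∀ x → a * x ≈ 0# → x ≈ 0#

  cancel : ∀ {a x y} → Regular a → a * x ≈ a * y → x ≈ y
  cancel {a} {x} {y} (regular reg) p = x∙y⁻¹≈ε⇒x≈y x y (reg (x - y)
    (≈-trans (distribˡ a x (- y)) (≈-trans (+-cong p (≈-sym (-‿distribʳ-* a y))) (-‿inverseʳ _))))

  regular-* : ∀ {a b} → Regular a → Regular b → Regular (a * b)
  regular-* (regular ra) (regular rb) = regular λ x p → rb x (ra _ (≈-trans (≈-sym (*-assoc _ _ _)) p))

  regular-unit : ∀ {a b} → b * a ≈ 1# → Regular a
  regular-unit {a} {b} p = regular λ x q →
    ≈-trans (≈-sym (≈-trans (≈-sym (*-assoc b a x)) (≈-trans (*-congʳ p) (*-identityˡ x))))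
      (≈-trans (*-congˡ q) (zeroʳ b))

  regular-cong : ∀ {a b} → a ≈ b → Regular a → Regular b
  regular-cong p (regular reg) = regular λ x q → reg x (≈-trans (*-congʳ p) q)

module SubstitutionIdentities {c ℓ} (R : CommutativeRing c ℓ)
  (φ : CommutativeRing.rawRing ℚ.+-*-commutativeRing -Raw-AlmostCommutative⟶ fromCommutativeRing R) where
  open CommutativeRing R renaming (refl to ≈-refl; trans to ≈-trans; sym to ≈-sym)
  open _-Raw-AlmostCommutative⟶_ φ using (⟦_⟧; *-homo; 1-homo)
  open Exp semiring using (_^_)
  open Regularity R

  private
    coeff≟ : ∀ p q → Maybe (⟦ p ⟧ ≈ ⟦ q ⟧)
    coeff≟ p q with p ℚ.≟ q
    ... | yes refl = just ≈-refl
    ... | no  _    = nothing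

    open RingSolver (CommutativeRing.rawRing ℚ.+-*-commutativeRing) (fromCommutativeRing R) φ coeff≟
      using (solve; con; _:=_; _:+_; _:*_; _:-_; _:^_)
    open ≈-Reasoning setoid

    -- Agrees with 1# by computation in ℚ[s]⟦t⟧, and is the form of 1 the solver understands.
    𝟙 : Carrier
    𝟙 = ⟦ ℚ.1ℚ ⟧

    2# 4# : Carrier
    2# = ⟦ + 2 / 1 ⟧
    4# = ⟦ + 4 / 1 ⟧

    regular-2 : Regular 2#
    regular-2 = regular-unit {b = ⟦ + 1 / 2 ⟧} (≈-trans (≈-sym (*-homo (+ 1 / 2) (+ 2 / 1))) 1-homo)

  module _ (s t √Δ u v w : Carrier)
    (√Δ² : √Δ ^ 2 ≈ (𝟙 + t) ^ 2 - 4# * s * t)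
    (u-def : (2# * (𝟙 - s) * t) * u ≈ (𝟙 + t ^ 2 - 2# * s * t) - (𝟙 - t) * √Δ)
    (v-def : (2# * s * t) * v ≈ ((𝟙 + t) ^ 2 - 2# * s * t) - (𝟙 + t) * √Δ)
    (w-def : (𝟙 + u * v) * w ≈ 𝟙 + u)
    (regular-s : Regular s) (regular-1-s : Regular (𝟙 - s)) (regular-t : Regular t)
    (regular-1+t* : ∀ h → Regular (𝟙 + t * h))
    where

    private
      V₀ U₀ a b Δ : Carrier
      V₀ = ((𝟙 + t) ^ 2 - 2# * s * t) - (𝟙 + t) * √Δ
      U₀ = (𝟙 + t ^ 2 - 2# * s * t) - (𝟙 - t) * √Δ
      a  = 2# * s * t
      b  = 2# * (𝟙 - s) * t
      Δ  = (𝟙 + t) ^ 2 - 4# * s * t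

      -- The identities below hold modulo `√Δ ^ 2 ≈ Δ`; the solver proves them with an explicit
      -- multiple of the defect.
      no-defect : ∀ x k → x + k * (√Δ ^ 2 - Δ) ≈ x
      no-defect x k = ≈-trans (+-congˡ (≈-trans (*-congˡ (≈-trans (+-congʳ √Δ²) (-‿inverseʳ Δ))) (zeroʳ k))) (+-identityʳ x)

      regular-a : Regular a
      regular-a = regular-* (regular-* regular-2 regular-s) regular-t

      regular-b : Regular b
      regular-b = regular-* (regular-* regular-2 regular-1-s) regular-t

    -- After multiplication by `a * a`, the numerator `V₀` replaces `a * v`, and polynomials in `s`,
    -- `t` and `√Δ` remain to be compared.
    v-quadratic : s * t * (𝟙 + v) ^ 2 ≈ (𝟙 + t) ^ 2 * v
    v-quadratic = cancel regular-a (cancel regular-a (begin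
      a * (a * (s * t * (𝟙 + v) ^ 2))
        ≈⟨ solve 4 (λ s t a v → let 1ₚ = con ℚ.1ℚ in
             a :* (a :* (s :* t :* (1ₚ :+ v) :^ 2)) := s :* t :* (a :+ a :* v) :^ 2) ≈-refl s t a v ⟩
      s * t * (a + a * v) ^ 2
        ≈⟨ *-congˡ (*-cong a+V (*-congʳ a+V)) ⟩
      s * t * (a + V₀) ^ 2
        ≈⟨ solve 3 (λ s t D → let 1ₚ = con ℚ.1ℚ ; 2ₚ = con (+ 2 / 1) ; 4ₚ = con (+ 4 / 1)
                                  a = 2ₚ :* s :* t ; V₀ = ((1ₚ :+ t) :^ 2 :- 2ₚ :* s :* t) :- (1ₚ :+ t) :* D in
             s :* t :* (a :+ V₀) :^ 2 := (1ₚ :+ t) :^ 2 :* (a :* V₀)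
               :+ (s :* t :* (1ₚ :+ t) :^ 2) :* (D :^ 2 :- ((1ₚ :+ t) :^ 2 :- 4ₚ :* s :* t))) ≈-refl s t √Δ ⟩
      (𝟙 + t) ^ 2 * (a * V₀) + (s * t * (𝟙 + t) ^ 2) * (√Δ ^ 2 - Δ)
        ≈⟨ no-defect _ _ ⟩
      (𝟙 + t) ^ 2 * (a * V₀)
        ≈⟨ *-congˡ (*-congˡ v-def) ⟨
      (𝟙 + t) ^ 2 * (a * (a * v))
        ≈⟨ solve 3 (λ q a v → q :* (a :* (a :* v)) := a :* (a :* (q :* v))) ≈-refl ((𝟙 + t) ^ 2) a v ⟩
      a * (a * ((𝟙 + t) ^ 2 * v)) ∎))
      where
      a+V : a + a * v ≈ a + V₀
      a+V = +-congˡ v-def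

    private
      v′ : Carrier
      v′ = s * (𝟙 + v) ^ 2 - (2# + t) * v

    -- By the quadratic, `(𝟙 + t) ^ 2 * v` is a multiple of `t`, and it differs from `v` by another.
    -- This makes `𝟙 + v` and `𝟙 + u * v` regular.
    v-divisible : v ≈ t * v′
    v-divisible = begin
      v
        ≈⟨ solve 2 (λ t v → let 1ₚ = con ℚ.1ℚ ; 2ₚ = con (+ 2 / 1) in v := (1ₚ :+ t) :^ 2 :* v :- t :* (2ₚ :+ t) :* v) ≈-refl t v ⟩
      (𝟙 + t) ^ 2 * v - t * (2# + t) * v
        ≈⟨ +-congʳ v-quadratic ⟨
      s * t * (𝟙 + v) ^ 2 - t * (2# + t) * v
        ≈⟨ solve 5 (λ s t q w v → s :* t :* q :- t :* w :* v := t :* (s :* q :- w :* v)) ≈-refl s t ((𝟙 + v) ^ 2) (2# + t) v ⟩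
      t * v′ ∎

    -- Equivalent to (1 + u)(1 + v) = (1 + t)(1 + u v), which yields `w[1+v]`.
    u+v : u + v ≈ t * (𝟙 + u * v)
    u+v = cancel regular-a (cancel regular-b (begin
      b * (a * (u + v))
        ≈⟨ solve 4 (λ a b u v → b :* (a :* (u :+ v)) := a :* (b :* u) :+ b :* (a :* v)) ≈-refl a b u v ⟩
      a * (b * u) + b * (a * v)
        ≈⟨ +-cong (*-congˡ u-def) (*-congˡ v-def) ⟩
      a * U₀ + b * V₀
        ≈⟨ solve 3 (λ s t D → let 1ₚ = con ℚ.1ℚ ; 2ₚ = con (+ 2 / 1) ; 4ₚ = con (+ 4 / 1)
                                  a = 2ₚ :* s :* t ; V₀ = ((1ₚ :+ t) :^ 2 :- 2ₚ :* s :* t) :- (1ₚ :+ t) :* D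
                                  b = 2ₚ :* (1ₚ :- s) :* t ; U₀ = (1ₚ :+ t :^ 2 :- 2ₚ :* s :* t) :- (1ₚ :- t) :* D in
             a :* U₀ :+ b :* V₀ := t :* (a :* b :+ U₀ :* V₀)
               :+ (t :* (1ₚ :- t) :* (con (+ 0 / 1) :- (1ₚ :+ t))) :* (D :^ 2 :- ((1ₚ :+ t) :^ 2 :- 4ₚ :* s :* t))) ≈-refl s t √Δ ⟩
      t * (a * b + U₀ * V₀) + (t * (𝟙 - t) * (⟦ + 0 / 1 ⟧ - (𝟙 + t))) * (√Δ ^ 2 - Δ)
        ≈⟨ no-defect _ _ ⟩
      t * (a * b + U₀ * V₀)
        ≈⟨ *-congˡ (+-congˡ (*-cong u-def v-def)) ⟨
      t * (a * b + b * u * (a * v))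
        ≈⟨ solve 5 (λ t a b u v → let 1ₚ = con ℚ.1ℚ in
             t :* (a :* b :+ b :* u :* (a :* v)) := b :* (a :* (t :* (1ₚ :+ u :* v)))) ≈-refl t a b u v ⟩
      b * (a * (t * (𝟙 + u * v))) ∎))

    private
      regular-1+uv : Regular (𝟙 + u * v)
      regular-1+uv = regular-cong {𝟙 + t * (u * v′)} (+-congˡ (begin
        t * (u * v′)  ≈⟨ solve 3 (λ t u v′ → t :* (u :* v′) := u :* (t :* v′)) ≈-refl t u v′ ⟩
        u * (t * v′)  ≈⟨ *-congˡ v-divisible ⟨
        u * v         ∎)) (regular-1+t* (u * v′))

      regular-1+v : Regular (𝟙 + v)
      regular-1+v = regular-cong {𝟙 + t * v′} (+-congˡ (≈-sym v-divisible)) (regular-1+t* v′)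

    w[1+v] : w + w * v ≈ 𝟙 + t
    w[1+v] = cancel regular-1+uv (begin
      (𝟙 + u * v) * (w + w * v)
        ≈⟨ solve 3 (λ u v w → let 1ₚ = con ℚ.1ℚ in (1ₚ :+ u :* v) :* (w :+ w :* v) := (1ₚ :+ u :* v) :* w :* (1ₚ :+ v)) ≈-refl u v w ⟩
      (𝟙 + u * v) * w * (𝟙 + v)
        ≈⟨ *-congʳ w-def ⟩
      (𝟙 + u) * (𝟙 + v)
        ≈⟨ solve 2 (λ u v → let 1ₚ = con ℚ.1ℚ in (1ₚ :+ u) :* (1ₚ :+ v) := (1ₚ :+ u :* v) :+ (u :+ v)) ≈-refl u v ⟩
      (𝟙 + u * v) + (u + v)
        ≈⟨ +-congˡ u+v ⟩
      (𝟙 + u * v) + t * (𝟙 + u * v)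
        ≈⟨ solve 2 (λ q t → let 1ₚ = con ℚ.1ℚ in q :+ t :* q := q :* (1ₚ :+ t)) ≈-refl (𝟙 + u * v) t ⟩
      (𝟙 + u * v) * (𝟙 + t) ∎)

    w²v : w * (w * v) ≈ s * t
    w²v = cancel regular-1+v (cancel regular-1+v (begin
      (𝟙 + v) * ((𝟙 + v) * (w * (w * v)))
        ≈⟨ solve 2 (λ v w → let 1ₚ = con ℚ.1ℚ in (1ₚ :+ v) :* ((1ₚ :+ v) :* (w :* (w :* v))) := (w :+ w :* v) :^ 2 :* v) ≈-refl v w ⟩
      (w + w * v) ^ 2 * v
        ≈⟨ *-congʳ (*-cong w[1+v] (*-congʳ w[1+v])) ⟩
      (𝟙 + t) ^ 2 * v
        ≈⟨ v-quadratic ⟨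
      s * t * (𝟙 + v) ^ 2
        ≈⟨ solve 2 (λ q v → let 1ₚ = con ℚ.1ℚ in q :* (1ₚ :+ v) :^ 2 := (1ₚ :+ v) :* ((1ₚ :+ v) :* q)) ≈-refl (s * t) v ⟩
      (𝟙 + v) * ((𝟙 + v) * (s * t)) ∎))


-- Non-zero-divisors among the power series

module SeriesSubstitution where
  private
    module P = Polynomial ℚ.+-*-commutativeRing
    module S = PowerSeries ℚ[s]
    module PR = CommutativeRing ℚ[s]
    module Sℚ = PowerSeries ℚ.+-*-commutativeRing

    coeff-+ : ∀ p q n → P.coeff (p P.+ q) n ≡ P.coeff p n ℚ.+ P.coeff q n
    coeff-+ []      q       n       = ≡.sym (ℚ.+-identityˡ _)
    coeff-+ (a ∷ p) []      n       = ≡.sym (ℚ.+-identityʳ _)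
    coeff-+ (a ∷ p) (b ∷ q) zero    = refl
    coeff-+ (a ∷ p) (b ∷ q) (suc n) = coeff-+ p q n

    coeff-scale : ∀ a q n → P.coeff (map (a ℚ.*_) q) n ≡ a ℚ.* P.coeff q n
    coeff-scale a []      n       = ≡.sym (ℚ.*-zeroʳ a)
    coeff-scale a (b ∷ q) zero    = refl
    coeff-scale a (b ∷ q) (suc n) = coeff-scale a q n

    coeff-X*-zero : ∀ q → P.coeff (P.X P.* q) 0 ≡ ℚ.0ℚ
    coeff-X*-zero q = ≡.trans (coeff-+ (map (ℚ.0ℚ ℚ.*_) q) (ℚ.0ℚ ∷ (map (ℚ.1ℚ ℚ.*_) q P.+ (ℚ.0ℚ ∷ []))) 0)
      (≡.trans (ℚ.+-identityʳ (P.coeff (map (ℚ.0ℚ ℚ.*_) q) 0))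
      (≡.trans (coeff-scale ℚ.0ℚ q 0) (ℚ.*-zeroˡ (P.coeff q 0))))

    coeff-X*-suc : ∀ q n → P.coeff (P.X P.* q) (suc n) ≡ P.coeff q n
    coeff-X*-suc q n = begin
      P.coeff (P.X P.* q) (suc n)
        ≡⟨ coeff-+ (map (ℚ.0ℚ ℚ.*_) q) (ℚ.0ℚ ∷ (map (ℚ.1ℚ ℚ.*_) q P.+ (ℚ.0ℚ ∷ []))) (suc n) ⟩
      P.coeff (map (ℚ.0ℚ ℚ.*_) q) (suc n) ℚ.+ P.coeff (map (ℚ.1ℚ ℚ.*_) q P.+ (ℚ.0ℚ ∷ [])) n
        ≡⟨ ≡.cong₂ ℚ._+_ (≡.trans (coeff-scale ℚ.0ℚ q (suc n)) (ℚ.*-zeroˡ (P.coeff q (suc n))))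
             (≡.trans (coeff-+ (map (ℚ.1ℚ ℚ.*_) q) (ℚ.0ℚ ∷ []) n) (≡.cong₂ ℚ._+_ (≡.trans (coeff-scale ℚ.1ℚ q n) (ℚ.*-identityˡ (P.coeff q n))) (0-at n))) ⟩
      ℚ.0ℚ ℚ.+ (P.coeff q n ℚ.+ ℚ.0ℚ)
        ≡⟨ ≡.trans (ℚ.+-identityˡ (P.coeff q n ℚ.+ ℚ.0ℚ)) (ℚ.+-identityʳ (P.coeff q n)) ⟩
      P.coeff q n ∎
      where
      open ≡.≡-Reasoning
      0-at : ∀ n → P.coeff (ℚ.0ℚ ∷ []) n ≡ ℚ.0ℚ
      0-at zero    = refl
      0-at (suc n) = refl

  open CommutativeRing ℚ[s]⟦t⟧ using (Carrier; _≈_; _+_; _*_; _-_; -_; 0#; 1#; *-assoc; +-cong; +-congˡ; *-identityˡ; zeroʳ; +-identityʳ; +-identityˡ)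
    renaming (refl to ≈-refl; trans to ≈-trans; sym to ≈-sym)
  open Defs using (s; t)
  open Regularity ℚ[s]⟦t⟧

  private
    0-at : ∀ n → 0# n PR.≈ PR.0#
    0-at zero    = PR.refl
    0-at (suc n) = PR.refl

  regular-t : Regular t
  regular-t = regular λ g p → S.ext λ n → PR.trans (PR.sym (S.X-*-suc g n)) (PR.trans (S.at p (suc n)) (PR.sym (0-at n)))

  regular-s : Regular s
  regular-s = regular λ g p → S.ext λ n → PR.trans (P.ext (Sℚ.ext λ k → begin
    P.coeff (g n) k                ≡⟨ coeff-X*-suc (g n) k ⟨
    P.coeff (P.X P.* g n) (suc k)  ≡⟨ Sℚ.at (P.coeffs (PR.trans (PR.sym (S.const-* P.X g n)) (PR.trans (S.at p n) (0-at n)))) (suc k) ⟩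
    ℚ.0ℚ                           ∎)) (PR.sym (0-at n))
    where open ≡.≡-Reasoning

  -- If `g ≈ s * g`, comparing coefficients of powers of `s` makes them vanish one after the other.
  regular-1-s : Regular (1# - s)
  regular-1-s = regular go
    where
    module _ (g : Carrier) (p : (1# - s) * g ≈ 0#) where
      g≈sg : g ≈ s * g
      g≈sg = RingProperties.x∙y⁻¹≈ε⇒x≈y (CommutativeRing.ring ℚ[s]⟦t⟧) g (s * g) (≈-trans
        (≈-sym (≈-trans (CommutativeRing.distribʳ ℚ[s]⟦t⟧ g 1# (- s)) (+-cong (*-identityˡ g)
          (≈-sym (RingProperties.-‿distribˡ-* (CommutativeRing.ring ℚ[s]⟦t⟧) s g))))) p)
      shift : ∀ n k → P.coeff (g n) k ≡ P.coeff (P.X P.* g n) k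
      shift n k = Sℚ.at (P.coeffs (PR.trans (S.at g≈sg n) (S.const-* P.X g n))) k
      vanish : ∀ n k → P.coeff (g n) k ≡ ℚ.0ℚ
      vanish n zero    = ≡.trans (shift n 0) (coeff-X*-zero (g n))
      vanish n (suc k) = ≡.trans (shift n (suc k)) (≡.trans (coeff-X*-suc (g n) k) (vanish n k))
      go : g ≈ 0#
      go = S.ext λ n → PR.trans (P.ext (Sℚ.ext (vanish n))) (PR.sym (0-at n))

  -- A coefficient of `t * (h * g)` involves only earlier coefficients of `g`, so strong induction
  -- applies.
  regular-1+t* : ∀ h → Regular (1# + t * h)
  regular-1+t* h = regular go
    where
    module _ (g : Carrier) (p : (1# + t * h) * g ≈ 0#) where
      eq : ∀ n → g n PR.+ (t * (h * g)) n PR.≈ PR.0#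
      eq n = PR.trans (S.at (≈-trans (≈-sym (≈-trans (CommutativeRing.distribʳ ℚ[s]⟦t⟧ g 1# (t * h))
        (+-cong (*-identityˡ g) (*-assoc t h g)))) p) n) (0-at n)
      below : ∀ k i → i < k → g i PR.≈ PR.0#
      below (suc k) zero    _         = PR.trans (PR.sym (PR.trans (PR.+-congˡ {g 0} (S.X-*-zero (h * g))) (PR.+-identityʳ (g 0)))) (eq 0)
      below (suc k) (suc i) (s≤s i<k) = PR.trans (PR.sym (PR.trans (PR.+-congˡ {g (suc i)} hg≈0) (PR.+-identityʳ (g (suc i))))) (eq (suc i))
        where
        hg≈0 : (t * (h * g)) (suc i) PR.≈ PR.0#
        hg≈0 = PR.trans (S.X-*-suc (h * g) i) (PR.trans
          (S.*-local i {h} {h} {g} {0#} (λ _ _ → PR.refl) (λ j j≤i → PR.trans (below k j (ℕ.≤-<-trans j≤i i<k)) (PR.sym (0-at j))))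
          (PR.trans (S.at (zeroʳ h) i) (0-at i)))
      go : g ≈ 0#
      go = S.ext λ n → PR.trans (below (suc n) n ℕ.≤-refl) (PR.sym (0-at n))


  module _ (σ : Substitution) where
    open Substitution σ

    w+wv : w + w * v ≈ 1# + t
    w+wv = SubstitutionIdentities.w[1+v] ℚ[s]⟦t⟧ fromℚ-morphism s t √Δ u v w √Δ² u-def v-def w-def
      regular-s regular-1-s regular-t regular-1+t*

    w*wv : w * (w * v) ≈ s * t
    w*wv = SubstitutionIdentities.w²v ℚ[s]⟦t⟧ fromℚ-morphism s t √Δ u v w √Δ² u-def v-def w-def
      regular-s regular-1-s regular-t regular-1+t*

-- Cycle types

/-*-cancel : ∀ a b .{{_ : NonZero b}} → (+ a / b) ℚ.* (+ b / 1) ≡ + a / 1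
/-*-cancel a (suc b) = ℚ.toℚᵘ-injective (begin
  toℚᵘ ((+ a / suc b) ℚ.* (+ suc b / 1))               ≈⟨ ℚ.toℚᵘ-homo-* (+ a / suc b) (+ suc b / 1) ⟩
  toℚᵘ (+ a / suc b) ℚᵘ.* toℚᵘ (+ suc b / 1)           ≈⟨ ℚᵘ.*-cong (ℚ.toℚᵘ-fromℚᵘ (mkℚᵘ (+ a) b)) (ℚ.toℚᵘ-fromℚᵘ (mkℚᵘ (+ suc b) 0)) ⟩
  mkℚᵘ (+ a) b ℚᵘ.* mkℚᵘ (+ suc b) 0                   ≈⟨ *≡* (≡.trans (ℤ.*-assoc (+ a) (+ suc b) (+ 1)) (cong (+ a ℤ.*_) (≡.sym (ℤ.pos-* (suc b) 1)))) ⟩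
  mkℚᵘ (+ a) 0                                         ≈⟨ ℚ.toℚᵘ-fromℚᵘ (mkℚᵘ (+ a) 0) ⟨
  toℚᵘ (+ a / 1)                                       ∎)
  where open ℚᵘ.≃-Reasoning

suc/1 : ∀ n → + suc n / 1 ≡ ℚ.1ℚ ℚ.+ (+ n / 1)
suc/1 n = ℚ.toℚᵘ-injective (begin
  toℚᵘ (+ suc n / 1)                ≈⟨ ℚ.toℚᵘ-fromℚᵘ (mkℚᵘ (+ suc n) 0) ⟩
  mkℚᵘ (+ suc n) 0                  ≈⟨ *≡* (cong (ℤ._* + 1) (≡.cong (λ k → + 1 ℤ.+ k) (≡.sym (ℤ.*-identityʳ (+ n))))) ⟩
  ℚᵘ.1ℚᵘ ℚᵘ.+ mkℚᵘ (+ n) 0          ≈⟨ ℚᵘ.+-congʳ ℚᵘ.1ℚᵘ (ℚ.toℚᵘ-fromℚᵘ (mkℚᵘ (+ n) 0)) ⟨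
  ℚᵘ.1ℚᵘ ℚᵘ.+ toℚᵘ (+ n / 1)        ≈⟨ ℚ.toℚᵘ-homo-+ ℚ.1ℚ (+ n / 1) ⟨
  toℚᵘ (ℚ.1ℚ ℚ.+ (+ n / 1))         ∎)
  where open ℚᵘ.≃-Reasoning

module _ {n} (λ′ : Partition n) where

  degrees : List ℕ
  degrees = map pred (parts λ′)

  parts≡ : parts λ′ ≡ map suc degrees
  parts≡ = go (positive λ′)
    where
    go : ∀ {ps} → All (0 <_) ps → ps ≡ map suc (map pred ps)
    go []                 = refl
    go (s≤s z≤n ∷ ps>0) = cong (_ ∷_) (go ps>0)

  sum-degrees : ℕ.sum (map suc degrees) ≡ n
  sum-degrees = ≡.trans (cong ℕ.sum (≡.sym parts≡)) (sum≡n λ′)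

  degrees<n : All (_< n) degrees
  degrees<n = All.map (λ p → ℕ.≤-trans p (ℕ.≤-reflexive sum-degrees)) (go degrees)
    where
    go : ∀ ds → All (_< ℕ.sum (map suc ds)) ds
    go []       = []
    go (d ∷ ds) = ℕ.m≤m+n (suc d) _ ∷ All.map (λ p → ℕ.≤-trans p (ℕ.m≤n+m _ (suc d))) (go ds)

  mult≡ : ∀ k → mult λ′ (suc k) ≡ multiplicity degrees k
  mult≡ k = ≡.trans (length-filter (suc k ℕ.≟_) (parts λ′))
    (≡.trans (cong (λ ps → ∑ℕ ps (λ p → bit (does (suc k ℕ.≟ p)))) parts≡) (∑ℕ-map suc degrees _))

  module _ (π : Permutation′ n) where

    private
      sizes : map suc (map proj₁ (states π)) ≡ map ∣_∣ (cycles π)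
      sizes = ≡.trans (≡.sym (List.map-∘ (states π))) (≡.trans (≡.sym (List.map-∘ (cycles π)))
        (List.map-cong-local (All.tabulate size)))
        where
        size : ∀ {c} → c ∈ cycles π → suc (pred ∣ c ∣) ≡ ∣ c ∣
        size c∈ with x , refl ← ∈-cycles⁻ π c∈ = ∣cycle∣>0 π x

      map-pred-suc : ∀ ks → map pred (map suc ks) ≡ ks
      map-pred-suc ks = ≡.trans (≡.sym (List.map-∘ ks)) (List.map-id ks)

    cycleType⇒↭ : cycleType π ≡ parts λ′ → map proj₁ (states π) ↭ degrees
    cycleType⇒↭ p = ↭-trans (↭-reflexive (≡.sym (map-pred-suc _))) (↭-map⁺ pred (↭-trans (↭-reflexive sizes)
      (↭-trans (↭-sym (InsertionSort.sort-↭ ℕ.≤-decTotalOrder (map ∣_∣ (cycles π)))) (↭-reflexive p))))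

    ↭⇒cycleType : map proj₁ (states π) ↭ degrees → cycleType π ≡ parts λ′
    ↭⇒cycleType p = ≋⇒≡ (↗↭↗⇒≋ ℕ.≤-totalOrder (InsertionSort.sort-↗ ℕ.≤-decTotalOrder (map ∣_∣ (cycles π))) (sorted λ′)
      (↭⇒↭ₛ (↭-trans (InsertionSort.sort-↭ ℕ.≤-decTotalOrder (map ∣_∣ (cycles π)))
        (↭-trans (↭-reflexive (≡.sym sizes)) (↭-trans (↭-map⁺ suc p) (↭-reflexive (≡.sym parts≡)))))))

    hasType? : Dec (cycleType π ≡ parts λ′)
    hasType? = List.≡-dec ℕ._≟_ (cycleType π) (parts λ′)

    matchings≡ : Matching.matchings (map proj₁ (states π)) degrees ≡ (if does hasType? then Matching.automorphisms degrees else 0)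
    matchings≡ = by-cases hasType?
      where
      by-cases : (d : Dec (cycleType π ≡ parts λ′)) →
        Matching.matchings (map proj₁ (states π)) degrees ≡ (if does d then Matching.automorphisms degrees else 0)
      by-cases (yes p) = Matching.matchings-↭ degrees (cycleType⇒↭ p)
      by-cases (no ¬p) = Matching.matchings-¬↭ degrees (¬p ∘ ↭⇒cycleType)

module _ where
  open CommutativeMonoidMult ℕ.*-1-commutativeMonoid using (×-distrib-+) renaming (_×_ to _·_)

  private
    ·≡^ : ∀ m x → m · x ≡ x ℕ.^ m
    ·≡^ zero    x = refl
    ·≡^ (suc m) x = cong (x ℕ.*_) (·≡^ m x)

  -- The cofactor of z λ′ in the product of all (part)! and (multiplicity)!.
  κ : ∀ {n} → Partition n → ℕ
  κ {n} λ′ = ∏ℕ (upTo n) (λ k → (k !) ℕ.^ mult λ′ (suc k))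

  κ≢0 : ∀ {n} (λ′ : Partition n) → NonZero (κ λ′)
  κ≢0 {n} λ′ = ℕ.product≢0 (All.map⁺ (All.universal (λ k → ℕ.m^n≢0 (k !) (mult λ′ (suc k)) {{k ℕ.!≢0}}) (upTo n)))

  -- Each (k+1)! splits as (k+1) times k!: the factors k+1 and the factorials of multiplicities form
  -- `z`, the factors k! form `κ`.
  fact-automorphisms : ∀ {n} (λ′ : Partition n) →
    ℕ.product (map (_! ∘ suc) (degrees λ′)) ℕ.* Matching.automorphisms (degrees λ′) ≡ z λ′ ℕ.* κ λ′
  fact-automorphisms {n} λ′ = begin
    ∏ℕ ds (_! ∘ suc) ℕ.* Matching.automorphisms ds
      ≡⟨ cong₂ ℕ._*_ (⨁-by-multiplicity ℕ.*-1-commutativeMonoid n (_! ∘ suc) (degrees<n λ′)) (Matching.automorphisms-! n (degrees<n λ′)) ⟩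
    ∏ℕ (upTo n) (λ k → multiplicity ds k · (suc k !)) ℕ.* ∏ℕ (upTo n) (λ k → multiplicity ds k !)
      ≡⟨ ∏ℕ-* (upTo n) _ _ ⟨
    ∏ℕ (upTo n) (λ k → multiplicity ds k · (suc k !) ℕ.* multiplicity ds k !)
      ≡⟨ ∏ℕ-cong (upTo n) step ⟩
    ∏ℕ (upTo n) (λ k → z-factor λ′ k ℕ.* (k !) ℕ.^ mult λ′ (suc k))
      ≡⟨ ∏ℕ-* (upTo n) _ _ ⟩
    z λ′ ℕ.* κ λ′ ∎
    where
    open ≡-Reasoning
    ds = degrees λ′
    step : ∀ k → multiplicity ds k · (suc k !) ℕ.* multiplicity ds k ! ≡ z-factor λ′ k ℕ.* (k !) ℕ.^ mult λ′ (suc k)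
    step k = begin
      multiplicity ds k · (suc k !) ℕ.* multiplicity ds k !  ≡⟨ cong (λ m → m · (suc k !) ℕ.* m !) (mult≡ λ′ k) ⟨
      m · (suc k !) ℕ.* m !                                  ≡⟨ cong (ℕ._* m !) (≡.trans (×-distrib-+ (suc k) (k !) m) (cong₂ ℕ._*_ (·≡^ m (suc k)) (·≡^ m (k !)))) ⟩
      suc k ℕ.^ m ℕ.* (k !) ℕ.^ m ℕ.* m !                    ≡⟨ xy∙z≈xz∙y (suc k ℕ.^ m) ((k !) ℕ.^ m) (m !) ⟩
      suc k ℕ.^ m ℕ.* m ! ℕ.* (k !) ℕ.^ m                    ∎
      where
      m = mult λ′ (suc k)
      open CommutativeSemigroupProperties ℕ.*-commutativeSemigroup using (xy∙z≈xz∙y)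

-- Degree of w in the cycle polynomial: fixed points contribute nothing.
exponent : ℕ → ℕ
exponent zero    = 0
exponent (suc d) = suc (suc d)

sum-exponent : ∀ ds → ℕ.sum (map suc ds) ≡ multiplicity ds 0 ℕ.+ ℕ.sum (map exponent ds)
sum-exponent []           = refl
sum-exponent (zero  ∷ ds) = cong suc (sum-exponent ds)
sum-exponent (suc d ∷ ds) = ≡.trans (cong (suc (suc d) ℕ.+_) (sum-exponent ds))
  (x∙yz≈y∙xz (suc (suc d)) (multiplicity ds 0) (ℕ.sum (map exponent ds)))
  where open CommutativeSemigroupProperties ℕ.+-commutativeSemigroup using (x∙yz≈y∙xz)

-- The formula for a given cycle type

module CycleTypeFormula {c ℓ} (R : CommutativeRing c ℓ)
  (φ : CommutativeRing.rawRing ℚ.+-*-commutativeRing -Raw-AlmostCommutative⟶ fromCommutativeRing R) where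
  open CommutativeRing R renaming (refl to ≈-refl; trans to ≈-trans; sym to ≈-sym)
  open _-Raw-AlmostCommutative⟶_ φ using (⟦_⟧; *-homo; +-homo; 1-homo; 0-homo)
  open Exp semiring using (_^_; ^-homo-*; ^-congˡ)
  open CommutativeExp commutativeSemiring using (^-distrib-*)
  open CommutativeSemigroupProperties *-commutativeSemigroup using (interchange; x∙yz≈y∙xz; xy∙z≈xz∙y)
  open SemiringFold commutativeSemiring
  open Growth commutativeSemiring
  open CyclePolynomial commutativeSemiring
  open Enumeration commutativeSemiring
  open Regularity R
  open ≈-Reasoning setoid

  ⟦⟧-ι : ∀ n → ⟦ + n / 1 ⟧ ≈ ι n
  ⟦⟧-ι zero    = 0-homo
  ⟦⟧-ι (suc n) = ≈-trans (reflexive (cong ⟦_⟧ (suc/1 n))) (≈-trans (+-homo ℚ.1ℚ (+ n / 1)) (+-cong 1-homo (⟦⟧-ι n)))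

  fraction : ∀ a b .{{_ : NonZero b}} → ⟦ + a / b ⟧ * ι b ≈ ι a
  fraction a b = ≈-trans (*-congˡ (≈-sym (⟦⟧-ι b))) (≈-trans (≈-sym (*-homo (+ a / b) (+ b / 1)))
    (≈-trans (reflexive (cong ⟦_⟧ (/-*-cancel a b))) (⟦⟧-ι a)))

  regular-ι : ∀ n .{{_ : NonZero n}} → Regular (ι n)
  regular-ι n = regular-unit (≈-trans (fraction 1 n) ι-1)

  ι-^ : ∀ x m → ι (x ℕ.^ m) ≈ ι x ^ m
  ι-^ x zero    = ι-1
  ι-^ x (suc m) = ≈-trans (ι-* x (x ℕ.^ m)) (*-congˡ (ι-^ x m))

  ι-∏ : ∀ {a} {A : Set a} (xs : List A) f → ι (ListFold.⨁ ℕ.*-1-commutativeMonoid xs f) ≈ ∏ xs (ι ∘ f)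
  ι-∏ []       f = ι-1
  ι-∏ (x ∷ xs) f = ≈-trans (ι-* (f x) _) (*-congˡ (ι-∏ xs f))

  ∑-filter : ∀ {a p} {A : Set a} {P : A → Set p} (P? : Decidable P) xs f →
    ∑ (filter P? xs) f ≈ ∑ xs (λ x → if does (P? x) then f x else 0#)
  ∑-filter P? []       f = ≈-refl
  ∑-filter P? (x ∷ xs) f with does (P? x)
  ... | true  = +-congˡ (∑-filter P? xs f)
  ... | false = ≈-trans (∑-filter P? xs f) (≈-sym (+-identityˡ _))

  -- 𝔸 stands for the sequence of Eulerian polynomials evaluated at v.
  module _ (s t v w : Carrier) (w+wv : w + w * v ≈ 1# + t) (w*wv : w * (w * v) ≈ s * t)
    (𝔸 : ℕ → Carrier) (𝔸-zero : 𝔸 0 ≈ 1#)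
    (𝔸-suc : ∀ d → 𝔸 (suc d) ≈ ∑ (permutations (suc d)) (λ π → v ^ suc (exc π))) where

    -- For `suc d`, every term (w v)^(e+1) w^(d+1-e) of the Eulerian sum has degree d + 2 in `w`,
    -- which is the cycle length.
    total-𝔸 : ∀ d → total d (cycleWeight s t d) ≈ w ^ exponent d * 𝔸 d
    total-𝔸 zero    = *-congˡ (≈-sym 𝔸-zero)
    total-𝔸 (suc d) = begin
      total (suc d) (cycleWeight s t (suc d))
        ≈⟨ total≈U w (w * v) w*wv w+wv d ⟩
      U w (w * v) (suc d) 1 0
        ≈⟨ reflexive (cong (λ k → U w (w * v) k 1 0) (ℕ.+-identityʳ (suc d))) ⟨
      U w (w * v) (suc d ℕ.+ 0) 1 0
        ≈⟨ ∑-U w (w * v) (suc d) 0 ⟨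
      ∑ (permutations (suc d)) (λ π → (w * v) ^ suc (exc π) * w ^ (suc d ∸ exc π))
        ≈⟨ ∑-cong (permutations (suc d)) homogeneous ⟩
      ∑ (permutations (suc d)) (λ π → w ^ suc (suc d) * v ^ suc (exc π))
        ≈⟨ ∑-*ˡ _ (permutations (suc d)) _ ⟩
      w ^ suc (suc d) * ∑ (permutations (suc d)) (λ π → v ^ suc (exc π))
        ≈⟨ *-congˡ (𝔸-suc d) ⟨
      w ^ suc (suc d) * 𝔸 (suc d) ∎
      where
      homogeneous : ∀ π → (w * v) ^ suc (exc π) * w ^ (suc d ∸ exc π) ≈ w ^ suc (suc d) * v ^ suc (exc π)
      homogeneous π = begin
        (w * v) ^ suc e * w ^ (suc d ∸ e)                  ≈⟨ *-congʳ (^-distrib-* w v (suc e)) ⟩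
        w ^ suc e * v ^ suc e * w ^ (suc d ∸ e)            ≈⟨ xy∙z≈xz∙y _ _ _ ⟩
        w ^ suc e * w ^ (suc d ∸ e) * v ^ suc e            ≈⟨ *-congʳ (^-homo-* w (suc e) (suc d ∸ e)) ⟨
        w ^ (suc e ℕ.+ (suc d ∸ e)) * v ^ suc e            ≈⟨ reflexive (cong (λ k → w ^ suc k * v ^ suc e) (ℕ.m+[n∸m]≡n e≤d)) ⟩
        w ^ suc (suc d) * v ^ suc e                        ∎
        where
        e = exc π
        e≤d : e ≤ suc d
        e≤d = ℕ.≤-trans (ℕ.m≤m+n e _) (ℕ.≤-reflexive (≡.sym (exc-complement π)))

    module _ {n} (λ′ : Partition n) where

      private
        ds = degrees λ′
        Ds : List (ℕ × Weight)
        Ds = map (λ d → d , cycleWeight s t d) ds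

        lhs : Carrier
        lhs = ∑ (permutationsOfType λ′) (λ π → s ^ cval π * t ^ exc π)

        aut fact : ℕ
        aut  = Matching.automorphisms ds
        fact = ℕ.product (map (_! ∘ suc) ds)

        E≈ : E n (map (cycleWeight s t) ds) ≈ ι aut * lhs
        E≈ = begin
          ∑ (permutations n) (λ π → M (states π) (map (cycleWeight s t) ds))
            ≈⟨ ∑-cong (permutations n) (λ π → begin
                 M (states π) (map (cycleWeight s t) ds)
                   ≈⟨ M-cycleWeights s t (states π) ds ⟩
                 ι (Matching.matchings (map proj₁ (states π)) ds) * ∏ (states π) (stateWeight s t)
                   ≈⟨ *-cong (reflexive (cong ι (matchings≡ λ′ π))) (∏-states s t π) ⟩
                 ι (if does (hasType? λ′ π) then aut else 0) * (s ^ cval π * t ^ exc π)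
                   ≈⟨ if-ι (does (hasType? λ′ π)) ⟩
                 ι aut * (if does (hasType? λ′ π) then s ^ cval π * t ^ exc π else 0#) ∎) ⟩
          ∑ (permutations n) (λ π → ι aut * (if does (hasType? λ′ π) then s ^ cval π * t ^ exc π else 0#))
            ≈⟨ ∑-*ˡ _ (permutations n) _ ⟩
          ι aut * ∑ (permutations n) (λ π → if does (hasType? λ′ π) then s ^ cval π * t ^ exc π else 0#)
            ≈⟨ *-congˡ (∑-filter (hasType? λ′) (permutations n) _) ⟨
          ι aut * lhs ∎
          where
          if-ι : ∀ b {m x} → ι (if b then m else 0) * x ≈ ι m * (if b then x else 0#)
          if-ι true  = ≈-refl
          if-ι false = ≈-trans (zeroˡ _) (≈-sym (zeroʳ _))

        Ds-proj₁ : map (suc ∘ proj₁) Ds ≡ map suc ds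
        Ds-proj₁ = ≡.sym (List.map-∘ ds)

        closed : ι fact * (ι aut * lhs) ≈ ι (n !) * ∏ ds (λ d → w ^ exponent d * 𝔸 d)
        closed = begin
          ι fact * (ι aut * lhs)
            ≈⟨ *-cong (reflexive (cong (ι ∘ ℕ.product) (List.map-∘ ds))) (≈-trans (≈-sym E≈) (reflexive (cong (E n) (List.map-∘ ds)))) ⟩
          _
            ≈⟨ closed-form E E-zero E-suc E-0 n Ds
                 (All.map⁺ (All.universal (λ d → cycleWeight-concentrated s t d) ds))
                 (≡.trans (cong ℕ.sum Ds-proj₁) (sum-degrees λ′)) ⟩
          ι (n !) * ∏ Ds (λ D → total (proj₁ D) (proj₂ D))
            ≈⟨ *-congˡ (≈-trans (∏-map (λ d → d , cycleWeight s t d) ds _) (∏-cong ds total-𝔸)) ⟩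
          ι (n !) * ∏ ds (λ d → w ^ exponent d * 𝔸 d) ∎

        powers : ∏ ds (λ d → w ^ exponent d * 𝔸 d) ≈ w ^ (n ∸ mult λ′ 1) * ∏ (upTo n) (λ k → 𝔸 k ^ mult λ′ (suc k))
        powers = begin
          ∏ ds (λ d → w ^ exponent d * 𝔸 d)
            ≈⟨ ∏-* ds _ _ ⟩
          ∏ ds (λ d → w ^ exponent d) * ∏ ds 𝔸
            ≈⟨ *-cong (≈-trans (∏-w ds) (reflexive (cong (w ^_) exponents))) (≈-trans
                 (⨁-by-multiplicity *-commutativeMonoid n 𝔸 (degrees<n λ′))
                 (∏-cong (upTo n) λ k → reflexive (cong (𝔸 k ^_) (≡.sym (mult≡ λ′ k))))) ⟩
          w ^ (n ∸ mult λ′ 1) * ∏ (upTo n) (λ k → 𝔸 k ^ mult λ′ (suc k)) ∎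
          where
          ∏-w : ∀ ds → ∏ ds (λ d → w ^ exponent d) ≈ w ^ ℕ.sum (map exponent ds)
          ∏-w []       = ≈-refl
          ∏-w (d ∷ ds) = ≈-trans (*-congˡ (∏-w ds)) (≈-sym (^-homo-* w (exponent d) _))
          exponents : ℕ.sum (map exponent ds) ≡ n ∸ mult λ′ 1
          exponents = ≡.sym (≡.trans (cong₂ _∸_ (≡.trans (≡.sym (sum-degrees λ′)) (sum-exponent ds)) (mult≡ λ′ 0))
            (ℕ.m+n∸m≡n (multiplicity ds 0) _))

        rescale : ∏ (upTo n) (λ k → (⟦ _/_ (+ 1) (k !) {{k ℕ.!≢0}} ⟧ * 𝔸 k) ^ mult λ′ (suc k)) * ι (κ λ′)
                  ≈ ∏ (upTo n) (λ k → 𝔸 k ^ mult λ′ (suc k))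
        rescale = begin
          ∏ (upTo n) (λ k → (q k * 𝔸 k) ^ m k) * ι (κ λ′)
            ≈⟨ *-congˡ (ι-∏ (upTo n) _) ⟩
          ∏ (upTo n) (λ k → (q k * 𝔸 k) ^ m k) * ∏ (upTo n) (λ k → ι ((k !) ℕ.^ m k))
            ≈⟨ ∏-* (upTo n) _ _ ⟨
          ∏ (upTo n) (λ k → (q k * 𝔸 k) ^ m k * ι ((k !) ℕ.^ m k))
            ≈⟨ ∏-cong (upTo n) (λ k → begin
                 (q k * 𝔸 k) ^ m k * ι ((k !) ℕ.^ m k)  ≈⟨ *-congˡ (ι-^ (k !) (m k)) ⟩
                 (q k * 𝔸 k) ^ m k * ι (k !) ^ m k      ≈⟨ ^-distrib-* (q k * 𝔸 k) (ι (k !)) (m k) ⟨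
                 (q k * 𝔸 k * ι (k !)) ^ m k            ≈⟨ ^-congˡ (m k) (≈-trans (xy∙z≈xz∙y _ _ _) (≈-trans
                                                             (*-congʳ (≈-trans (fraction 1 (k !) {{k ℕ.!≢0}}) ι-1)) (*-identityˡ _))) ⟩
                 𝔸 k ^ m k                              ∎) ⟩
          ∏ (upTo n) (λ k → 𝔸 k ^ m k) ∎
          where
          m : ℕ → ℕ
          m k = mult λ′ (suc k)
          q : ℕ → Carrier
          q k = ⟦ _/_ (+ 1) (k !) {{k ℕ.!≢0}} ⟧

      formula : ∑ (permutationsOfType λ′) (λ π → s ^ cval π * t ^ exc π)
        ≈ ⟦ _/_ (+ (n !)) (z λ′) {{z≢0 λ′}} ⟧ * w ^ (n ∸ mult λ′ 1)
          * ∏ (upTo n) (λ k → (⟦ _/_ (+ 1) (k !) {{k ℕ.!≢0}} ⟧ * 𝔸 k) ^ mult λ′ (suc k))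
      -- Multiplying by `z` and `κ` clears all denominators; nonzero naturals are units here, hence
      -- regular.
      formula = cancel (regular-* (regular-ι (z λ′) {{z≢0 λ′}}) (regular-ι (κ λ′) {{κ≢0 λ′}})) (begin
        ι (z λ′) * ι (κ λ′) * lhs
          ≈⟨ *-congʳ (≈-trans (≈-sym (ι-* (z λ′) (κ λ′))) (≈-trans (reflexive (cong ι (≡.sym (fact-automorphisms λ′)))) (ι-* fact aut))) ⟩
        ι fact * ι aut * lhs
          ≈⟨ ≈-trans (*-assoc _ _ _) closed ⟩
        ι (n !) * ∏ ds (λ d → w ^ exponent d * 𝔸 d)
          ≈⟨ *-cong (≈-sym (fraction (n !) (z λ′) {{z≢0 λ′}})) (≈-trans powers (*-congˡ (≈-sym rescale))) ⟩
        Q * ι (z λ′) * (W * (Π * ι (κ λ′)))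
          ≈⟨ solve 5 (λ Q Z W Π K → Q :* Z :* (W :* (Π :* K)) := Z :* K :* (Q :* W :* Π)) ≈-refl Q (ι (z λ′)) W Π (ι (κ λ′)) ⟩
        ι (z λ′) * ι (κ λ′) * (Q * W * Π) ∎)
        where
        open NaturalSolver commutativeSemiring using (solve; _:=_; _:*_)
        Q = ⟦ _/_ (+ (n !)) (z λ′) {{z≢0 λ′}} ⟧
        W = w ^ (n ∸ mult λ′ 1)
        Π = ∏ (upTo n) (λ k → (⟦ _/_ (+ 1) (k !) {{k ℕ.!≢0}} ⟧ * 𝔸 k) ^ mult λ′ (suc k))

open import Defs
open import Algebra.Properties.Semiring.Exp (CommutativeRing.semiring ℚ[s]⟦t⟧) using (_^_)
open import Data.Nat.Properties using (_!≢0)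
open CommutativeRing ℚ[s]⟦t⟧ using (_≈_; _*_)

theorem1 : (σ : Substitution) → let open Substitution σ in
    (n : ℕ) .{{_ : NonZero n}} (λ′ : Partition n) →
    ∑ (permutationsOfType λ′) (λ π → s ^ cval π * t ^ exc π)
    ≈ fromℚ (_/_ (+ (n !)) (z λ′) {{z≢0 λ′}})
    * w ^ (n ∸ mult λ′ 1)
    * ∏ (upTo n) (λ k → (fromℚ (_/_ (+ 1) (k !) {{k !≢0}}) * A k v) ^ mult λ′ (suc k))
theorem1 σ n λ′ = CycleTypeFormula.formula ℚ[s]⟦t⟧ fromℚ-morphism s t v w
  (SeriesSubstitution.w+wv σ) (SeriesSubstitution.w*wv σ) (λ k → A k v) ≈-refl (λ d → ≈-refl) λ′
  where
  open Substitution σ using (v; w)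
  open CommutativeRing ℚ[s]⟦t⟧ using () renaming (refl to ≈-refl)
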